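{- For the Server Cloud Scheduling problem restricted to chain task graphs there is an FPTAS with respect to the cost objective (minimize cost subject to makespan at most a given deadline $d$) and an FPTAS with respect to the makespan objective (minimize makespan subject to cost at most a given budget $b$).
   Context: Server Cloud Scheduling: the input is a directed acyclic task graph $G=(\mathcal{J},E)$ with exactly one source $s$ and one sink $t$; each job $j\in\mathcal{J}$ has a server processing time $p_s(j)\in\mathbb{N}_0$ and a cloud processing time $p_c(j)\in\mathbb{N}_0$, where $p_s(s)=p_s(t)=0$ and $p_c(s)=p_c(t)=\infty$; each edge $(i,j)\in E$ has a communication delay $c(i,j)\in\mathbb{N}_0$. There is one server machine (processing at most one job at a time) and unboundedly many cloud machines. A schedule is a partition $\mathcal{J}=\mathcal{J}_s\cup\mathcal{J}_c$ together with completion times $C:\mathcal{J}\to\mathbb{N}_0$; let $p_\pi(j)=p_s(j)$ if $j\in\mathcal{J}_s$ and $p_\pi(j)=p_c(j)$ if $j\in\mathcal{J}_c$. It is valid if (a) for distinct $i,j\in\mathcal{J}_s$: $C(i)\le C(j)-p_\pi(j)$ or $C(i)-p_\pi(i)\ge C(j)$; (b) for every edge $(i,j)$ with $i,j$ on the same side: $C(i)\le C(j)-p_\pi(j)$, and for every edge with $i,j$ on different sides: $C(i)+c(i,j)\le C(j)-p_\pi(j)$. The makespan is $C(t)$ and the cost is $\sum_{j\in\mathcal{J}_c}p_c(j)$. A chain task graph is one in which the jobs form a single directed path from $s$ to $t$. -}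

module Defs where

open import Data.Bool.Base using (if_then_else_)
open import Data.Fin.Base using (Fin; toℕ)
open import Data.Fin.Permutation using (Permutation′; _⟨$⟩ʳ_)
open import Data.Integer.Base as ℤ using (∣_∣)
open import Data.List.Base as List using (List; []; _∷_)
open import Data.List.Membership.Propositional using (_∈_)
open import Data.List.Relation.Unary.All as All using (All; []; _∷_)
open import Data.Maybe.Base as Maybe using (Maybe; just; nothing; maybe)
open import Data.Nat.Base
  using (ℕ; zero; suc; _+_; _*_; _∸_; _^_; _/_; _≤_; _≤ᵇ_)
open import Data.Nat.ListAction using (sum)
open import Data.Nat.Logarithm using (⌊log₂_⌋)
open import Data.Product.Base using (Σ-syntax; ∃-syntax; _×_; _,_; proj₁; proj₂)
open import Data.Rational.Base as ℚ using (ℚ; 1ℚ; Positive; ↥_; ↧ₙ_)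
open import Data.Rational.Properties using (pos⇒nonZero)
open import Data.Sum.Base using (_⊎_; inj₁; inj₂)
open import Data.Unit.Base using (⊤; tt)
import Data.Vec.Functional as Vector
open import Function.Bundles using (_⇔_)
open import Relation.Binary.Construct.Add.Supremum.NonStrict using ()
  renaming (_≤⁺_ to Lift≤)
open import Relation.Binary.Construct.Closure.Transitive using (TransClosure)
open import Relation.Binary.PropositionalEquality.Core using (_≡_; _≢_)
open import Relation.Nullary.Construct.Add.Supremum using (_⁺; ⊤⁺; [_])
open import Relation.Nullary.Negation.Core using (¬_)

------------------------------------------------------------------------
-- Model of computation
--
-- A simply typed first-order call-by-value language with unbounded loops
-- and logarithmic-cost arithmetic.  Except for numbers, values are shared
-- by reference, so variable access, construction and destruction take one
-- step.  Run times agree up to a polynomial with those of a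
-- logarithmic-cost RAM.

infixr 6 _`×_
infixr 5 _`⊎_

data Ty : Set where
  `1 `ℕ     : Ty
  _`×_ _`⊎_ : Ty → Ty → Ty
  `List     : Ty → Ty

⟦_⟧ : Ty → Set
⟦ `1 ⟧      = ⊤
⟦ `ℕ ⟧      = ℕ
⟦ σ `× τ ⟧  = ⟦ σ ⟧ × ⟦ τ ⟧
⟦ σ `⊎ τ ⟧  = ⟦ σ ⟧ ⊎ ⟦ τ ⟧
⟦ `List τ ⟧ = List ⟦ τ ⟧

-- Number of binary digits; ⌊log₂ 0 ⌋ is 0, so 0 has one digit.
bits : ℕ → ℕ
bits n = suc ⌊log₂ n ⌋

-- Encoding length, with numbers written in binary.
size : ∀ τ → ⟦ τ ⟧ → ℕ
size `1        _        = 1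
size `ℕ        n        = bits n
size (σ `× τ)  (x , y)  = suc (size σ x + size τ y)
size (σ `⊎ τ)  (inj₁ x) = suc (size σ x)
size (σ `⊎ τ)  (inj₂ y) = suc (size τ y)
size (`List τ) xs       = suc (sum (List.map (λ x → suc (size τ x)) xs))

`Bool : Ty
`Bool = `1 `⊎ `1

data Op : Ty → Set where
  add monus mul quot : Op `ℕ
  leq                : Op `Bool

applyOp : ∀ {τ} → Op τ → ℕ → ℕ → ⟦ τ ⟧
applyOp add   m n       = m + n
applyOp monus m n       = m ∸ n
applyOp mul   m n       = m * n
applyOp quot  m zero    = 0
applyOp quot  m (suc n) = m / suc n
applyOp leq   m n       = if m ≤ᵇ n then inj₁ tt else inj₂ tt

-- The schoolbook algorithms are at most quadratic in the number of digits.
opCost : ℕ → ℕ → ℕ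
opCost m n = (bits m + bits n) ^ 2

Ctx : Set
Ctx = List Ty

infix 4 _⊢_

data _⊢_ (Γ : Ctx) : Ty → Set where
  var      : ∀ {τ} → τ ∈ Γ → Γ ⊢ τ
  bind     : ∀ {σ τ} → Γ ⊢ σ → σ ∷ Γ ⊢ τ → Γ ⊢ τ
  lit      : ℕ → Γ ⊢ `ℕ
  op       : ∀ {τ} → Op τ → Γ ⊢ `ℕ → Γ ⊢ `ℕ → Γ ⊢ τ
  unit     : Γ ⊢ `1
  pair     : ∀ {σ τ} → Γ ⊢ σ → Γ ⊢ τ → Γ ⊢ σ `× τ
  fst      : ∀ {σ τ} → Γ ⊢ σ `× τ → Γ ⊢ σ
  snd      : ∀ {σ τ} → Γ ⊢ σ `× τ → Γ ⊢ τ
  inl      : ∀ {σ τ} → Γ ⊢ σ → Γ ⊢ σ `⊎ τ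
  inr      : ∀ {σ τ} → Γ ⊢ τ → Γ ⊢ σ `⊎ τ
  caseSum  : ∀ {ρ σ τ} → Γ ⊢ ρ `⊎ σ → ρ ∷ Γ ⊢ τ → σ ∷ Γ ⊢ τ → Γ ⊢ τ
  nil      : ∀ {τ} → Γ ⊢ `List τ
  cons     : ∀ {τ} → Γ ⊢ τ → Γ ⊢ `List τ → Γ ⊢ `List τ
  caseList : ∀ {σ τ} → Γ ⊢ `List σ → Γ ⊢ τ → σ ∷ `List σ ∷ Γ ⊢ τ → Γ ⊢ τ
  -- loop b e: starting from the state e, run b repeatedly; inj₁ is the
  -- next state, inj₂ exits with a result.
  loop     : ∀ {σ τ} → σ ∷ Γ ⊢ σ `⊎ τ → Γ ⊢ σ → Γ ⊢ τ

Env : Ctx → Set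
Env = All ⟦_⟧

-- γ ⊢ e ⇓ v ∣ k: in environment γ, e evaluates to v in k steps.
-- γ ⊢ b ∶ x ⟳ v ∣ k: iterating the loop body b from state x exits with v
-- after k steps.

infix 3 _⊢_⇓_∣_ _⊢_∶_⟳_∣_

mutual

  data _⊢_⇓_∣_ {Γ} (γ : Env Γ) : ∀ {τ} → Γ ⊢ τ → ⟦ τ ⟧ → ℕ → Set where

    var  : ∀ {τ} (x : τ ∈ Γ) → γ ⊢ var x ⇓ All.lookup γ x ∣ 1

    bind : ∀ {σ τ} {e : Γ ⊢ σ} {f : σ ∷ Γ ⊢ τ} {x y k l} →
           γ ⊢ e ⇓ x ∣ k → x ∷ γ ⊢ f ⇓ y ∣ l →
           γ ⊢ bind e f ⇓ y ∣ suc (k + l)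

    lit  : ∀ n → γ ⊢ lit n ⇓ n ∣ 1

    op   : ∀ {τ} (o : Op τ) {e f m n k l} →
           γ ⊢ e ⇓ m ∣ k → γ ⊢ f ⇓ n ∣ l →
           γ ⊢ op o e f ⇓ applyOp o m n ∣ suc (k + l + opCost m n)

    unit : γ ⊢ unit ⇓ tt ∣ 1

    pair : ∀ {σ τ} {e : Γ ⊢ σ} {f : Γ ⊢ τ} {x y k l} →
           γ ⊢ e ⇓ x ∣ k → γ ⊢ f ⇓ y ∣ l →
           γ ⊢ pair e f ⇓ (x , y) ∣ suc (k + l)

    fst  : ∀ {σ τ} {e : Γ ⊢ σ `× τ} {p k} →
           γ ⊢ e ⇓ p ∣ k → γ ⊢ fst e ⇓ proj₁ p ∣ suc k

    snd  : ∀ {σ τ} {e : Γ ⊢ σ `× τ} {p k} →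
           γ ⊢ e ⇓ p ∣ k → γ ⊢ snd e ⇓ proj₂ p ∣ suc k

    inl  : ∀ {σ τ} {e : Γ ⊢ σ} {x k} →
           γ ⊢ e ⇓ x ∣ k → γ ⊢ inl {τ = τ} e ⇓ inj₁ x ∣ suc k

    inr  : ∀ {σ τ} {e : Γ ⊢ τ} {y k} →
           γ ⊢ e ⇓ y ∣ k → γ ⊢ inr {σ = σ} e ⇓ inj₂ y ∣ suc k

    caseSum₁ : ∀ {ρ σ τ} {e : Γ ⊢ ρ `⊎ σ} {f : ρ ∷ Γ ⊢ τ} {g : σ ∷ Γ ⊢ τ}
               {x v k l} →
               γ ⊢ e ⇓ inj₁ x ∣ k → x ∷ γ ⊢ f ⇓ v ∣ l →
               γ ⊢ caseSum e f g ⇓ v ∣ suc (k + l)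

    caseSum₂ : ∀ {ρ σ τ} {e : Γ ⊢ ρ `⊎ σ} {f : ρ ∷ Γ ⊢ τ} {g : σ ∷ Γ ⊢ τ}
               {y v k l} →
               γ ⊢ e ⇓ inj₂ y ∣ k → y ∷ γ ⊢ g ⇓ v ∣ l →
               γ ⊢ caseSum e f g ⇓ v ∣ suc (k + l)

    nil  : ∀ {τ} → γ ⊢ nil {τ = τ} ⇓ [] ∣ 1

    cons : ∀ {τ} {e : Γ ⊢ τ} {f : Γ ⊢ `List τ} {x xs k l} →
           γ ⊢ e ⇓ x ∣ k → γ ⊢ f ⇓ xs ∣ l →
           γ ⊢ cons e f ⇓ x ∷ xs ∣ suc (k + l)

    caseList₁ : ∀ {σ τ} {e : Γ ⊢ `List σ} {f : Γ ⊢ τ} {g : σ ∷ `List σ ∷ Γ ⊢ τ}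
                {v k l} →
                γ ⊢ e ⇓ [] ∣ k → γ ⊢ f ⇓ v ∣ l →
                γ ⊢ caseList e f g ⇓ v ∣ suc (k + l)

    caseList₂ : ∀ {σ τ} {e : Γ ⊢ `List σ} {f : Γ ⊢ τ} {g : σ ∷ `List σ ∷ Γ ⊢ τ}
                {x xs v k l} →
                γ ⊢ e ⇓ x ∷ xs ∣ k → x ∷ xs ∷ γ ⊢ g ⇓ v ∣ l →
                γ ⊢ caseList e f g ⇓ v ∣ suc (k + l)

    loop : ∀ {σ τ} {b : σ ∷ Γ ⊢ σ `⊎ τ} {e : Γ ⊢ σ} {x v k l} →
           γ ⊢ e ⇓ x ∣ k → γ ⊢ b ∶ x ⟳ v ∣ l →
           γ ⊢ loop b e ⇓ v ∣ suc (k + l)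

  data _⊢_∶_⟳_∣_ {Γ} (γ : Env Γ) {σ τ} (b : σ ∷ Γ ⊢ σ `⊎ τ) :
                 ⟦ σ ⟧ → ⟦ τ ⟧ → ℕ → Set where

    exit : ∀ {x v k} → x ∷ γ ⊢ b ⇓ inj₂ v ∣ k → γ ⊢ b ∶ x ⟳ v ∣ suc k

    next : ∀ {x x′ v k l} →
           x ∷ γ ⊢ b ⇓ inj₁ x′ ∣ k → γ ⊢ b ∶ x′ ⟳ v ∣ l →
           γ ⊢ b ∶ x ⟳ v ∣ suc (k + l)

Program : Ty → Ty → Set
Program σ τ = σ ∷ [] ⊢ τ

-- Program A on input x halts with output y after k steps.
Runs : ∀ {σ τ} → Program σ τ → ⟦ σ ⟧ → ⟦ τ ⟧ → ℕ → Set
Runs A x y k = x ∷ [] ⊢ A ⇓ y ∣ k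

------------------------------------------------------------------------
-- Minimisation problems and approximation schemes

infix 4 _≤⁺_

_≤⁺_ : ℕ ⁺ → ℕ ⁺ → Set
_≤⁺_ = Lift≤ _≤_

record MinProblem : Set₁ where
  field
    Instance       : Set
    instanceTy     : Ty
    encodeInstance : Instance → ⟦ instanceTy ⟧

    Solution       : Instance → Set
    solutionTy     : Ty
    encodeSolution : ∀ {I} → Solution I → ⟦ solutionTy ⟧

    Feasible       : ∀ I → Solution I → Set
    value          : ∀ I → Solution I → ℕ ⁺

  IsOptimum : Instance → ℕ ⁺ → Set
  IsOptimum I opt =
    (Σ[ S ∈ Solution I ] Feasible I S × value I S ≡ opt) ×
    (∀ S → Feasible I S → opt ≤⁺ value I S)

fromℕ : ℕ → ℚ
fromℕ n = ℤ.+ n ℚ./ 1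

-- v ≤[1+ ε ]· w:  v ≤ (1 + ε) · w, with (1 + ε) · ∞ = ∞.
_≤[1+_]·_ : ℕ ⁺ → ℚ → ℕ ⁺ → Set
v ≤[1+ ε ]· w =
  Lift≤ ℚ._≤_ (Maybe.map fromℕ v)
              (Maybe.map (λ n → (1ℚ ℚ.+ ε) ℚ.* fromℕ n) w)

⌈1/_⌉ : (ε : ℚ) .{{_ : Positive ε}} → ℕ
⌈1/ ε ⌉ = ∣ ℚ.ceiling (ℚ.1/_ ε {{pos⇒nonZero ε}}) ∣

-- A positive rational is given by its numerator and denominator.
`ℚ : Ty
`ℚ = `ℕ `× `ℕ

encodeℚ : ℚ → ⟦ `ℚ ⟧
encodeℚ ε = ∣ ↥ ε ∣ , ↧ₙ ε

module _ (P : MinProblem) where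
  open MinProblem P

  -- The output is a solution, or inj₁ tt for "no feasible solution".
  data Approximates (I : Instance) (ε : ℚ) : ⟦ `1 `⊎ solutionTy ⟧ → Set where
    solution   : (S : Solution I) → Feasible I S →
                 (∀ opt → IsOptimum I opt → value I S ≤[1+ ε ]· opt) →
                 Approximates I ε (inj₂ (encodeSolution S))
    infeasible : (∀ S → ¬ Feasible I S) → Approximates I ε (inj₁ tt)

  -- One program takes the instance together with ε; its run time is
  -- polynomial in the encoding length of this input and 1/ε.
  HasFPTAS : Set
  HasFPTAS =
    Σ[ A ∈ Program (instanceTy `× `ℚ) (`1 `⊎ solutionTy) ]
    ∃[ c ] ∃[ k ]
    (∀ I ε .{{_ : Positive ε}} →
     let input = encodeInstance I , encodeℚ ε in
     ∃[ out ] ∃[ time ]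
       Runs A input out time ×
       Approximates I ε out ×
       time ≤ c * (size (instanceTy `× `ℚ) input + ⌈1/ ε ⌉) ^ k)

------------------------------------------------------------------------
-- Server Cloud Scheduling

record TaskGraph : Set where
  field
    n : ℕ

  Job : Set
  Job = Fin n

  field
    pˢ : Job → ℕ
    pᶜ : Job → ℕ ⁺
    -- delay i j is just c(i,j) if (i,j) is an edge and nothing otherwise.
    delay : Job → Job → Maybe ℕ
    s t : Job

  Edge : Job → Job → Set
  Edge i j = ∃[ c ] delay i j ≡ just c

  IsSource : Job → Set
  IsSource j = ∀ i → ¬ Edge i j

  IsSink : Job → Set
  IsSink i = ∀ j → ¬ Edge i j

  field
    acyclic  : ∀ j → ¬ TransClosure Edge j j
    source   : IsSource s
    source!  : ∀ j → IsSource j → j ≡ s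
    sink     : IsSink t
    sink!    : ∀ j → IsSink j → j ≡ t
    pˢ-s     : pˢ s ≡ 0
    pˢ-t     : pˢ t ≡ 0
    pᶜ-s     : pᶜ s ≡ ⊤⁺
    pᶜ-t     : pᶜ t ≡ ⊤⁺
    pᶜ-inner : ∀ j → j ≢ s → j ≢ t → ∃[ p ] pᶜ j ≡ [ p ]

data Side : Set where
  server cloud : Side

-- x ≤ y - p, with subtraction taken in ℤ and y - ∞ = -∞.
_≤_-_ : ℕ → ℕ → ℕ ⁺ → Set
x ≤ y - p = Maybe.map (x +_) p ≤⁺ [ y ]

module _ (G : TaskGraph) where
  open TaskGraph G

  -- position numbers the jobs along the path; the first job is then the
  -- source s and the last one the sink t.
  IsChain : Set
  IsChain =
    Σ[ position ∈ Permutation′ n ]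
    (∀ i j → Edge i j ⇔ toℕ (position ⟨$⟩ʳ j) ≡ suc (toℕ (position ⟨$⟩ʳ i)))

  record Schedule : Set where
    field
      side : Job → Side
      C    : Job → ℕ

    p : Job → ℕ ⁺
    p j with side j
    ... | server = [ pˢ j ]
    ... | cloud  = pᶜ j

    StartsFrom : ℕ → Job → Set
    StartsFrom x j = x ≤ C j - p j

    makespan : ℕ
    makespan = C t

    cloudTime : Job → ℕ ⁺
    cloudTime j with side j
    ... | server = [ 0 ]
    ... | cloud  = pᶜ j

    cost : ℕ ⁺
    cost = Vector.foldr (Maybe.zipWith _+_) [ 0 ] cloudTime

    record Valid : Set where
      field
        -- Start times are natural numbers.  In particular no job with
        -- infinite processing time is completed, so s and t run on the
        -- server.
        start     : ∀ j → StartsFrom 0 j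
        exclusive : ∀ i j → i ≢ j → side i ≡ server → side j ≡ server →
                    StartsFrom (C i) j ⊎ StartsFrom (C j) i
        sameSide  : ∀ i j → Edge i j → side i ≡ side j → StartsFrom (C i) j
        crossSide : ∀ i j c → delay i j ≡ just c → side i ≢ side j →
                    StartsFrom (C i + c) j

------------------------------------------------------------------------
-- Encodings

`Maybe : Ty → Ty
`Maybe τ = `1 `⊎ τ

encodeMaybe : Maybe ℕ → ⟦ `Maybe `ℕ ⟧
encodeMaybe = maybe inj₂ (inj₁ tt)

-- The processing times of all jobs, the matrix of delays, s and t.
`TaskGraph : Ty
`TaskGraph =
  `List (`ℕ `× `Maybe `ℕ) `× `List (`List (`Maybe `ℕ)) `× `ℕ `× `ℕ

encodeTaskGraph : TaskGraph → ⟦ `TaskGraph ⟧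
encodeTaskGraph G =
  List.tabulate (λ j → pˢ j , encodeMaybe (pᶜ j)) ,
  List.tabulate (λ i → List.tabulate (λ j → encodeMaybe (delay i j))) ,
  toℕ s , toℕ t
  where open TaskGraph G

encodeSide : Side → ⟦ `Bool ⟧
encodeSide server = inj₁ tt
encodeSide cloud  = inj₂ tt

`Schedule : Ty
`Schedule = `List (`Bool `× `ℕ)

encodeSchedule : ∀ {G} → Schedule G → ⟦ `Schedule ⟧
encodeSchedule S = List.tabulate (λ j → encodeSide (side j) , C j)
  where open Schedule S

------------------------------------------------------------------------
-- The two objectives, on the task graphs of a given class

module _ (Class : TaskGraph → Set) where

  BoundedInstance : Set
  BoundedInstance = (Σ[ G ∈ TaskGraph ] Class G) × ℕ

  graph : BoundedInstance → TaskGraph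
  graph ((G , _) , _) = G

  encodeBounded : BoundedInstance → ⟦ `TaskGraph `× `ℕ ⟧
  encodeBounded (G , bound) = encodeTaskGraph (proj₁ G) , bound

  minCostWithinDeadline : MinProblem
  minCostWithinDeadline = record
    { Instance       = BoundedInstance
    ; instanceTy     = `TaskGraph `× `ℕ
    ; encodeInstance = encodeBounded
    ; Solution       = λ I → Schedule (graph I)
    ; solutionTy     = `Schedule
    ; encodeSolution = encodeSchedule
    ; Feasible       = λ (_ , d) S → Schedule.Valid S × Schedule.makespan S ≤ d
    ; value          = λ _ S → Schedule.cost S
    }

  minMakespanWithinBudget : MinProblem
  minMakespanWithinBudget = record
    { Instance       = BoundedInstance
    ; instanceTy     = `TaskGraph `× `ℕ
    ; encodeInstance = encodeBounded
    ; Solution       = λ I → Schedule (graph I)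
    ; solutionTy     = `Schedule
    ; encodeSolution = encodeSchedule
    ; Feasible       = λ (_ , b) S → Schedule.Valid S × Schedule.cost S ≤⁺ [ b ]
    ; value          = λ _ S → [ Schedule.makespan S ]
    }

{-# OPTIONS --safe #-}
module Submission where

-- On a chain, a schedule that starts every job as early as possible is determined by the sides of
-- the jobs, and both its makespan and its cost are sums over consecutive jobs of weights that only
-- depend on the two sides.  Either problem thus asks for a path through layers of two nodes that
-- minimises one total (the objective) within a bound on the other (the resource).
--
-- Guess the largest objective weight w on an optimal path: it is 0 or one of the at most 4n weights
-- in the instance.  Discard heavier arcs and replace a weight a by ⌊a q / w⌋ where q = n M and
-- 1 / M ≤ ε.  Scaled totals are at most n q, so one partial schedule of least resource per layer,
-- side and scaled total can be kept.  Rounding costs at most n w / q = w / M ≤ ε w, and w is at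
-- most the optimum.
--
-- The time bound rests on an invariant of the program: with S the input size plus ⌈1/ε⌉, all lists
-- it folds over have length at most S ^ 5 and all numbers it computes with have at most S ^ 5
-- digits.

open import Defs
open import Algebra.Properties.CommutativeMonoid.Sum as Sum using ()
open import Data.Bool.Base using (true; false)
open import Data.Empty using (⊥-elim)
open import Data.Fin.Base as Fin using (Fin; toℕ; fromℕ<)
open import Data.Fin.Permutation using (_⟨$⟩ʳ_; _⟨$⟩ˡ_; inverseʳ; inverseˡ)
open import Data.Fin.Properties using (toℕ-fromℕ<; toℕ<n; toℕ-injective)
open import Data.Integer.Base as ℤ using (+≤+; ∣_∣)
import Data.Integer.Properties as ℤ
open import Data.List.Base as List
  using (List; []; _∷_; _∷ʳ_; length; foldl; foldr; reverse; _ʳ++_; downFrom; tabulate)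
open import Data.List.Membership.Propositional using (_∈_)
open import Data.List.Membership.Propositional.Properties
  using (∈-tabulate⁺; ∈-tabulate⁻; ∈-downFrom⁺; ∈-downFrom⁻)
open import Data.List.Properties
  using (length-reverse; length-tabulate; length-downFrom; tabulate-cong; reverse-foldl; unfold-reverse)
open import Data.List.Relation.Unary.All as All using ([]; _∷_)
open import Data.List.Relation.Unary.Any using (here; there)
import Data.List.Relation.Unary.Any.Properties as Any
open import Data.Maybe.Base as Maybe using (Maybe; just; fromMaybe)
open import Data.Maybe.Properties using (just-injective)
open import Data.Nat.Base
open import Data.Nat.DivMod using (m/n*n≤m; m≡m%n+[m/n]*n; m%n<n)
import Data.Nat.ListAction as ListAction
open import Data.Nat.Logarithm using (⌊log₂⌋-mono-≤; ⌊log₂[2^n]⌋≡n)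
open import Data.Nat.Properties
open import Data.Nat.Solver using (module +-*-Solver)
open import Data.Product.Base using (∃-syntax; _×_; _,_; proj₁; proj₂)
open import Data.Rational.Base as ℚ using (ℚ; mkℚ; 1ℚ; Positive; ↥_; ↧ₙ_; toℚᵘ)
import Data.Rational.Properties as ℚ
open import Data.Rational.Unnormalised.Base as ℚᵘ using (mkℚᵘ; *≤*)
import Data.Rational.Unnormalised.Properties as ℚᵘ
open import Data.Sum.Base using (_⊎_; inj₁; inj₂; [_,_]′)
open import Data.Sum.Properties using (inj₂-injective)
open import Data.Unit.Base using (⊤; tt)
import Data.Vec.Functional as Vector
open import Function.Bundles using (module Equivalence)
open import Relation.Binary.Construct.Add.Supremum.NonStrict using ([_])
open import Relation.Binary.Definitions using (tri<; tri≈; tri>)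
open import Relation.Binary.PropositionalEquality hiding ([_])
open import Relation.Nullary using (Dec; yes; no)
open import Relation.Nullary.Construct.Add.Supremum using (_⁺; ⊤⁺) renaming ([_] to finite)
open import Relation.Nullary.Negation using (¬_)

open Sum +-0-commutativeMonoid using (sum; sum-permute)

-- Programs of the model are described by an evaluation relation and may diverge. The schemes are
-- therefore written in a total language `Fn` whose meaning `run` is an ordinary function, and
-- compiled: correctness concerns `run` alone, and time reduces to the predicate `Safe`. The
-- exponent `degree` is read off the syntax, so it is the same for all inputs. Keeping one partial
-- schedule per side and scaled total is harmless because two schedules that agree in both have the
-- same continuations, with the same increments of every total. Agreement is exact equality of
-- rounded totals, so the exchange loses nothing and the rounding error is paid once, at the end. A
-- wrong guess of w does no harm: whatever it leaves still is a schedule with its true totals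
-- recorded, and the winner is chosen by true objective. The jobs are listed in arbitrary order, so
-- the program first has to find the path by following the matrix of delays. Exclusiveness on the
-- server comes for free, since a chain already orders its jobs in time.

private variable
  ρ σ τ γ : Ty
  Γ : Ctx
  A B : Set

-- A total language of folds and its compilation to the machine

infixr 9 _∘_

-- Total functions with folds in place of loops.  The argument is the tuple of the variables in
-- scope, the most recent one first.
data Fn : Ty → Ty → Set where
  id    : Fn σ σ
  _∘_   : Fn σ τ → Fn ρ σ → Fn ρ τ
  lit   : ℕ → Fn γ `ℕ
  op    : Op τ → Fn γ `ℕ → Fn γ `ℕ → Fn γ τ
  unit  : Fn γ `1
  pair  : Fn γ σ → Fn γ τ → Fn γ (σ `× τ)
  fst   : Fn (σ `× τ) σ
  snd   : Fn (σ `× τ) τ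
  inl   : Fn γ σ → Fn γ (σ `⊎ τ)
  inr   : Fn γ τ → Fn γ (σ `⊎ τ)
  case  : Fn γ (ρ `⊎ σ) → Fn (ρ `× γ) τ → Fn (σ `× γ) τ → Fn γ τ
  nil   : Fn γ (`List τ)
  cons  : Fn γ τ → Fn γ (`List τ) → Fn γ (`List τ)
  fold  : Fn (σ `× ρ `× γ) ρ → Fn γ (`List σ) → Fn γ ρ → Fn γ ρ
  range : Fn γ `ℕ → Fn γ (`List `ℕ)

run : Fn σ τ → ⟦ σ ⟧ → ⟦ τ ⟧
run id x            = x
run (g ∘ f) x       = run g (run f x)
run (lit n) x       = n
run (op o f g) x    = applyOp o (run f x) (run g x)
run unit x          = tt
run (pair f g) x    = run f x , run g x
run fst x           = proj₁ x
run snd x           = proj₂ x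
run (inl f) x       = inj₁ (run f x)
run (inr f) x       = inj₂ (run f x)
run (case e f g) x  = [ (λ y → run f (y , x)) , (λ y → run g (y , x)) ]′ (run e x)
run nil x           = []
run (cons f g) x    = run f x ∷ run g x
run (fold f xs a) x = foldl (λ b y → run f (y , b , x)) (run a x) (run xs x)
run (range f) x     = downFrom (run f x)

-- Run times are tracked by their exponents alone: ⊕ bounds a sum of two powers of len ≥ 2.
infixl 6 _⊕_

_⊕_ : ℕ → ℕ → ℕ
a ⊕ b = 2 + (a + b)

-- Follows the term `foldBody` node by node along its longer branch, with `d` for the folded
-- function; `rangeBodyDegree` does the same for `rangeBody`.
foldBodyDegree : ℕ → ℕ
foldBodyDegree d = 1 ⊕ suc (0 ⊕ ((0 ⊕ (1 ⊕ 0)) ⊕ d))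

rangeBodyDegree : ℕ
rangeBodyDegree = (0 ⊕ 1 ⊕ 4) ⊕ suc ((1 ⊕ 0 ⊕ 4) ⊕ (1 ⊕ 1))

-- Never depends on the argument, which makes the exponent of the final bound a constant. A loop
-- adds three exponents to its body: two for the number of iterations and one for the extra step in
-- each.
degree : Fn σ τ → ℕ
degree id            = 0
degree (g ∘ f)       = degree f ⊕ degree g
degree (lit n)       = 0
degree (op o f g)    = degree f ⊕ degree g ⊕ 4
degree unit          = 0
degree (pair f g)    = degree f ⊕ degree g
degree fst           = 1
degree snd           = 1
degree (inl f)       = 1 + degree f
degree (inr f)       = 1 + degree f
degree (case e f g)  = degree e ⊕ (2 ⊕ (degree f + degree g))
degree nil           = 0
degree (cons f g)    = degree f ⊕ degree g
degree (fold f xs a) =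
  (degree xs ⊕ degree a) ⊕ (3 + foldBodyDegree (degree f))
degree (range f)     =
  degree f ⊕ (2 ⊕ (3 + rangeBodyDegree))

v0 : ∀ {Γ} → σ ∷ Γ ⊢ σ
v0 = var (here refl)

v1 : ∀ {Γ} → ρ ∷ σ ∷ Γ ⊢ σ
v1 = var (there (here refl))

v2 : ∀ {Γ} → ρ ∷ τ ∷ σ ∷ Γ ⊢ σ
v2 = var (there (there (here refl)))

v3 : ∀ {Γ} → ρ ∷ τ ∷ γ ∷ σ ∷ Γ ⊢ σ
v3 = var (there (there (there (here refl))))

-- The loop state consists of the elements still to come and the accumulator. The variable below it
-- is the argument of the whole fold, which becomes the tail of the tuple given to `f`.
foldBody : (σ `× ρ `× γ) ∷ σ ∷ `List σ ∷ (`List σ `× ρ) ∷ γ ∷ Γ ⊢ ρ →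
           (`List σ `× ρ) ∷ γ ∷ Γ ⊢ (`List σ `× ρ) `⊎ ρ
foldBody f = caseList (fst v0) (inr (snd v0))
  (inl (pair v1 (bind (pair v0 (pair (snd v2) v3)) f)))

rangeBody : (`ℕ `× `List `ℕ) ∷ `ℕ ∷ Γ ⊢ (`ℕ `× `List `ℕ) `⊎ `List `ℕ
rangeBody = caseSum (op leq v1 (fst v0))
  (inr (snd v1))
  (inl (pair (op add (fst v1) (lit 1)) (cons (fst v1) (snd v1))))

-- A compiled function reads only the most recent variable; leaving the rest of the context
-- arbitrary lets it be placed under binders without weakening.
term : Fn σ τ → σ ∷ Γ ⊢ τ
term id            = v0
term (g ∘ f)       = bind (term f) (term g)
term (lit n)       = lit n
term (op o f g)    = op o (term f) (term g)
term unit          = unit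
term (pair f g)    = pair (term f) (term g)
term fst           = fst v0
term snd           = snd v0
term (inl f)       = inl (term f)
term (inr f)       = inr (term f)
term (case e f g)  =
  caseSum (term e) (bind (pair v0 v1) (term f)) (bind (pair v0 v1) (term g))
term nil           = nil
term (cons f g)    = cons (term f) (term g)
term (fold f xs a) =
  loop (foldBody (term f)) (pair (term xs) (term a))
term (range f)     = bind (term f) (loop rangeBody (pair (lit 0) nil))

-- Running time of compiled programs

Along : (A → B → Set) → (B → A → B) → B → List A → Set
Along P f b []       = ⊤
Along P f b (x ∷ xs) = P x b × Along P f (f b x) xs

bits-mono : ∀ {m n} → m ≤ n → bits m ≤ bits n
bits-mono m≤n = s≤s (⌊log₂⌋-mono-≤ m≤n)

leq-true : ∀ {m n} → m ≤ n → applyOp leq m n ≡ inj₁ tt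
leq-true {m} {n} m≤n with m ≤ᵇ n | ≤⇒≤ᵇ m≤n
... | true | _ = refl

leq-false : ∀ {m n} → n < m → applyOp leq m n ≡ inj₂ tt
leq-false {m} {n} n<m with m ≤ᵇ n | ≤ᵇ⇒≤ m n
... | true  | f = ⊥-elim (<⇒≱ n<m (f tt))
... | false | _ = refl

module Resources (len num : ℕ) where

  -- Beyond the syntax, time depends only on the number of iterations and on the digits of operands.
  -- Results of arithmetic are bounded only where they become operands in turn.
  Safe : Fn σ τ → ⟦ σ ⟧ → Set
  Safe id x            = ⊤
  Safe (g ∘ f) x       = Safe f x × Safe g (run f x)
  Safe (lit n) x       = ⊤
  Safe (op o f g) x    = (Safe f x × Safe g x) × run f x ≤ num × run g x ≤ num
  Safe unit x          = ⊤
  Safe (pair f g) x    = Safe f x × Safe g x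
  Safe fst x           = ⊤
  Safe snd x           = ⊤
  Safe (inl f) x       = Safe f x
  Safe (inr f) x       = Safe f x
  Safe (case e f g) x  =
    Safe e x × [ (λ y → Safe f (y , x)) , (λ y → Safe g (y , x)) ]′ (run e x)
  Safe nil x           = ⊤
  Safe (cons f g) x    = Safe f x × Safe g x
  Safe (fold f xs a) x =
    (Safe xs x × Safe a x) × length (run xs x) ≤ len ×
    Along (λ y b → Safe f (y , b , x)) (λ b y → run f (y , b , x)) (run a x) (run xs x)
  Safe (range f) x     = Safe f x × run f x ≤ len × run f x ≤ num

  module _ (2≤len : 2 ≤ len) (bits≤len : bits num ≤ len) where

    infix 3 _⊢_⇓_∣^_

    -- Hides the number of steps and exposes an exponent only, so that derivations compose by `_⊕_`.
    record _⊢_⇓_∣^_ (γ : Env Γ) (e : Γ ⊢ τ) (v : ⟦ τ ⟧) (d : ℕ) : Set where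
      constructor ⟨_,_⟩
      field
        {steps} : ℕ
        derivation : γ ⊢ e ⇓ v ∣ steps
        steps≤ : steps ≤ len ^ d

    instance
      len≢0 : NonZero len
      len≢0 = >-nonZero (≤-trans (s≤s z≤n) 2≤len)

    ^-double : ∀ d {k l} → k ≤ len ^ d → l ≤ len ^ d → k + l ≤ len ^ suc d
    ^-double d {k} {l} p q = begin
      k + l                 ≤⟨ +-mono-≤ p q ⟩
      len ^ d + len ^ d     ≡⟨ cong (len ^ d +_) (+-identityʳ _) ⟨
      2 * len ^ d           ≤⟨ *-monoˡ-≤ (len ^ d) 2≤len ⟩
      len ^ suc d           ∎
      where open ≤-Reasoning

    1≤^ : ∀ d → 1 ≤ len ^ d
    1≤^ d = m^n>0 len d

    ^-mono : ∀ {a b} → a ≤ b → len ^ a ≤ len ^ b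
    ^-mono = ^-monoʳ-≤ len

    ^-suc : ∀ a {k} → k ≤ len ^ a → suc k ≤ len ^ suc a
    ^-suc a = ^-double a (1≤^ a)

    -- Both terms are at most `len ^ (a + b)`. Doubling costs one exponent and the extra step
    -- another: these are the 2 in `_⊕_`.
    ^-⊕ : ∀ a b {k l} → k ≤ len ^ a → l ≤ len ^ b → suc (k + l) ≤ len ^ (a ⊕ b)
    ^-⊕ a b p q = ^-suc (suc (a + b)) (^-double (a + b)
      (≤-trans p (^-mono (m≤m+n a b))) (≤-trans q (^-mono (m≤n+m b a))))

    opCost≤ : ∀ {m n} → m ≤ num → n ≤ num → opCost m n ≤ len ^ 4
    opCost≤ {m} {n} p q = begin
      (bits m + bits n) ^ 2  ≤⟨ ^-monoˡ-≤ 2 (^-double 1 (le p) (le q)) ⟩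
      (len ^ 2) ^ 2          ≡⟨ ^-*-assoc len 2 2 ⟩
      len ^ 4                ∎
      where
      open ≤-Reasoning
      le : ∀ {m} → m ≤ num → bits m ≤ len ^ 1
      le p = ≤-trans (≤-trans (bits-mono p) bits≤len) (≤-reflexive (sym (*-identityʳ len)))

    module _ {γ : Env Γ} where

      relax : ∀ {e : Γ ⊢ τ} {v a b} → a ≤ b → γ ⊢ e ⇓ v ∣^ a → γ ⊢ e ⇓ v ∣^ b
      relax a≤b ⟨ r , p ⟩ = ⟨ r , ≤-trans p (^-mono a≤b) ⟩

      exactly : ∀ {e : Γ ⊢ τ} {v w a} → v ≡ w → γ ⊢ e ⇓ v ∣^ a → γ ⊢ e ⇓ w ∣^ a
      exactly refl r = r

      var^ : ∀ (x : τ ∈ Γ) → γ ⊢ var x ⇓ All.lookup γ x ∣^ 0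
      var^ x = ⟨ var x , ≤-refl ⟩

      lit^ : ∀ n → γ ⊢ lit n ⇓ n ∣^ 0
      lit^ n = ⟨ lit n , ≤-refl ⟩

      unit^ : γ ⊢ unit ⇓ tt ∣^ 0
      unit^ = ⟨ unit , ≤-refl ⟩

      nil^ : γ ⊢ nil {τ = τ} ⇓ [] ∣^ 0
      nil^ = ⟨ nil , ≤-refl ⟩

      bind^ : ∀ {e : Γ ⊢ σ} {f : σ ∷ Γ ⊢ τ} {x y a b} → γ ⊢ e ⇓ x ∣^ a →
              x ∷ γ ⊢ f ⇓ y ∣^ b → γ ⊢ bind e f ⇓ y ∣^ a ⊕ b
      bind^ {a = a} {b} ⟨ r , p ⟩ ⟨ s , q ⟩ = ⟨ bind r s , ^-⊕ a b p q ⟩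

      op^ : ∀ (o : Op τ) {e f m n a b} → m ≤ num → n ≤ num →
            γ ⊢ e ⇓ m ∣^ a → γ ⊢ f ⇓ n ∣^ b →
            γ ⊢ op o e f ⇓ applyOp o m n ∣^ a ⊕ b ⊕ 4
      op^ o {a = a} {b} m≤ n≤ ⟨ r , p ⟩ ⟨ s , q ⟩ =
        ⟨ op o r s
        , ^-⊕ (a ⊕ b) 4 (≤-trans (n≤1+n _) (^-⊕ a b p q)) (opCost≤ m≤ n≤) ⟩

      pair^ : ∀ {e : Γ ⊢ σ} {f : Γ ⊢ τ} {x y a b} →
              γ ⊢ e ⇓ x ∣^ a → γ ⊢ f ⇓ y ∣^ b → γ ⊢ pair e f ⇓ (x , y) ∣^ a ⊕ b
      pair^ {a = a} {b} ⟨ r , p ⟩ ⟨ s , q ⟩ = ⟨ pair r s , ^-⊕ a b p q ⟩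

      cons^ : ∀ {e : Γ ⊢ τ} {f : Γ ⊢ `List τ} {x xs a b} →
              γ ⊢ e ⇓ x ∣^ a → γ ⊢ f ⇓ xs ∣^ b → γ ⊢ cons e f ⇓ x ∷ xs ∣^ a ⊕ b
      cons^ {a = a} {b} ⟨ r , p ⟩ ⟨ s , q ⟩ = ⟨ cons r s , ^-⊕ a b p q ⟩

      fst^ : ∀ {e : Γ ⊢ σ `× τ} {x a} → γ ⊢ e ⇓ x ∣^ a → γ ⊢ fst e ⇓ proj₁ x ∣^ suc a
      fst^ {a = a} ⟨ r , p ⟩ = ⟨ fst r , ^-suc a p ⟩

      snd^ : ∀ {e : Γ ⊢ σ `× τ} {x a} → γ ⊢ e ⇓ x ∣^ a → γ ⊢ snd e ⇓ proj₂ x ∣^ suc a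
      snd^ {a = a} ⟨ r , p ⟩ = ⟨ snd r , ^-suc a p ⟩

      inl^ : ∀ {e : Γ ⊢ σ} {x a} → γ ⊢ e ⇓ x ∣^ a → γ ⊢ inl {τ = τ} e ⇓ inj₁ x ∣^ suc a
      inl^ {a = a} ⟨ r , p ⟩ = ⟨ inl r , ^-suc a p ⟩

      inr^ : ∀ {e : Γ ⊢ τ} {x a} → γ ⊢ e ⇓ x ∣^ a → γ ⊢ inr {σ = σ} e ⇓ inj₂ x ∣^ suc a
      inr^ {a = a} ⟨ r , p ⟩ = ⟨ inr r , ^-suc a p ⟩

      caseSum₁^ : ∀ {e : Γ ⊢ ρ `⊎ σ} {f : ρ ∷ Γ ⊢ τ} {g : σ ∷ Γ ⊢ τ} {x v a b} →
                  γ ⊢ e ⇓ inj₁ x ∣^ a → x ∷ γ ⊢ f ⇓ v ∣^ b →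
                  γ ⊢ caseSum e f g ⇓ v ∣^ a ⊕ b
      caseSum₁^ {a = a} {b} ⟨ r , p ⟩ ⟨ s , q ⟩ = ⟨ caseSum₁ r s , ^-⊕ a b p q ⟩

      caseSum₂^ : ∀ {e : Γ ⊢ ρ `⊎ σ} {f : ρ ∷ Γ ⊢ τ} {g : σ ∷ Γ ⊢ τ} {x v a b} →
                  γ ⊢ e ⇓ inj₂ x ∣^ a → x ∷ γ ⊢ g ⇓ v ∣^ b →
                  γ ⊢ caseSum e f g ⇓ v ∣^ a ⊕ b
      caseSum₂^ {a = a} {b} ⟨ r , p ⟩ ⟨ s , q ⟩ = ⟨ caseSum₂ r s , ^-⊕ a b p q ⟩

      caseList₁^ : ∀ {e : Γ ⊢ `List σ} {f : Γ ⊢ τ} {g : σ ∷ `List σ ∷ Γ ⊢ τ} {v a b} →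
                   γ ⊢ e ⇓ [] ∣^ a → γ ⊢ f ⇓ v ∣^ b →
                   γ ⊢ caseList e f g ⇓ v ∣^ a ⊕ b
      caseList₁^ {a = a} {b} ⟨ r , p ⟩ ⟨ s , q ⟩ = ⟨ caseList₁ r s , ^-⊕ a b p q ⟩

      caseList₂^ : ∀ {e : Γ ⊢ `List σ} {f : Γ ⊢ τ} {g : σ ∷ `List σ ∷ Γ ⊢ τ}
                   {x xs v a b} →
                   γ ⊢ e ⇓ x ∷ xs ∣^ a → x ∷ xs ∷ γ ⊢ g ⇓ v ∣^ b →
                   γ ⊢ caseList e f g ⇓ v ∣^ a ⊕ b
      caseList₂^ {a = a} {b} ⟨ r , p ⟩ ⟨ s , q ⟩ = ⟨ caseList₂ r s , ^-⊕ a b p q ⟩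

      -- `n` counts the iterations before the exiting one; each of the `suc n` iterations costs its
      -- body and one step of the loop.
      record Within (n d : ℕ) (b : σ ∷ Γ ⊢ σ `⊎ τ) (x : ⟦ σ ⟧) (v : ⟦ τ ⟧) : Set where
        constructor ⟨_,_⟩
        field
          {steps} : ℕ
          derivation : γ ⊢ b ∶ x ⟳ v ∣ steps
          steps≤ : steps ≤ suc n * suc (len ^ d)

      exit^ : ∀ {b : σ ∷ Γ ⊢ σ `⊎ τ} {x v d} →
              x ∷ γ ⊢ b ⇓ inj₂ v ∣^ d → Within 0 d b x v
      exit^ ⟨ r , p ⟩ = ⟨ exit r , ≤-trans (s≤s p) (m≤m+n _ 0) ⟩

      next^ : ∀ {b : σ ∷ Γ ⊢ σ `⊎ τ} {x x′ v d n} →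
              x ∷ γ ⊢ b ⇓ inj₁ x′ ∣^ d → Within n d b x′ v → Within (suc n) d b x v
      next^ ⟨ r , p ⟩ ⟨ s , q ⟩ = ⟨ next r s , +-mono-≤ (s≤s p) q ⟩

      loop^ : ∀ {b : σ ∷ Γ ⊢ σ `⊎ τ} {e x v a d n} → n ≤ len →
              γ ⊢ e ⇓ x ∣^ a → Within n d b x v → γ ⊢ loop b e ⇓ v ∣^ a ⊕ (3 + d)
      loop^ {a = a} {d} {n} n≤ ⟨ r , p ⟩ (⟨_,_⟩ {k} s q) =
        ⟨ loop r s , ^-⊕ a (3 + d) p (begin
          k                          ≤⟨ q ⟩
          suc n * suc (len ^ d)      ≤⟨ *-mono-≤ 1+n≤ (^-suc d ≤-refl) ⟩
          len ^ 2 * len ^ suc d      ≡⟨ ^-distribˡ-+-* len 2 (suc d) ⟨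
          len ^ (3 + d)              ∎) ⟩
        where
        open ≤-Reasoning
        1+n≤ : suc n ≤ len ^ 2
        1+n≤ = ^-suc 1 (≤-trans n≤ (≤-reflexive (sym (*-identityʳ len))))

    -- Induction on the syntax. For loops a second induction follows the remaining list, with
    -- `Along` supplying safety at each accumulator, or the distance of the counter from its goal.
    eval : ∀ (f : Fn σ τ) {x} {γ : Env Γ} → Safe f x →
           x ∷ γ ⊢ term f ⇓ run f x ∣^ degree f
    eval id _          = var^ _
    eval (g ∘ f) (p , q) = bind^ (eval f p) (eval g q)
    eval (lit n) _     = lit^ n
    eval (op o f g) ((p , q) , m≤ , n≤) = op^ o m≤ n≤ (eval f p) (eval g q)
    eval unit _        = unit^
    eval (pair f g) (p , q) = pair^ (eval f p) (eval g q)
    eval fst _         = fst^ (var^ _)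
    eval snd _         = snd^ (var^ _)
    eval (inl f) p     = inl^ (eval f p)
    eval (inr f) p     = inr^ (eval f p)
    eval (case e f g) {x} (p , q) with run e x | eval e p | q
    -- The degrees of both branches are added, so the bound does not depend on which one is taken.
    ... | inj₁ y | r | q = caseSum₁^ r (relax (+-monoʳ-≤ 4 (m≤m+n _ _))
                             (bind^ (pair^ (var^ _) (var^ _)) (eval f q)))
    ... | inj₂ y | r | q = caseSum₂^ r (relax (+-monoʳ-≤ 4 (m≤n+m _ _))
                             (bind^ (pair^ (var^ _) (var^ _)) (eval g q)))
    eval nil _         = nil^
    eval (cons f g) (p , q) = cons^ (eval f p) (eval g q)
    eval (fold f xs a) {x} {γ} ((p , q) , l , safe) =
      loop^ l (pair^ (eval xs p) (eval a q)) (iterate (run a x) (run xs x) safe)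
      where
      iterate : ∀ b ys → Along (λ y b → Safe f (y , b , x)) (λ b y → run f (y , b , x)) b ys →
                Within {γ = x ∷ γ} (length ys) (foldBodyDegree (degree f))
                  (foldBody (term f)) (ys , b)
                  (foldl (λ b y → run f (y , b , x)) b ys)
      iterate b [] _ =
        -- The last iteration merely returns the accumulator; it is charged like the others.
        exit^ (relax (+-monoʳ-≤ 3 (s≤s (s≤s z≤n)))
          (caseList₁^ (fst^ (var^ _)) (inr^ (snd^ (var^ _)))))
      iterate b (y ∷ ys) (p , ps) =
        next^ (caseList₂^ (fst^ (var^ _))
                (inl^ (pair^ (var^ _)
                  (bind^ (pair^ (var^ _) (pair^ (snd^ (var^ _)) (var^ _))) (eval f p)))))
              (iterate _ ys ps)
    eval (range f) {x} {γ} (p , n≤len , n≤num) =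
      bind^ (eval f p) (loop^ n≤len (pair^ (lit^ 0) nil^) (count 0 (run f x) refl))
      where
      n = run f x
      count : ∀ i j → i + j ≡ n →
              Within {γ = n ∷ x ∷ γ} j rangeBodyDegree rangeBody
                (i , downFrom i) (downFrom n)
      count i zero eq with refl ← trans (sym (+-identityʳ i)) eq =
        exit^ (relax (+-monoʳ-≤ 11 (s≤s (s≤s z≤n)))
          (caseSum₁^ (exactly (leq-true {n} ≤-refl)
                       (op^ leq n≤num n≤num (var^ _) (fst^ (var^ _))))
            (inr^ (snd^ (var^ _)))))
      count i (suc j) eq =
        next^
          (caseSum₂^ (exactly (leq-false i<n)
                       (op^ leq n≤num i≤num (var^ _) (fst^ (var^ _))))
            (inl^ (pair^
              (exactly (+-comm i 1)
                (op^ add i≤num (≤-trans (s≤s z≤n) (≤-trans i<n n≤num))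
                  (fst^ (var^ _)) (lit^ 1)))
              (cons^ (fst^ (var^ _)) (snd^ (var^ _))))))
          (count (suc i) j (trans (sym (+-suc i j)) eq))
        where
        i<n : i < n
        i<n = subst (i <_) eq (m<m+n i (s≤s z≤n))
        i≤num : i ≤ num
        i≤num = ≤-trans (<⇒≤ i<n) n≤num

-- Filtering, least elements and numbering by folds

foldl-preserves : ∀ {f : B → A → B} (Inv : B → Set) xs →
                  (∀ {y b} → y ∈ xs → Inv b → Inv (f b y)) →
                  ∀ {b} → Inv b → Inv (foldl f b xs)
foldl-preserves Inv []       step i = i
foldl-preserves Inv (x ∷ xs) step i =
  foldl-preserves Inv xs (λ y∈ → step (there y∈)) (step (here refl) i)

along : ∀ {P : A → B → Set} {f} (Inv : B → Set) xs →
        (∀ {y b} → y ∈ xs → Inv b → P y b × Inv (f b y)) →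
        ∀ {b} → Inv b → Along P f b xs
along Inv []       step i = tt
along Inv (x ∷ xs) step i with step (here refl) i
... | p , i′ = p , along Inv xs (λ y∈ → step (there y∈)) i′

along-∷ʳ : ∀ {P : A → B → Set} {f} xs {y b} →
           Along P f b xs → P y (foldl f b xs) → Along P f b (xs ∷ʳ y)
along-∷ʳ []       _        q = q , tt
along-∷ʳ (x ∷ xs) (p , ps) q = p , along-∷ʳ xs ps q

by-cases : ∀ {P : A → Set} {Q : B → Set} s →
           (∀ y → P y) → (∀ z → Q z) → [ P , Q ]′ s
by-cases (inj₁ y) p q = p y
by-cases (inj₂ z) p q = q z

True : ⟦ `Bool ⟧ → Set
True b = b ≡ inj₁ tt

¬True-inj₂ : ∀ {u} → ¬ True (inj₂ u)
¬True-inj₂ ()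

leq-true⁻ : ∀ {m n} → True (applyOp leq m n) → m ≤ n
leq-true⁻ t = ≮⇒≥ λ n<m → ¬True-inj₂ (trans (sym (leq-false n<m)) t)

ifte : Fn γ `Bool → Fn γ τ → Fn γ τ → Fn γ τ
ifte c f g = case c (f ∘ snd) (g ∘ snd)

eq : Fn γ `ℕ → Fn γ `ℕ → Fn γ `Bool
eq f g = ifte (op leq f g) (op leq g f) (inr unit)

eq-true⁺ : ∀ (f g : Fn γ `ℕ) {x} → run f x ≡ run g x → True (run (eq f g) x)
eq-true⁺ f g {x} p rewrite leq-true (≤-reflexive p) | leq-true (≤-reflexive (sym p)) = refl

eq-true⁻ : ∀ (f g : Fn γ `ℕ) {x} → True (run (eq f g) x) → run f x ≡ run g x
eq-true⁻ f g {x} t with applyOp leq (run f x) (run g x) in p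
... | inj₁ _ = ≤-antisym (leq-true⁻ p) (leq-true⁻ t)

-- The meaning of `gather`: the two agree by computation, so facts about `collect` apply to programs
-- directly.
collect : (A → ⊤ ⊎ B) → List B → List A → List B
collect g = foldl (λ b y → [ (λ _ → b) , (_∷ b) ]′ (g y))

module _ {g : A → ⊤ ⊎ B} where

  collect-∈ˡ : ∀ {b z} xs → z ∈ b → z ∈ collect g b xs
  collect-∈ˡ {z = z} xs = foldl-preserves (z ∈_) xs step
    where
    step : ∀ {y b} → y ∈ xs → z ∈ b → z ∈ [ (λ _ → b) , (_∷ b) ]′ (g y)
    step {y} _ z∈ with g y
    ... | inj₁ _ = z∈
    ... | inj₂ _ = there z∈

  collect-∈ʳ : ∀ {b xs y z} → y ∈ xs → g y ≡ inj₂ z → z ∈ collect g b xs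
  collect-∈ʳ {xs = x ∷ xs} (here refl) e rewrite e = collect-∈ˡ xs (here refl)
  collect-∈ʳ (there y∈)  e = collect-∈ʳ y∈ e

  collect-∈⁻ : ∀ {b z} xs → z ∈ collect g b xs →
               z ∈ b ⊎ ∃[ y ] y ∈ xs × g y ≡ inj₂ z
  collect-∈⁻ []       z∈ = inj₁ z∈
  collect-∈⁻ (x ∷ xs) z∈ with g x in e | collect-∈⁻ xs z∈
  ... | _      | inj₂ (y , y∈ , r) = inj₂ (y , there y∈ , r)
  ... | inj₁ _ | inj₁ z∈b          = inj₁ z∈b
  ... | inj₂ _ | inj₁ (here refl)  = inj₂ (x , here refl , e)
  ... | inj₂ _ | inj₁ (there z∈b)  = inj₁ z∈b

  collect-length : ∀ {b} xs → length (collect g b xs) ≤ length b + length xs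
  collect-length []       = m≤m+n _ 0
  collect-length {b} (x ∷ xs) with g x
  ... | inj₁ _ = ≤-trans (collect-length xs) (+-monoʳ-≤ (length b) (n≤1+n _))
  ... | inj₂ _ = ≤-trans (collect-length xs) (≤-reflexive (sym (+-suc (length b) _)))

-- `numbered` lists its elements in reverse and `collect` reverses once more, so the output comes in
-- the order of the jobs, as the encoding of schedules requires.
collect-reverse-tabulate : ∀ {n} {g : A → ⊤ ⊎ B} (h : Fin n → A) (k : Fin n → B) →
  (∀ j → g (h j) ≡ inj₂ (k j)) → collect g [] (reverse (tabulate h)) ≡ tabulate k
collect-reverse-tabulate {g = g} h k e =
  trans (reverse-foldl _ [] (tabulate h)) (go h k e)
  where
  go : ∀ {n} (h : Fin n → _) (k : Fin n → _) → (∀ j → g (h j) ≡ inj₂ (k j)) →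
       foldr (λ y b → [ (λ _ → b) , (_∷ b) ]′ (g y)) [] (tabulate h) ≡ tabulate k
  go {zero}  h k e = refl
  go {suc n} h k e
    rewrite e Fin.zero = cong (_ ∷_)
      (go (λ j → h (Fin.suc j)) (λ j → k (Fin.suc j)) (λ j → e (Fin.suc j)))

-- A left fold that prepends its results: they come in reverse order.
gather : Fn (σ `× γ) (`1 `⊎ τ) → Fn γ (`List σ) → Fn γ (`List τ) → Fn γ (`List τ)
gather f = fold (case (f ∘ pair fst (snd ∘ snd))
  (fst ∘ snd ∘ snd) (cons fst (fst ∘ snd ∘ snd)))

pickStep : Fn (σ `× γ) `Bool → Fn σ `ℕ → Fn (σ `× (`1 `⊎ σ) `× γ) (`1 `⊎ σ)
pickStep p v = ifte (p ∘ pair fst (snd ∘ snd))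
  (case (fst ∘ snd) (inr (fst ∘ snd))
    (ifte (op leq (v ∘ fst ∘ snd) (v ∘ fst)) (inr (fst ∘ snd)) (inr fst)))
  (fst ∘ snd)

pick : Fn (σ `× γ) `Bool → Fn σ `ℕ → Fn γ (`List σ) → Fn γ (`1 `⊎ σ)
pick p v xs = fold (pickStep p v) xs (inl unit)

data Picked (P : A → Set) (val : A → ℕ) (xs : List A) : ⊤ ⊎ A → Set where
  none : (∀ {y} → y ∈ xs → ¬ P y) → Picked P val xs (inj₁ tt)
  some : ∀ {y} → y ∈ xs → P y → (∀ {z} → z ∈ xs → P z → val y ≤ val z) →
         Picked P val xs (inj₂ y)

picked-some : ∀ {P : A → Set} {val xs c y} → Picked P val xs c → c ≡ inj₂ y → y ∈ xs × P y
picked-some (some y∈ Py _) refl = y∈ , Py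

-- The invariant is `Picked` for the elements scanned so far. That list grows at its front and ends
-- up reversed, but `Picked` only speaks of membership.
picked : ∀ (p : Fn (σ `× γ) `Bool) v xs {x} →
         Picked (λ y → True (run p (y , x))) (run v) (run xs x) (run (pick p v xs) x)
picked {σ} p v xs {x} = go (run xs x) (none λ ())
  where
  P : ⟦ σ ⟧ → Set
  P y = True (run p (y , x))

  keep : ⊤ ⊎ ⟦ σ ⟧ → ⟦ σ ⟧ → ⊤ ⊎ ⟦ σ ⟧
  keep b y = run (pickStep p v) (y , b , x)

  step : ∀ {seen acc} y → Picked P (run v) seen acc → Picked P (run v) (y ∷ seen) (keep acc y)
  step y (none ¬P) with run p (y , x) in e
  ... | inj₁ _ = some (here refl) e λ where
    (here refl) _ → ≤-refl
    (there z∈) Pz → ⊥-elim (¬P z∈ Pz)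
  ... | inj₂ _ = none λ where
    (here refl) Py → ¬True-inj₂ (trans (sym e) Py)
    (there z∈) Pz → ¬P z∈ Pz
  step y (some {z} z∈ Pz min) with run p (y , x) in e
  ... | inj₂ _ = some (there z∈) Pz λ where
    (here refl) Py → ⊥-elim (¬True-inj₂ (trans (sym e) Py))
    (there w∈) Pw → min w∈ Pw
  ... | inj₁ _ with ≤-<-connex (run v y) (run v z)
  ...   | inj₁ y≤z rewrite leq-true y≤z = some (here refl) e λ where
    (here refl) _ → ≤-refl
    (there w∈) Pw → ≤-trans y≤z (min w∈ Pw)
  ...   | inj₂ z<y rewrite leq-false z<y = some (there z∈) Pz λ where
    (here refl) _ → <⇒≤ z<y
    (there w∈) Pw → min w∈ Pw

  unreverse : ∀ {ys acc} → Picked P (run v) (reverse ys) acc → Picked P (run v) ys acc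
  unreverse (none ¬P)       = none λ y∈ → ¬P (Any.reverse⁺ y∈)
  unreverse (some y∈ Py min) = some (Any.reverse⁻ y∈) Py λ z∈ → min (Any.reverse⁺ z∈)

  scan : ∀ ys {seen acc} → Picked P (run v) seen acc →
          Picked P (run v) (ys ʳ++ seen) (foldl keep acc ys)
  scan []       q = q
  scan (y ∷ ys) q = scan ys (step y q)

  go : ∀ ys → Picked P (run v) [] (inj₁ tt) → Picked P (run v) ys (foldl keep (inj₁ tt) ys)
  go ys q = unreverse (scan ys q)

numberStep : Fn (σ `× (`ℕ `× `List (`ℕ `× σ)) `× γ) (`ℕ `× `List (`ℕ `× σ))
numberStep = pair (op add (fst ∘ fst ∘ snd) (lit 1))
                  (cons (pair (fst ∘ fst ∘ snd) fst) (snd ∘ fst ∘ snd))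

-- One pass yields both the length, which enters the scale, and the indices by which the input
-- refers to jobs.
numbered : Fn γ (`List σ) → Fn γ (`ℕ `× `List (`ℕ `× σ))
numbered xs = fold numberStep xs (pair (lit 0) nil)

number : ∀ {n} → (Fin n → A) → Fin n → ℕ × A
number h j = toℕ j , h j

run-numbered : ∀ {n} (xs : Fn γ (`List σ)) {x} (h : Fin n → ⟦ σ ⟧) →
  run xs x ≡ tabulate h → run (numbered xs) x ≡ (n , reverse (tabulate (number h)))
run-numbered {σ = σ} {n = n} xs {x} h e rewrite e = go 0 h []
  where
  append : ℕ × List (ℕ × ⟦ σ ⟧) → ⟦ σ ⟧ → ℕ × List (ℕ × ⟦ σ ⟧)
  append b y = run numberStep (y , b , x)

  go : ∀ {n} k (h : Fin n → ⟦ σ ⟧) out → foldl append (k , out) (tabulate h) ≡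
       (k + n , tabulate (λ j → k + toℕ j , h j) ʳ++ out)
  go {zero}  k h out = cong (_, out) (sym (+-identityʳ k))
  go {suc n} k h out = trans (go (k + 1) (λ j → h (Fin.suc j)) ((k , h Fin.zero) ∷ out))
    (cong₂ _,_ (+-assoc k 1 n)
      (cong₂ (λ i l → l ʳ++ ((i , h Fin.zero) ∷ out)) (sym (+-identityʳ k))
        (tabulate-cong λ j → cong (_, h (Fin.suc j)) (+-assoc k 1 (toℕ j)))))

number-∈ : ∀ {n} (h : Fin n → A) j → (toℕ j , h j) ∈ reverse (tabulate (number h))
number-∈ h j = Any.reverse⁺ (∈-tabulate⁺ {f = number h} j)

number-∈⁻ : ∀ {n} (h : Fin n → A) {z} → z ∈ reverse (tabulate (number h)) →
            ∃[ j ] z ≡ (toℕ j , h j)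
number-∈⁻ h z∈ = ∈-tabulate⁻ {f = number h} (Any.reverse⁻ z∈)

module ResourcesOfCombinators (len num : ℕ) where
  open Resources len num

  safe-case : ∀ (e : Fn γ (ρ `⊎ σ)) (f : Fn (ρ `× γ) τ) g {x} → Safe e x →
              (∀ {y} → run e x ≡ inj₁ y → Safe f (y , x)) →
              (∀ {y} → run e x ≡ inj₂ y → Safe g (y , x)) → Safe (case e f g) x
  safe-case e f g {x} p l r with run e x
  ... | inj₁ y = p , l refl
  ... | inj₂ y = p , r refl

  safe-ifte : ∀ (c : Fn γ `Bool) (f g : Fn γ τ) {x} →
              Safe c x → Safe f x → Safe g x → Safe (ifte c f g) x
  safe-ifte c f g {x} p q r = p , by-cases (run c x) (λ _ → tt , q) (λ _ → tt , r)

  safe-eq : ∀ (f g : Fn γ `ℕ) {x} → Safe f x → Safe g x →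
            run f x ≤ num → run g x ≤ num → Safe (eq f g) x
  safe-eq f g p q m≤ n≤ =
    safe-ifte (op leq f g) (op leq g f) (inr unit)
      ((p , q) , m≤ , n≤) ((q , p) , n≤ , m≤) tt

  safe-gather : ∀ (f : Fn (σ `× γ) (`1 `⊎ τ)) xs a {x} → Safe xs x → Safe a x →
                length (run xs x) ≤ len → (∀ {y} → y ∈ run xs x → Safe f (y , x)) →
                Safe (gather f xs a) x
  safe-gather f xs a {x} p q l safe =
    (p , q) , l , along (λ _ → ⊤) (run xs x)
      (λ {y} y∈ _ → (((_ , safe y∈) , by-cases (run f (y , x)) (λ _ → _) (λ _ → _))) , tt) tt

  safe-pick : ∀ (p : Fn (σ `× γ) `Bool) v xs {x} → Safe xs x → length (run xs x) ≤ len →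
              (∀ {y} → y ∈ run xs x → Safe p (y , x) × Safe v y × run v y ≤ num) →
              Safe (pick p v xs) x
  safe-pick {σ} {γ} p v xs {x} q l safe =
    (q , tt) , l , along Inv (run xs x) step tt
    where
    -- Each comparison evaluates `v` on the element kept so far as well, so its safety and bound
    -- travel with the accumulator.
    Inv : ⊤ ⊎ ⟦ σ ⟧ → Set
    Inv = [ (λ _ → ⊤) , (λ z → Safe v z × run v z ≤ num) ]′

    step : ∀ {y b} → y ∈ run xs x → Inv b →
           Safe (pickStep p v) (y , b , x) × Inv (run (pickStep p v) (y , b , x))
    step {y} {b} y∈ i with safe y∈
    ... | safe-p , safe-v , v≤ with run p (y , x)
    step {y} {b}      y∈ i | safe-p , safe-v , v≤ | inj₂ _ = ((_ , safe-p) , _) , i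
    step {y} {inj₁ _} y∈ i | safe-p , safe-v , v≤ | inj₁ _ = ((_ , safe-p) , _) , safe-v , v≤
    step {y} {inj₂ z} y∈ (safe-z , z≤) | safe-p , safe-v , v≤ | inj₁ _ =
      ((_ , safe-p) , _ , _ ,
        safe-ifte {σ `× σ `× (`1 `⊎ σ) `× γ} {`1 `⊎ σ} (op leq (v ∘ fst ∘ snd) (v ∘ fst))
          (inr (fst ∘ snd)) (inr fst) {z , y , inj₂ z , x}
          (((_ , safe-v) , _ , safe-z) , v≤ , z≤) _ _) ,
      inv
      where
      inv : Inv ([ (λ _ → inj₂ y) , (λ _ → inj₂ z) ]′ (applyOp leq (run v y) (run v z)))
      inv with applyOp leq (run v y) (run v z)
      ... | inj₁ _ = safe-v , v≤
      ... | inj₂ _ = safe-z , z≤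

  safe-numbered : ∀ (xs : Fn γ (`List σ)) {x} → Safe xs x → 1 ≤ num →
                  length (run xs x) ≤ len → length (run xs x) ≤ num →
                  Safe (numbered xs) x
  safe-numbered {γ} {σ} xs {x} p 1≤ l m = (p , _) , l , go 0 [] (run xs x) m
    where
    go : ∀ k out (ys : List ⟦ σ ⟧) → k + length ys ≤ num →
         Along (λ y b → Safe (numberStep {γ = γ}) (y , b , x))
               (λ b y → run (numberStep {γ = γ}) (y , b , x)) (k , out) ys
    go k out []       m = tt
    go k out (y ∷ ys) m =
      ((_ , m+n≤o⇒m≤o k m , 1≤) , _) ,
      go (k + 1) _ ys (≤-trans (≤-reflexive (+-assoc k 1 (length ys))) m)

-- The approximation scheme

`Step `Path `Entry `Job `Row : Ty
-- A job with the delay from its predecessor and its processing times.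
`Step  = `ℕ `× `ℕ `× `ℕ `× `Maybe `ℕ
`Path  = `List (`ℕ `× `Bool `× `ℕ)
-- Side of the last job, (makespan, cost), scaled objective, and the jobs with their sides
-- and completion times.
`Entry = `Bool `× (`ℕ `× `ℕ) `× `ℕ `× `Path
`Job   = `ℕ `× `Maybe `ℕ
`Row   = `List (`Maybe `ℕ)

data Objective : Set where
  minCost minMakespan : Objective

objective resource : Objective → Fn (`ℕ `× `ℕ) `ℕ
objective minCost     = snd
objective minMakespan = fst
resource  minCost     = fst
resource  minMakespan = snd

onServer onCloud : Fn γ `Bool
onServer = inl unit
onCloud  = inr unit

delayToServer delayToCloud : Fn (`Bool `× `Bool `× `Step) `ℕ
delayToServer = case fst (lit 0) (fst ∘ snd ∘ snd ∘ snd ∘ snd)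
delayToCloud  = case fst (fst ∘ snd ∘ snd ∘ snd ∘ snd) (lit 0)

-- What a job adds to (makespan, cost), given the side of its predecessor and its own side. The left
-- injection stands for an infinite weight; it is what keeps the sink off the cloud.
weight : Fn (`Bool `× `Bool `× `Step) (`Maybe (`ℕ `× `ℕ))
weight = case (fst ∘ snd)
  (inr (pair (op add delayToServer (fst ∘ snd ∘ snd ∘ snd ∘ snd)) (lit 0)) ∘ snd)
  (case (snd ∘ snd ∘ snd ∘ snd ∘ snd ∘ snd) (inl unit)
    (inr (pair (op add (delayToCloud ∘ snd ∘ snd) fst) fst)))

lastSide : Fn `Entry `Bool
lastSide = fst

totals : Fn `Entry (`ℕ `× `ℕ)
totals = fst ∘ snd

scaled : Fn `Entry `ℕ
scaled = fst ∘ snd ∘ snd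

path : Fn `Entry `Path
path = snd ∘ snd ∘ snd

`Move `Search `Layer `Final : Ty
`Move   = `Entry `× `Bool `× `ℕ `× `ℕ `× `Step
`Search = `ℕ `× `ℕ `× `List `ℕ `× `List `Step `× `ℕ
`Layer  = `Step `× `List `Entry `× `Search
`Final  = `List `ℕ `× (`ℕ `× `List `ℕ `× `List `Step `× `ℕ) `× `ℕ

moveTo : (∀ {γ} → Fn γ `Bool) → Fn (`Entry `× `Layer) `Move
moveTo y = pair fst (pair y (pair (fst ∘ snd ∘ snd ∘ snd)
  (pair (fst ∘ snd ∘ snd ∘ snd ∘ snd) (fst ∘ snd))))

module _ (o : Objective) where

  -- The new makespan total is also the completion time of the new job, hence the two uses of
  -- `time`. The scaled total grows by the rounded weight.
  advance : Fn ((`ℕ `× `ℕ) `× `Move) `Entry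
  advance =
    pair target (pair (pair time (op add (snd ∘ totals ∘ fst ∘ snd) (snd ∘ fst)))
      (pair (op add (scaled ∘ fst ∘ snd)
                    (op quot (op mul (objective o ∘ fst) (fst ∘ snd ∘ snd ∘ snd ∘ snd))
                             (fst ∘ snd ∘ snd ∘ snd)))
            (cons (pair (fst ∘ snd ∘ snd ∘ snd ∘ snd ∘ snd) (pair target time))
                  (path ∘ fst ∘ snd))))
    where
    target : Fn ((`ℕ `× `ℕ) `× `Move) `Bool
    target = fst ∘ snd ∘ snd
    time : Fn ((`ℕ `× `ℕ) `× `Move) `ℕ
    time = op add (fst ∘ totals ∘ fst ∘ snd) (fst ∘ fst)

  extend : Fn `Move (`Maybe `Entry)
  extend = case
    (weight ∘ pair (lastSide ∘ fst) (pair (fst ∘ snd) (snd ∘ snd ∘ snd ∘ snd)))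
    (inl unit)
    (case (op leq (objective o ∘ fst) (fst ∘ snd ∘ snd ∘ snd))
      (inr (advance ∘ snd)) (inl unit))

  candidates : (∀ {γ} → Fn γ `Bool) → Fn `Layer (`List `Entry)
  candidates y = gather (extend ∘ moveTo y) (fst ∘ snd) nil

  -- Iterating over the keys, and not over the candidates, bounds the result by the number of keys.
  trim : Fn (`List `Entry `× `List `ℕ `× `List `Entry) (`List `Entry)
  trim = gather
    (pick (eq (scaled ∘ fst) (fst ∘ snd)) (resource o ∘ totals) (fst ∘ snd))
    (fst ∘ snd) (snd ∘ snd)

  -- The two target sides are trimmed separately, so that a layer keeps up to two entries per key.
  layer : Fn `Layer (`List `Entry)
  layer = trim ∘ pair (candidates onServer) (pair keys
    (trim ∘ pair (candidates onCloud) (pair keys nil)))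
    where
    keys : Fn `Layer (`List `ℕ)
    keys = fst ∘ snd ∘ snd ∘ snd ∘ snd

  initial : Fn `Search `Entry
  initial = pair onServer (pair (pair (lit 0) (lit 0)) (pair (lit 0)
    (cons (pair (snd ∘ snd ∘ snd ∘ snd) (pair onServer (lit 0))) nil)))

  search : Fn `Search (`List `Entry)
  search = fold layer (fst ∘ snd ∘ snd ∘ snd) (cons initial nil)

  guess : (x y : ∀ {γ} → Fn γ `Bool) → Fn (`Step `× γ) (`Maybe `ℕ)
  guess x y = case (weight ∘ pair x (pair y fst)) (inl unit) (inr (objective o ∘ fst))

  -- All pairs of sides are tried on every step. The guess 0 serves the path without arcs, where
  -- source and sink coincide.
  guesses : Fn (`List `Step) (`List `ℕ)
  guesses =
    gather (guess onServer onServer) id (gather (guess onServer onCloud) id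
      (gather (guess onCloud onServer) id (gather (guess onCloud onCloud) id
        (cons (lit 0) nil))))

  good : Fn (`Entry `× `ℕ `× `Final) `Bool
  good = case (lastSide ∘ fst)
    (op leq (resource o ∘ totals ∘ fst) (snd ∘ snd ∘ snd ∘ snd) ∘ snd) (inr unit)

  -- Ranks by the true objective; scaled totals have only served to thin out the layers.
  champion : Fn (`ℕ `× `Final) (`Maybe `Entry)
  champion = pick good (objective o ∘ totals) (search ∘ pair fst (fst ∘ snd ∘ snd))

  optimum : Fn `Final (`Maybe `Entry)
  optimum = pick (inl unit) (objective o ∘ totals) (gather champion fst nil)

-- Lookup by index. The constant ranking accepts any match, and keys are unique in the lists that
-- are searched.
byKey : Fn γ `ℕ → Fn γ (`List (`ℕ `× σ)) → Fn γ (`Maybe (`ℕ `× σ))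
byKey k = pick (eq (fst ∘ fst) (k ∘ snd)) (lit 0)

isJust : Fn ((ρ `× `Maybe τ) `× γ) `Bool
isJust = case (snd ∘ fst) (inr unit) (inl unit)

`Lists : Ty
`Lists = `List (`ℕ `× `Job) `× `List (`ℕ `× `Row)

resolveJob : Fn (`ℕ `× (`ℕ `× `Maybe `ℕ) `× (`ℕ `× `Row) `× `ℕ `× `Lists) (`Maybe `Step)
resolveJob = case (byKey (fst ∘ fst ∘ snd) (fst ∘ snd ∘ snd ∘ snd ∘ snd)) (inl unit)
  (inr (pair (fst ∘ fst) (pair (fst ∘ snd) (snd ∘ fst))))

resolveDelay : Fn ((`ℕ `× `Maybe `ℕ) `× (`ℕ `× `Row) `× `ℕ `× `Lists) (`Maybe `Step)
resolveDelay = case (snd ∘ fst) (inl unit) resolveJob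

resolveRow : Fn ((`ℕ `× `Row) `× `ℕ `× `Lists) (`Maybe `Step)
resolveRow = case (pick isJust (lit 0) (snd ∘ numbered (snd ∘ fst))) (inl unit) resolveDelay

successor : Fn (`ℕ `× `Lists) (`Maybe `Step)
successor = case (byKey fst (snd ∘ snd)) (inl unit) resolveRow

walkStep : Fn (`Job `× (`ℕ `× `List `Step) `× `List `Job `× `ℕ `× `Lists) (`ℕ `× `List `Step)
walkStep = case (successor ∘ pair (fst ∘ fst ∘ snd) (snd ∘ snd ∘ snd ∘ snd)) (fst ∘ snd ∘ snd)
  (pair (fst ∘ fst) (cons fst (snd ∘ fst ∘ snd ∘ snd)))

-- The list of jobs is a supply of iterations: one per job is enough to reach the sink, where the
-- walk comes to rest. Steps accumulate in reverse.
walk : Fn (`List `Job `× `ℕ `× `Lists) (`ℕ `× `List `Step)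
walk = fold walkStep fst (pair (fst ∘ snd) nil)

`Input : Ty
`Input = (`TaskGraph `× `ℕ) `× `ℚ

jobs : Fn `Input (`List `Job)
jobs = fst ∘ fst ∘ fst

rows : Fn `Input (`List `Row)
rows = fst ∘ snd ∘ fst ∘ fst

sourceIndex : Fn `Input `ℕ
sourceIndex = fst ∘ snd ∘ snd ∘ fst ∘ fst

steps : Fn `Input (`List `Step)
steps = gather (inr fst) (snd ∘ walk ∘ pair jobs
  (pair sourceIndex (pair (snd ∘ numbered jobs) (snd ∘ numbered rows)))) nil

-- The number n M with M = ⌊1/ε⌋ + 1, where 1/ε is the denominator of ε divided by its numerator.
scale : Fn `Input `ℕ
scale = op mul (fst ∘ numbered jobs) (op add (op quot (snd ∘ snd) (fst ∘ snd)) (lit 1))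

scaledBound : Fn `Input `ℕ
scaledBound = op mul (fst ∘ numbered jobs) scale

`Output : Ty
`Output = `1 `⊎ `Schedule

placement : Fn ((`ℕ `× `Job) `× `Entry `× `Maybe `Entry `× `List (`ℕ `× `Job))
               (`Maybe (`Bool `× `ℕ))
placement = case (byKey (fst ∘ fst) (path ∘ fst ∘ snd)) (inl unit) (inr (snd ∘ fst))

assemble : Fn (`Maybe `Entry `× `List (`ℕ `× `Job)) `Output
assemble = case fst (inl unit) (inr (gather placement (snd ∘ snd) nil))

final : Objective → Fn `Input `Final
final o = pair (guesses o ∘ steps)
  (pair (pair scale (pair (range (op add scaledBound (lit 1))) (pair steps sourceIndex)))
        (snd ∘ fst))

scheme : Objective → Fn `Input `Output
scheme o = assemble ∘ pair (optimum o ∘ final o) (snd ∘ numbered jobs)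

-- The dynamic program

quotient : ℕ → ℕ → ℕ
quotient = applyOp quot

quotient-*≤ : ∀ m n → quotient m n * n ≤ m
quotient-*≤ m zero    = z≤n
quotient-*≤ m (suc n) = m/n*n≤m m (suc n)

<1+quotient-* : ∀ m n → m ≤ suc (quotient m (suc n)) * suc n
<1+quotient-* m n = begin
  m                                            ≡⟨ m≡m%n+[m/n]*n m (suc n) ⟩
  m % suc n + quotient m (suc n) * suc n       ≤⟨ +-monoˡ-≤ _ (<⇒≤ (m%n<n m (suc n))) ⟩
  suc n + quotient m (suc n) * suc n           ∎
  where open ≤-Reasoning

-- The bounds hold for w = 0 as well, since then a = 0.
module _ {a w : ℕ} (q : ℕ) (a≤w : a ≤ w) where

  scaling-≥ : a * q ≤ suc (quotient (a * q) w) * w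
  scaling-≥ = go w a≤w
    where
    go : ∀ w → a ≤ w → a * q ≤ suc (quotient (a * q) w) * w
    go zero    z≤n = z≤n
    go (suc w) _   = <1+quotient-* (a * q) w

  scaling-bounded : quotient (a * q) w ≤ q
  scaling-bounded = go w a≤w
    where
    go : ∀ w → a ≤ w → quotient (a * q) w ≤ q
    go zero    _   = z≤n
    go (suc w) a≤w = *-cancelʳ-≤ _ _ (suc w) (begin
      quotient (a * q) (suc w) * suc w  ≤⟨ quotient-*≤ (a * q) (suc w) ⟩
      a * q                             ≤⟨ *-monoˡ-≤ q a≤w ⟩
      suc w * q                         ≡⟨ *-comm (suc w) q ⟩
      q * suc w                         ∎)
      where open ≤-Reasoning

_⊞_ : ℕ × ℕ → ℕ × ℕ → ℕ × ℕ
(t , k) ⊞ (t′ , k′) = t + t′ , k + k′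

value : Objective → ℕ × ℕ → ℕ
value o = run (objective o)

load : Objective → ℕ × ℕ → ℕ
load o = run (resource o)

value-⊞ : ∀ o u v → value o (u ⊞ v) ≡ value o u + value o v
value-⊞ minCost     u v = refl
value-⊞ minMakespan u v = refl

load-⊞ : ∀ o u v → load o (u ⊞ v) ≡ load o u + load o v
load-⊞ minCost     u v = refl
load-⊞ minMakespan u v = refl

module _ (o : Objective) (e : ⟦ `Entry ⟧) (y : ⟦ `Bool ⟧) (w q : ℕ) (st : ⟦ `Step ⟧) where

  -- Inversion of `extend`: matching on it exposes the new entry as a result of `advance`, and in
  -- particular its last side.
  data Extends : ⟦ `Entry ⟧ → Set where
    extends : ∀ {u} → run weight (run lastSide e , y , st) ≡ inj₂ u → value o u ≤ w →
              Extends (run (advance o) (u , e , y , w , q , st))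

  extend⁻ : ∀ {f} → run (extend o) (e , y , w , q , st) ≡ inj₂ f → Extends f
  extend⁻ r with run weight (run lastSide e , y , st) in p
  ... | inj₂ u with applyOp leq (value o u) w in t
  extend⁻ refl | inj₂ u | inj₁ _ = extends p (leq-true⁻ t)

  extend⁺ : ∀ {u} → run weight (run lastSide e , y , st) ≡ inj₂ u → value o u ≤ w →
            run (extend o) (e , y , w , q , st) ≡
            inj₂ (run (advance o) (u , e , y , w , q , st))
  extend⁺ {u} p u≤w rewrite p | leq-true u≤w = refl

-- Sides are indexed by position on the path, not by job. Values beyond the sink are arbitrary, so
-- assignments are compared on initial segments only.
Assignment : Set
Assignment = ℕ → ⟦ `Bool ⟧

infix 4 _≈[_]_
_≈[_]_ : Assignment → ℕ → Assignment → Set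
σ ≈[ k ] τ = ∀ {i} → i ≤ k → σ i ≡ τ i

module Chain (s : ℕ) (step : ℕ → ⟦ `Step ⟧) where

  arc : Assignment → ℕ → ⟦ `Maybe (`ℕ `× `ℕ) ⟧
  arc σ k = run weight (σ k , σ (suc k) , step k)

  total : Assignment → ℕ → ℕ × ℕ
  total σ zero    = 0 , 0
  -- A missing arc contributes zero by default; `Admissible` demands that all arcs exist.
  total σ (suc k) = total σ k ⊞ [ (λ _ → 0 , 0) , (λ u → u) ]′ (arc σ k)

  pathOf : Assignment → ℕ → ⟦ `Path ⟧
  pathOf σ zero    = (s , inj₁ tt , 0) ∷ []
  pathOf σ (suc k) =
    (proj₁ (step k) , σ (suc k) , proj₁ (total σ (suc k))) ∷ pathOf σ k

  module Guess (o : Objective) (w q : ℕ) where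

    startEntry : ⟦ `Entry ⟧
    startEntry = inj₁ tt , (0 , 0) , 0 , (s , inj₁ tt , 0) ∷ []

    -- What the program would build along `σ` if nothing were trimmed. Every surviving entry has
    -- this form, so facts about entries can be proved along a single assignment.
    entryOf : Assignment → ℕ → ⟦ `Maybe `Entry ⟧
    entryOf σ zero    = inj₂ startEntry
    entryOf σ (suc k) =
      [ inj₁ , (λ e → run (extend o) (e , σ (suc k) , w , q , step k)) ]′ (entryOf σ k)

    entryOf-cong : ∀ {σ τ} k → σ ≈[ k ] τ → entryOf σ k ≡ entryOf τ k
    entryOf-cong zero    e = refl
    entryOf-cong (suc k) e
      rewrite entryOf-cong k (λ i≤k → e (≤-trans i≤k (n≤1+n k))) | e (≤-refl {suc k}) = refl

    entryOf-exists : ∀ σ k → (∀ {i} → i < k → ∃[ u ] arc σ i ≡ inj₂ u × value o u ≤ w) →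
                     σ 0 ≡ inj₁ tt → ∃[ e ] entryOf σ k ≡ inj₂ e × run lastSide e ≡ σ k
    entryOf-exists σ zero    h z = startEntry , refl , sym z
    entryOf-exists σ (suc k) h z
      with entryOf-exists σ k (λ i<k → h (≤-trans i<k (n≤1+n k))) z | h (≤-refl {suc k})
    ... | e , p , r | u , a , u≤w rewrite p =
      _ , extend⁺ o e (σ (suc k)) w q (step k)
            (trans (cong (λ x → run weight (x , σ (suc k) , step k)) r) a) u≤w , refl

    -- The scaled total is a sum of k floors of weights multiplied by q / w, and each floor loses at
    -- most one unit. The last two fields say so with denominators cleared, which also covers `w`
    -- equal to 0.
    record Facts (σ : Assignment) (k : ℕ) (e : ⟦ `Entry ⟧) : Set where
      field
        side≡    : run lastSide e ≡ σ k
        totals≡  : run totals e ≡ total σ k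
        path≡    : run path e ≡ pathOf σ k
        arcs     : ∀ {i} → i < k → ∃[ u ] arc σ i ≡ inj₂ u
        scaled≤  : run scaled e ≤ k * q
        scaled-≤ : run scaled e * w ≤ value o (total σ k) * q
        scaled-≥ : value o (total σ k) * q ≤ (run scaled e + k) * w

    facts : ∀ {σ} k {e} → σ 0 ≡ inj₁ tt → entryOf σ k ≡ inj₂ e → Facts σ k e
    facts zero    z refl = record
      { side≡ = sym z ; totals≡ = refl ; path≡ = refl ; arcs = λ ()
      ; scaled≤ = z≤n ; scaled-≤ = z≤n
      ; scaled-≥ = ≤-reflexive (cong (_* q) (case-o o)) }
      where
      case-o : ∀ o → value o (0 , 0) ≡ 0
      case-o minCost     = refl
      case-o minMakespan = refl
    facts {σ} (suc k) z r with entryOf σ k in p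
    ... | inj₂ e with extend⁻ o e (σ (suc k)) w q (step k) r
    ...   | extends {u} a u≤w = record
      { side≡    = refl
      ; totals≡  = total≡
      ; path≡    = cong₂ (λ t l → (proj₁ (step k) , σ (suc k) , proj₁ t) ∷ l) total≡ F.path≡
      ; arcs     = arcs′
      ; scaled≤  = ≤-trans (+-mono-≤ F.scaled≤ (scaling-bounded q u≤w)) (≤-reflexive (+-comm _ q))
      ; scaled-≤ = begin
          (run scaled e + a′) * w                          ≡⟨ *-distribʳ-+ w (run scaled e) a′ ⟩
          run scaled e * w + a′ * w
            ≤⟨ +-mono-≤ F.scaled-≤ (quotient-*≤ (value o u * q) w) ⟩
          value o (total σ k) * q + value o u * q
            ≡⟨ *-distribʳ-+ q (value o (total σ k)) (value o u) ⟨
          (value o (total σ k) + value o u) * q            ≡⟨ cong (_* q) value≡ ⟨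
          value o (total σ (suc k)) * q                    ∎
      ; scaled-≥ = begin
          value o (total σ (suc k)) * q                    ≡⟨ cong (_* q) value≡ ⟩
          (value o (total σ k) + value o u) * q
            ≡⟨ *-distribʳ-+ q (value o (total σ k)) (value o u) ⟩
          value o (total σ k) * q + value o u * q
            ≤⟨ +-mono-≤ F.scaled-≥ (scaling-≥ q u≤w) ⟩
          (run scaled e + k) * w + suc a′ * w
            ≡⟨ *-distribʳ-+ w (run scaled e + k) (suc a′) ⟨
          (run scaled e + k + suc a′) * w
            ≡⟨ cong (_* w) (rearrange (run scaled e) k a′) ⟩
          (run scaled e + a′ + suc k) * w                  ∎
      }
      where
      open ≤-Reasoning
      F = facts k z p
      module F = Facts F
      a′ = quotient (value o u * q) w
      arc≡ : arc σ k ≡ inj₂ u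
      arc≡ = trans (cong (λ x → run weight (x , σ (suc k) , step k)) (sym F.side≡)) a
      total≡ : run totals e ⊞ u ≡ total σ (suc k)
      total≡ = cong₂ _⊞_ F.totals≡ (cong [ (λ _ → 0 , 0) , (λ u → u) ]′ (sym arc≡))
      value≡ : value o (total σ (suc k)) ≡ value o (total σ k) + value o u
      value≡ = trans (cong (λ v → value o (total σ k ⊞ [ (λ _ → 0 , 0) , (λ u → u) ]′ v)) arc≡)
                     (value-⊞ o (total σ k) u)
      arcs′ : ∀ {i} → i < suc k → ∃[ u ] arc σ i ≡ inj₂ u
      arcs′ {i} i<1+k with m<1+n⇒m<n∨m≡n i<1+k
      ... | inj₁ i<k  = F.arcs i<k
      ... | inj₂ refl = u , arc≡
      rearrange : ∀ x k y → x + k + suc y ≡ x + y + suc k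
      rearrange = solve 3 (λ x k y → x :+ k :+ (con 1 :+ y) := x :+ y :+ (con 1 :+ k)) refl
        where open +-*-Solver

module _ (o : Objective) where

  module _ (y : ∀ {γ} → Fn γ `Bool) (b : ⟦ `Bool ⟧) (y≡b : ∀ {γ} {x : ⟦ γ ⟧} → run (y {γ}) x ≡ b)
           (st : ⟦ `Step ⟧) (es : List ⟦ `Entry ⟧) (w q : ℕ)
           (rest : ⟦ `List `ℕ `× `List `Step `× `ℕ ⟧) where

    private
      x : ⟦ `Search ⟧
      x = w , q , rest

      move : ⟦ `Entry ⟧ → ⟦ `Maybe `Entry ⟧
      move e = run (extend o ∘ moveTo y) (e , st , es , x)

      move≡ : ∀ e → move e ≡ run (extend o) (e , b , w , q , st)
      move≡ e = cong (λ b → run (extend o) (e , b , w , q , st)) (y≡b {`Entry `× `Layer} {e , st , es , x})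

    candidates-∈⁺ : ∀ {e f} → e ∈ es → run (extend o) (e , b , w , q , st) ≡ inj₂ f →
                    f ∈ run (candidates o y) (st , es , w , q , rest)
    candidates-∈⁺ {e} e∈ r = collect-∈ʳ {g = move} e∈ (trans (move≡ e) r)

    candidates-∈⁻ : ∀ {f} → f ∈ run (candidates o y) (st , es , w , q , rest) →
                    ∃[ e ] e ∈ es × run (extend o) (e , b , w , q , st) ≡ inj₂ f
    candidates-∈⁻ f∈ with collect-∈⁻ {g = move} es f∈
    ... | inj₂ (e , e∈ , r) = e , e∈ , trans (sym (move≡ e)) r

    candidates-length : length (run (candidates o y) (st , es , w , q , rest)) ≤ length es
    candidates-length = collect-length {g = move} es

  module _ (cs : List ⟦ `Entry ⟧) (ks : List ℕ) (acc : List ⟦ `Entry ⟧) where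

    choose : ℕ → ⟦ `Maybe `Entry ⟧
    choose v = run (pick (eq (scaled ∘ fst) (fst ∘ snd)) (resource o ∘ totals) (fst ∘ snd))
                   (v , cs , ks , acc)

    chosen : ∀ v →
      Picked (λ e → True (run (eq (scaled ∘ fst) (fst ∘ snd)) (e , v , cs , ks , acc)))
             (run (resource o ∘ totals)) cs (choose v)
    chosen v = picked {γ = `ℕ `× `List `Entry `× `List `ℕ `× `List `Entry}
      (eq (scaled ∘ fst) (fst ∘ snd)) (resource o ∘ totals) (fst ∘ snd) {v , cs , ks , acc}

    trim-∈⁻ : ∀ {e} → e ∈ run (trim o) (cs , ks , acc) → e ∈ acc ⊎ e ∈ cs
    trim-∈⁻ e∈ with collect-∈⁻ {g = choose} ks e∈
    ... | inj₁ e∈acc       = inj₁ e∈acc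
    ... | inj₂ (v , _ , r) = inj₂ (proj₁ (picked-some (chosen v) r))

    trim-acc : ∀ {e} → e ∈ acc → e ∈ run (trim o) (cs , ks , acc)
    trim-acc = collect-∈ˡ {g = choose} ks

    -- The entry `f` itself matches the key of its scaled total, so the pick for that key cannot
    -- come back empty.
    trim-∈⁺ : ∀ {f} → f ∈ cs → run scaled f ∈ ks →
              ∃[ g ] g ∈ run (trim o) (cs , ks , acc) × g ∈ cs ×
                run scaled g ≡ run scaled f × load o (run totals g) ≤ load o (run totals f)
    trim-∈⁺ {f} f∈ v∈ with choose (run scaled f) in r | chosen (run scaled f)
    ... | _ | none ¬P = ⊥-elim (¬P f∈
      (eq-true⁺ (scaled ∘ fst) (fst ∘ snd) {f , run scaled f , cs , ks , acc} refl))
    ... | _ | some {g} g∈ t min =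
      g , collect-∈ʳ {g = choose} v∈ r , g∈ ,
      eq-true⁻ (scaled ∘ fst) (fst ∘ snd) {g , run scaled f , cs , ks , acc} t ,
      min f∈ (eq-true⁺ (scaled ∘ fst) (fst ∘ snd) {f , run scaled f , cs , ks , acc} refl)

    trim-length : length (run (trim o) (cs , ks , acc)) ≤ length acc + length ks
    trim-length = collect-length {g = choose} ks

  module Layer (st : ⟦ `Step ⟧) (es : List ⟦ `Entry ⟧) (w q : ℕ) (ks : List ℕ)
               (rest : ⟦ `List `Step `× `ℕ ⟧) where

    x : ⟦ `Search ⟧
    x = w , q , ks , rest

    toServer toCloud fromCloud : List ⟦ `Entry ⟧
    toServer  = run (candidates o onServer) (st , es , x)
    toCloud   = run (candidates o onCloud) (st , es , x)
    fromCloud = run (trim o) (toCloud , ks , [])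

    layer-∈⁻ : ∀ {f} → f ∈ run (layer o) (st , es , x) →
               ∃[ e ] ∃[ b ] e ∈ es × run (extend o) (e , b , w , q , st) ≡ inj₂ f
    layer-∈⁻ f∈ with trim-∈⁻ toServer ks fromCloud f∈
    ... | inj₂ f∈′ with e , e∈ , r ← candidates-∈⁻ onServer (inj₁ tt) refl st es w q (ks , rest) f∈′ =
      e , inj₁ tt , e∈ , r
    ... | inj₁ f∈′ with trim-∈⁻ toCloud ks [] f∈′
    ...   | inj₂ f∈″ with e , e∈ , r ← candidates-∈⁻ onCloud (inj₂ tt) refl st es w q (ks , rest) f∈″ =
      e , inj₂ tt , e∈ , r

    layer-∈⁺ : ∀ {e f} b → e ∈ es → run (extend o) (e , b , w , q , st) ≡ inj₂ f →
               run scaled f ∈ ks →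
               ∃[ g ] g ∈ run (layer o) (st , es , x) × run lastSide g ≡ b ×
                 run scaled g ≡ run scaled f × load o (run totals g) ≤ load o (run totals f)
    layer-∈⁺ (inj₁ tt) e∈ r v∈
      with g , g∈ , g∈c , s≡ , l≤ ← trim-∈⁺ toServer ks fromCloud
             (candidates-∈⁺ onServer (inj₁ tt) refl st es w q (ks , rest) e∈ r) v∈
      with e′ , _ , r′ ← candidates-∈⁻ onServer (inj₁ tt) refl st es w q (ks , rest) g∈c
      -- Matching on `Extends` reveals the last side of `g`.
      with extends _ _ ← extend⁻ o e′ (inj₁ tt) w q st r′ =
      g , g∈ , refl , s≡ , l≤
    layer-∈⁺ (inj₂ tt) e∈ r v∈
      with g , g∈ , g∈c , s≡ , l≤ ← trim-∈⁺ toCloud ks []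
             (candidates-∈⁺ onCloud (inj₂ tt) refl st es w q (ks , rest) e∈ r) v∈
      with e′ , _ , r′ ← candidates-∈⁻ onCloud (inj₂ tt) refl st es w q (ks , rest) g∈c
      with extends _ _ ← extend⁻ o e′ (inj₂ tt) w q st r′ =
      g , trim-acc toServer ks fromCloud g∈ , refl , s≡ , l≤

    layer-length : length (run (layer o) (st , es , x)) ≤ length ks + length ks
    layer-length = ≤-trans (trim-length toServer ks fromCloud)
      (+-monoˡ-≤ (length ks) (trim-length toCloud ks []))

module SearchProperties (o : Objective) (s : ℕ) (step : ℕ → ⟦ `Step ⟧) (w q L : ℕ)
              (sts : List ⟦ `Step ⟧) where

  open Chain s step
  open Guess o w q

  context : ⟦ `Search ⟧
  context = w , q , downFrom (suc L) , sts , s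

  entries : ℕ → List ⟦ `Entry ⟧
  entries zero    = startEntry ∷ []
  entries (suc k) = run (layer o) (step k , entries k , context)

  extendAt : Assignment → ℕ → ⟦ `Bool ⟧ → Assignment
  extendAt σ k b i with i ≤? k
  ... | yes _ = σ i
  ... | no  _ = b

  extendAt-≈ : ∀ σ k b → σ ≈[ k ] extendAt σ k b
  extendAt-≈ σ k b {i} i≤k with i ≤? k
  ... | yes _   = refl
  ... | no  i≰k = ⊥-elim (i≰k i≤k)

  extendAt-suc : ∀ σ k b → extendAt σ k b (suc k) ≡ b
  extendAt-suc σ k b with suc k ≤? k
  ... | yes 1+k≤k = ⊥-elim (1+n≰n 1+k≤k)
  ... | no  _     = refl

  -- Trimming only discards, so a survivor extends a survivor of the previous layer; the assignment
  -- of the latter is overridden beyond `k`. This yields feasibility of the output as well as the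
  -- bounds on all numbers of the search.
  sound : ∀ k {e} → e ∈ entries k → ∃[ σ ] σ 0 ≡ inj₁ tt × entryOf σ k ≡ inj₂ e
  sound zero    (here refl) = (λ _ → inj₁ tt) , refl , refl
  sound (suc k) f∈
    with e , b , e∈ , r ← Layer.layer-∈⁻ o (step k) (entries k) w q (downFrom (suc L)) (sts , s) f∈
    with σ , z , p ← sound k e∈ =
    extendAt σ k b , trans (sym (extendAt-≈ σ k b z≤n)) z , entry≡
    where
    entry≡ : entryOf (extendAt σ k b) (suc k) ≡ inj₂ _
    entry≡ rewrite trans (sym (entryOf-cong k (extendAt-≈ σ k b))) p | extendAt-suc σ k b = r

  -- The exchange argument: the substitute `g` ends on the same side as `e`, so the next arc weighs
  -- the same after both and adds equally to scaled total and load. Trimming can then only lower the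
  -- load.
  complete : ∀ k → k * q ≤ L → ∀ {σ e} → σ 0 ≡ inj₁ tt → entryOf σ k ≡ inj₂ e →
             ∃[ g ] g ∈ entries k × run lastSide g ≡ run lastSide e ×
               run scaled g ≡ run scaled e × load o (run totals g) ≤ load o (run totals e)
  complete zero    _ z refl = startEntry , here refl , refl , refl , ≤-refl
  complete (suc k) kq≤L {σ} z r with entryOf σ k in p
  ... | inj₂ e
    with g , g∈ , side≡ , scaled≡ , load≤ ←
           complete k (≤-trans (m≤n+m (k * q) q) kq≤L) z p
    with extend⁻ o e (σ (suc k)) w q (step k) r
       | Facts.scaled≤ (facts (suc k) z (trans (cong [ inj₁ , _ ]′ p) r))
  ...   | extends {u} a u≤w | f≤
    with h , h∈ , side≡′ , scaled≡′ , load≤′ ←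
           Layer.layer-∈⁺ o (step k) (entries k) w q (downFrom (suc L)) (sts , s) (σ (suc k)) g∈
             (extend⁺ o g (σ (suc k)) w q (step k)
               (trans (cong (λ b → run weight (b , σ (suc k) , step k)) side≡) a) u≤w)
             -- The extension of `g` has the scaled total of the extension of `e`, which is at most
             -- `suc k * q` and hence among the keys.
             (∈-downFrom⁺ (s≤s (≤-trans (≤-reflexive (cong (_+ _) scaled≡)) (≤-trans f≤ kq≤L)))) =
    h , h∈ , side≡′ , trans scaled≡′ (cong (_+ _) scaled≡) , (begin
      load o (run totals h)               ≤⟨ load≤′ ⟩
      load o (run totals g ⊞ u)           ≡⟨ load-⊞ o (run totals g) u ⟩
      load o (run totals g) + load o u    ≤⟨ +-monoˡ-≤ (load o u) load≤ ⟩
      load o (run totals e) + load o u    ≡⟨ load-⊞ o (run totals e) u ⟨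
      load o (run totals e ⊞ u)           ∎)
    where open ≤-Reasoning

module Steps (step : ℕ → ⟦ `Step ⟧) where

  revSteps : ℕ → List ⟦ `Step ⟧
  revSteps zero    = []
  revSteps (suc k) = step k ∷ revSteps k

  length-revSteps : ∀ m → length (revSteps m) ≡ m
  length-revSteps zero    = refl
  length-revSteps (suc m) = cong suc (length-revSteps m)

  revSteps-∈ : ∀ {i m} → i < m → step i ∈ revSteps m
  revSteps-∈ {i} {suc m} i<1+m with m<1+n⇒m<n∨m≡n i<1+m
  ... | inj₁ i<m  = there (revSteps-∈ i<m)
  ... | inj₂ refl = here refl

  revSteps-∈⁻ : ∀ m {st} → st ∈ revSteps m → ∃[ i ] i < m × st ≡ step i
  revSteps-∈⁻ (suc m) (here refl) = m , ≤-refl , refl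
  revSteps-∈⁻ (suc m) (there st∈) with i , i<m , p ← revSteps-∈⁻ m st∈ =
    i , ≤-trans i<m (n≤1+n m) , p

module _ (o : Objective) (sts : List ⟦ `Step ⟧) where

  guessOf : ⟦ `Bool ⟧ → ⟦ `Bool ⟧ → ⟦ `Step ⟧ → ⟦ `Maybe `ℕ ⟧
  guessOf x y st = [ inj₁ , (λ u → inj₂ (value o u)) ]′ (run weight (x , y , st))

  guesses₃ guesses₂ guesses₁ : List ℕ
  guesses₃ = collect (guessOf (inj₂ tt) (inj₂ tt)) (0 ∷ []) sts
  guesses₂ = collect (guessOf (inj₂ tt) (inj₁ tt)) guesses₃ sts
  guesses₁ = collect (guessOf (inj₁ tt) (inj₂ tt)) guesses₂ sts

  guesses-0 : 0 ∈ run (guesses o) sts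
  guesses-0 =
    collect-∈ˡ {g = guessOf (inj₁ tt) (inj₁ tt)} sts
    (collect-∈ˡ {g = guessOf (inj₁ tt) (inj₂ tt)} sts
    (collect-∈ˡ {g = guessOf (inj₂ tt) (inj₁ tt)} sts
    (collect-∈ˡ {g = guessOf (inj₂ tt) (inj₂ tt)} sts (here refl))))

  guesses-∈ : ∀ x y {st u} → st ∈ sts → run weight (x , y , st) ≡ inj₂ u →
              value o u ∈ run (guesses o) sts
  guesses-∈ x y {u = u} st∈ r with cong [ inj₁ , (λ u → inj₂ (value o u)) ]′ r
  guesses-∈ (inj₁ tt) (inj₁ tt) st∈ _ | r = collect-∈ʳ {g = guessOf (inj₁ tt) (inj₁ tt)} st∈ r
  guesses-∈ (inj₁ tt) (inj₂ tt) st∈ _ | r =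
    collect-∈ˡ {g = guessOf (inj₁ tt) (inj₁ tt)} sts
    (collect-∈ʳ {g = guessOf (inj₁ tt) (inj₂ tt)} st∈ r)
  guesses-∈ (inj₂ tt) (inj₁ tt) st∈ _ | r =
    collect-∈ˡ {g = guessOf (inj₁ tt) (inj₁ tt)} sts
    (collect-∈ˡ {g = guessOf (inj₁ tt) (inj₂ tt)} sts
    (collect-∈ʳ {g = guessOf (inj₂ tt) (inj₁ tt)} st∈ r))
  guesses-∈ (inj₂ tt) (inj₂ tt) st∈ _ | r =
    collect-∈ˡ {g = guessOf (inj₁ tt) (inj₁ tt)} sts
    (collect-∈ˡ {g = guessOf (inj₁ tt) (inj₂ tt)} sts
    (collect-∈ˡ {g = guessOf (inj₂ tt) (inj₁ tt)} sts
    (collect-∈ʳ {g = guessOf (inj₂ tt) (inj₂ tt)} st∈ r)))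

  guesses-length : length (run (guesses o) sts) ≤
                   1 + length sts + length sts + length sts + length sts
  guesses-length =
    ≤-trans (collect-length {g = guessOf (inj₁ tt) (inj₁ tt)} sts) (+-monoˡ-≤ (length sts)
    (≤-trans (collect-length {g = guessOf (inj₁ tt) (inj₂ tt)} sts) (+-monoˡ-≤ (length sts)
    (≤-trans (collect-length {g = guessOf (inj₂ tt) (inj₁ tt)} sts) (+-monoˡ-≤ (length sts)
    (collect-length {g = guessOf (inj₂ tt) (inj₂ tt)} sts))))))

  Guessed : ℕ → Set
  Guessed w = ∃[ x ] ∃[ y ] ∃[ st ] ∃[ u ]
    st ∈ sts × run weight (x , y , st) ≡ inj₂ u × w ≡ value o u

  guessed : ∀ x y {b w} → w ∈ collect (guessOf x y) b sts → w ∈ b ⊎ Guessed w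
  guessed x y {w = w} w∈ with collect-∈⁻ {g = guessOf x y} sts w∈
  ... | inj₁ w∈b = inj₁ w∈b
  ... | inj₂ (st , st∈ , r) = inj₂ (unguess r)
    where
    unguess : guessOf x y st ≡ inj₂ w → Guessed w
    unguess r with run weight (x , y , st) in p
    unguess refl | inj₂ u = x , y , st , u , st∈ , p , refl

  guesses-∈⁻ : ∀ {w} → w ∈ run (guesses o) sts → w ≡ 0 ⊎ Guessed w
  guesses-∈⁻ w∈ with guessed (inj₁ tt) (inj₁ tt) w∈
  ... | inj₂ g = inj₂ g
  ... | inj₁ w∈₁ with guessed (inj₁ tt) (inj₂ tt) w∈₁
  ...   | inj₂ g = inj₂ g
  ...   | inj₁ w∈₂ with guessed (inj₂ tt) (inj₁ tt) w∈₂
  ...     | inj₂ g = inj₂ g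
  ...     | inj₁ w∈₃ with guessed (inj₂ tt) (inj₂ tt) w∈₃
  ...       | inj₂ g = inj₂ g
  ...       | inj₁ (here w≡0) = inj₁ w≡0

module Optimisation (o : Objective) (s : ℕ) (step : ℕ → ⟦ `Step ⟧) (m : ℕ)
                    {n : ℕ} (m≤n : m ≤ n) .{{n≢0 : NonZero n}} (M bound : ℕ) where

  open Chain s step
  open Steps step

  sts : List ⟦ `Step ⟧
  sts = reverse (revSteps m)

  q L : ℕ
  q = n * M
  L = n * q

  fin : ⟦ `Final ⟧
  fin = run (guesses o) sts , (q , downFrom (suc L) , sts , s) , bound

  module _ (w : ℕ) where
    open SearchProperties o s step w q L sts

    -- Stated for every prefix, since the time bound needs the accumulators inside the fold and not
    -- only its result.
    foldl-entries : ∀ k → foldl (λ es st → run (layer o) (st , es , context)) (entries 0)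
                            (reverse (revSteps k)) ≡ entries k
    foldl-entries k = trans (reverse-foldl _ _ (revSteps k)) (go k)
      where
      go : ∀ k → foldr (λ st es → run (layer o) (st , es , context)) (entries 0) (revSteps k) ≡
                 entries k
      go zero    = refl
      go (suc k) = cong (λ es → run (layer o) (step k , es , context)) (go k)

    search≡ : run (search o) (w , q , downFrom (suc L) , sts , s) ≡ entries m
    search≡ = foldl-entries m

  record Admissible (σ : Assignment) : Set where
    field
      starts  : σ 0 ≡ inj₁ tt
      ends    : σ m ≡ inj₁ tt
      arcs    : ∀ {i} → i < m → ∃[ u ] arc σ i ≡ inj₂ u
      within  : load o (total σ m) ≤ bound

  -- The witness is the largest objective weight among the arcs. A maximum of naturals is at most
  -- their sum, and this comparison with the optimum is what pays for the rounding.
  bottleneck : ∀ σ k → k ≤ m → (∀ {i} → i < k → ∃[ u ] arc σ i ≡ inj₂ u) →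
    ∃[ w ] w ∈ run (guesses o) sts × w ≤ value o (total σ k) ×
      (∀ {i} → i < k → ∃[ u ] arc σ i ≡ inj₂ u × value o u ≤ w)
  bottleneck σ zero    _    h = 0 , guesses-0 o sts , z≤n , λ ()
  bottleneck σ (suc k) k<m  h
    with w , w∈ , w≤ , all ← bottleneck σ k (<⇒≤ k<m) (λ i<k → h (≤-trans i<k (n≤1+n k)))
       | u , a ← h (≤-refl {suc k})
    with value≡ ← trans (cong (λ v → value o (total σ k ⊞ [ (λ _ → 0 , 0) , (λ u → u) ]′ v)) a)
                        (value-⊞ o (total σ k) u)
    with ≤-total w (value o u)
  ... | inj₁ w≤u =
    value o u , guesses-∈ o sts (σ k) (σ (suc k)) (Any.reverse⁺ (revSteps-∈ k<m)) a ,
    ≤-trans (m≤n+m _ _) (≤-reflexive (sym value≡)) , all′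
    where
    all′ : ∀ {i} → i < suc k → ∃[ v ] arc σ i ≡ inj₂ v × value o v ≤ value o u
    all′ i<1+k with m<1+n⇒m<n∨m≡n i<1+k
    ... | inj₁ i<k with v , p , v≤ ← all i<k = v , p , ≤-trans v≤ w≤u
    ... | inj₂ refl = u , a , ≤-refl
  ... | inj₂ u≤w =
    w , w∈ , ≤-trans w≤ (≤-trans (m≤m+n _ _) (≤-reflexive (sym value≡))) , all′
    where
    all′ : ∀ {i} → i < suc k → ∃[ v ] arc σ i ≡ inj₂ v × value o v ≤ w
    all′ i<1+k with m<1+n⇒m<n∨m≡n i<1+k
    ... | inj₁ i<k  = all i<k
    ... | inj₂ refl = u , a , u≤w

  Good : ⟦ `Entry ⟧ → Set
  Good e = run lastSide e ≡ inj₁ tt × load o (run totals e) ≤ bound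

  good⁺ : ∀ {e w} → Good e → True (run (good o) (e , w , fin))
  good⁺ (refl , l) = leq-true l

  good⁻ : ∀ {e w} → True (run (good o) (e , w , fin)) → Good e
  good⁻ {inj₁ _ , _} t = refl , leq-true⁻ t

  championOf : ℕ → ⟦ `Maybe `Entry ⟧
  championOf w = run (champion o) (w , fin)

  champion-picked : ∀ w → Picked (λ e → True (run (good o) (e , w , fin)))
    (run (objective o ∘ totals)) (run (search o) (w , q , downFrom (suc L) , sts , s)) (championOf w)
  champion-picked w =
    picked (good o) (objective o ∘ totals) (search o ∘ pair fst (fst ∘ snd ∘ snd)) {w , fin}

  champions : List ⟦ `Entry ⟧
  champions = collect championOf [] (run (guesses o) sts)

  optimum-picked : Picked (λ _ → True (inj₁ tt)) (run (objective o ∘ totals)) champions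
                     (run (optimum o) fin)
  optimum-picked = picked (inl unit) (objective o ∘ totals) (gather (champion o) fst nil) {fin}

  record Solves (e : ⟦ `Entry ⟧) (σ : Assignment) : Set where
    field
      feasible : Admissible σ
      path≡    : run path e ≡ pathOf σ m
      value≡   : value o (run totals e) ≡ value o (total σ m)

  -- Holds for right and wrong guesses alike: discarding heavy arcs leaves only true partial
  -- schedules, and `good` checks the end and the bound on unscaled totals.
  solves : ∀ {e} → e ∈ champions → ∃[ σ ] Solves e σ
  solves {e} e∈ with collect-∈⁻ {g = championOf} (run (guesses o) sts) e∈
  ... | inj₂ (w , _ , r)
    with e∈′ , t ← picked-some (champion-picked w) r
    with σ , z , p ← SearchProperties.sound o s step w q L sts m (subst (_ ∈_) (search≡ w) e∈′)
    with g₁ , g₂ ← good⁻ {e} {w} t =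
    let open Guess.Facts (Guess.facts o w q m z p) in
    σ , record
      { feasible = record
        { starts = z
        ; ends   = trans (sym side≡) g₁
        ; arcs   = arcs
        ; within = subst (λ v → load o v ≤ bound) totals≡ g₂
        }
      ; path≡  = path≡
      ; value≡ = cong (value o) totals≡
      }

  -- For the bottleneck of `σ` as guess, the search keeps some `g` with the scaled total of `σ` and
  -- no larger load. So `g` is good and the champion is at least as good as `g`. The rounding costs
  -- at most `m * w`, and `w` is at most the value of `σ`; dividing by `n` leaves the claim.
  competitive : ∀ {σ} → Admissible σ → ∃[ e ] e ∈ champions ×
                value o (run totals e) * M ≤ value o (total σ m) * suc M
  competitive {σ} f
    with w , w∈ , w≤ , all ← bottleneck σ m ≤-refl (Admissible.arcs f)
    with e , p , _ ← Guess.entryOf-exists o w q σ m all (Admissible.starts f)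
    with g , g∈ , side≡ , scaled≡ , load≤ ← SearchProperties.complete o s step w q L sts m
           (*-monoˡ-≤ q m≤n) (Admissible.starts f) p
    -- `g` may follow another assignment `τ`. Its true value is known only through the scaled total
    -- it shares with `σ`, which is why both rounding bounds are used.
    with τ , z , r ← SearchProperties.sound o s step w q L sts m g∈
    with championOf w in c | champion-picked w
  ... | _ | none ¬P = ⊥-elim (¬P (subst (g ∈_) (sym (search≡ w)) g∈) (good⁺ {g} {w} good-g))
    where
    module E = Guess.Facts (Guess.facts o w q m (Admissible.starts f) p)
    good-g : Good g
    good-g = trans side≡ (trans E.side≡ (Admissible.ends f)) ,
             ≤-trans load≤ (subst (λ v → load o v ≤ bound) (sym E.totals≡) (Admissible.within f))
  ... | _ | some {h} h∈ t min =
    h , collect-∈ʳ {g = championOf} w∈ c , *-cancelˡ-≤ n (begin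
      n * (value o (run totals h) * M)
        ≡⟨ solve 3 (λ n v M → n :* (v :* M) := v :* (n :* M)) refl n (value o (run totals h)) M ⟩
      value o (run totals h) * q
        ≤⟨ *-monoˡ-≤ q (min (subst (g ∈_) (sym (search≡ w)) g∈) (good⁺ {g} {w} good-g)) ⟩
      value o (run totals g) * q                  ≡⟨ cong (λ v → value o v * q) G.totals≡ ⟩
      value o (total τ m) * q                     ≤⟨ G.scaled-≥ ⟩
      (run scaled g + m) * w                      ≡⟨ cong (λ a → (a + m) * w) scaled≡ ⟩
      (run scaled e + m) * w                      ≡⟨ *-distribʳ-+ w (run scaled e) m ⟩
      run scaled e * w + m * w                    ≤⟨ +-mono-≤ E.scaled-≤ (*-mono-≤ m≤n w≤) ⟩
      value o (total σ m) * q + n * value o (total σ m)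
        ≡⟨ solve 3 (λ n v M → v :* (n :* M) :+ n :* v := n :* (v :* (con 1 :+ M))) refl
             n (value o (total σ m)) M ⟩
      n * (value o (total σ m) * suc M)           ∎)
    where
    open ≤-Reasoning
    open +-*-Solver
    module E = Guess.Facts (Guess.facts o w q m (Admissible.starts f) p)
    module G = Guess.Facts (Guess.facts o w q m z r)
    good-g : Good g
    good-g = trans side≡ (trans E.side≡ (Admissible.ends f)) ,
             ≤-trans load≤ (subst (λ v → load o v ≤ bound) (sym E.totals≡) (Admissible.within f))

  data Outcome : ⟦ `Maybe `Entry ⟧ → Set where
    infeasible : (∀ σ → ¬ Admissible σ) → Outcome (inj₁ tt)
    solved     : ∀ {e} σ → Solves e σ →
                 (∀ {τ} → Admissible τ → value o (total σ m) * M ≤ value o (total τ m) * suc M) →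
                 Outcome (inj₂ e)

  outcome : Outcome (run (optimum o) fin)
  outcome with run (optimum o) fin | optimum-picked
  ... | _ | none ¬P = infeasible λ σ f → ¬P (proj₁ (proj₂ (competitive f))) refl
  ... | _ | some {e} e∈ _ min with σ , sol ← solves e∈ = solved σ sol λ f →
    let e′ , e′∈ , le = competitive f in
    ≤-trans (*-monoˡ-≤ M (subst (_≤ _) (Solves.value≡ sol) (min e′∈ refl))) le

-- Resources used by the search

-- An infinite cloud time is unconstrained, since no arithmetic is done on it.
Bounded : ℕ → ⟦ `Step ⟧ → Set
Bounded P (_ , c , p , r) = c ≤ P × p ≤ P × (∀ {q} → r ≡ inj₂ q → q ≤ P)

weight-bounded : ∀ {P} x y st {u} → Bounded P st → run weight (x , y , st) ≡ inj₂ u →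
                 proj₁ u ≤ P + P × proj₂ u ≤ P + P
weight-bounded {P} (inj₁ _) (inj₁ _) (_ , c , p , r)      (c≤ , p≤ , r≤) refl =
  ≤-trans p≤ (m≤m+n P P) , z≤n
weight-bounded {P} (inj₂ _) (inj₁ _) (_ , c , p , r)      (c≤ , p≤ , r≤) refl =
  +-mono-≤ c≤ p≤ , z≤n
weight-bounded {P} (inj₁ _) (inj₂ _) (_ , c , p , inj₂ r) (c≤ , p≤ , r≤) refl =
  +-mono-≤ c≤ (r≤ refl) , ≤-trans (r≤ refl) (m≤m+n P P)
weight-bounded {P} (inj₂ _) (inj₂ _) (_ , c , p , inj₂ r) (c≤ , p≤ , r≤) refl =
  ≤-trans (r≤ refl) (m≤m+n P P) , ≤-trans (r≤ refl) (m≤m+n P P)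

value≤ : ∀ o {u X} → proj₁ u ≤ X × proj₂ u ≤ X → value o u ≤ X
value≤ minCost     (_ , k≤) = k≤
value≤ minMakespan (t≤ , _) = t≤

load≤ : ∀ o {u X} → proj₁ u ≤ X × proj₂ u ≤ X → load o u ≤ X
load≤ minCost     (t≤ , _) = t≤
load≤ minMakespan (_ , k≤) = k≤

module SafeSearch (o : Objective) (s : ℕ) (step : ℕ → ⟦ `Step ⟧) (m : ℕ)
  {n : ℕ} (m≤n : m ≤ n) .{{n≢0 : NonZero n}} (M bound : ℕ)
  (len num P : ℕ)
  (bounded : ∀ {i} → i < m → Bounded P (step i))
  (entries≤len : suc (n * (n * M)) + suc (n * (n * M)) ≤ len)
  (guesses≤len : 1 + n + n + n + n ≤ len)
  (L≤num : n * (n * M) ≤ num) (nX≤num : n * (P + P) ≤ num) (Xq≤num : (P + P) * (n * M) ≤ num)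
  (q≤num : n * M ≤ num) (bound≤num : bound ≤ num)
  where

  open Optimisation o s step m m≤n M bound

  X : ℕ
  X = P + P

  open Resources len num
  open ResourcesOfCombinators len num
  open Chain s step
  open Steps step

  n≤len : n ≤ len
  n≤len = ≤-trans (≤-trans (m≤n+m n (1 + n + n + n)) ≤-refl) guesses≤len

  X≤num : X ≤ num
  X≤num = ≤-trans (m≤n*m X n) nX≤num

  P≤num : P ≤ num
  P≤num = ≤-trans (m≤m+n P P) X≤num

  safe-objective : ∀ o u → Safe (objective o) u
  safe-objective minCost     u = tt
  safe-objective minMakespan u = tt

  safe-resource : ∀ o u → Safe (resource o) u
  safe-resource minCost     u = tt
  safe-resource minMakespan u = tt

  safe-weight : ∀ x y st → Bounded P st → Safe weight (x , y , st)
  safe-weight (inj₁ _) (inj₁ _) st (c≤ , p≤ , r≤) = _ , _ , (_ , z≤n , ≤-trans p≤ P≤num) , _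
  safe-weight (inj₂ _) (inj₁ _) st (c≤ , p≤ , r≤) =
    _ , _ , (_ , ≤-trans c≤ P≤num , ≤-trans p≤ P≤num) , _
  safe-weight (inj₁ _) (inj₂ _) (_ , _ , _ , inj₁ _) _ = _
  safe-weight (inj₂ _) (inj₂ _) (_ , _ , _ , inj₁ _) _ = _
  safe-weight (inj₁ _) (inj₂ _) (_ , _ , _ , inj₂ _) (c≤ , p≤ , r≤) =
    _ , _ , (_ , ≤-trans c≤ P≤num , ≤-trans (r≤ refl) P≤num) , _
  safe-weight (inj₂ _) (inj₂ _) (_ , _ , _ , inj₂ _) (c≤ , p≤ , r≤) =
    _ , _ , (_ , z≤n , ≤-trans (r≤ refl) P≤num) , _

  total-bounded : ∀ σ k → k ≤ m → (∀ {i} → i < k → ∃[ u ] arc σ i ≡ inj₂ u) →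
                  proj₁ (total σ k) ≤ k * X × proj₂ (total σ k) ≤ k * X
  total-bounded σ zero    _   h = z≤n , z≤n
  total-bounded σ (suc k) k<m h
    with t≤ , k≤ ← total-bounded σ k (<⇒≤ k<m) (λ i<k → h (≤-trans i<k (n≤1+n k)))
    with u , r ← h (≤-refl {suc k})
    with t≤′ , k≤′ ← weight-bounded (σ k) (σ (suc k)) (step k) (bounded k<m) r
    rewrite r | +-comm X (k * X) = +-mono-≤ t≤ t≤′ , +-mono-≤ k≤ k≤′

  sts≤n : length sts ≤ n
  sts≤n = ≤-trans (≤-reflexive (trans (length-reverse (revSteps m)) (length-revSteps m))) m≤n

  sts≤len : length sts ≤ len
  sts≤len = ≤-trans sts≤n n≤len

  module _ (w : ℕ) (w≤num : w ≤ num) where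
    open Guess o w q
    open SearchProperties o s step w q L sts

    record EntryBounds (k : ℕ) (e : ⟦ `Entry ⟧) : Set where
      field
        totals≤ : proj₁ (run totals e) ≤ k * X × proj₂ (run totals e) ≤ k * X
        scaled≤ : run scaled e ≤ k * q

    -- By soundness an entry records totals over `k` arcs of a single assignment, so its numbers
    -- grow linearly with `k`.
    entry-bounds : ∀ {k e} → k ≤ m → e ∈ entries k → EntryBounds k e
    entry-bounds {k} k≤m e∈ with σ , z , p ← sound k e∈ = record
      { totals≤ = subst (λ u → proj₁ u ≤ k * X × proj₂ u ≤ k * X) (sym F.totals≡)
                    (total-bounded σ k k≤m F.arcs)
      ; scaled≤ = F.scaled≤ }
      where module F = Facts (facts k z p)

    kX≤num : ∀ {k} → k ≤ m → k * X ≤ num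
    kX≤num k≤m = ≤-trans (*-monoˡ-≤ X (≤-trans k≤m m≤n)) nX≤num

    kq≤num : ∀ {k} → k ≤ m → k * q ≤ num
    kq≤num k≤m = ≤-trans (*-monoˡ-≤ q (≤-trans k≤m m≤n)) L≤num

    safe-advance : ∀ {k u e y} → k < m → EntryBounds k e → proj₁ u ≤ X × proj₂ u ≤ X →
                   value o u ≤ w → Safe (advance o) (u , e , y , w , q , step k)
    safe-advance {k} {u} {e} {y} k<m b u≤ v≤w =
      _ , (safe-time , _ , ≤-trans (proj₂ totals≤) kX , ≤-trans (proj₂ u≤) X≤num) ,
      ((_ , safe-quot) , ≤-trans scaled≤ (kq≤num (<⇒≤ k<m)) , ≤-trans (scaling-bounded q v≤w) q≤num) ,
      (_ , _ , safe-time) , _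
      where
      open EntryBounds b
      kX = kX≤num (<⇒≤ k<m)
      safe-time = _ , ≤-trans (proj₁ totals≤) kX , ≤-trans (proj₁ u≤) X≤num
      safe-mul = ((_ , safe-objective o u) , _) , ≤-trans (value≤ o u≤) X≤num , q≤num
      safe-quot = (safe-mul , _) , ≤-trans (*-monoˡ-≤ q (value≤ o u≤)) Xq≤num , w≤num

    safe-extend : ∀ {k e} y → k < m → EntryBounds k e → Safe (extend o) (e , y , w , q , step k)
    safe-extend {k} {e} y k<m b =
      safe-case (weight ∘ pair (lastSide ∘ fst) (pair (fst ∘ snd) (snd ∘ snd ∘ snd ∘ snd)))
        (inl unit) checked {x}
        (_ , safe-weight (run lastSide e) y (step k) (bounded k<m)) (λ _ → tt)
        λ {u} r → let u≤ = weight-bounded (run lastSide e) y (step k) (bounded k<m) r in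
          safe-case (op leq (objective o ∘ fst) (fst ∘ snd ∘ snd ∘ snd))
            (inr (advance o ∘ snd)) (inl unit) {u , x}
            (((_ , safe-objective o u) , _) , ≤-trans (value≤ o u≤) X≤num , w≤num)
            -- The test against `w` has succeeded, which keeps the rounded weight below or at `q`.
            (λ t → _ , safe-advance {k} {u} {e} {y} k<m b u≤ (leq-true⁻ t)) (λ _ → tt)
      where
      x : ⟦ `Move ⟧
      x = e , y , w , q , step k
      checked : Fn ((`ℕ `× `ℕ) `× `Move) (`Maybe `Entry)
      checked = case (op leq (objective o ∘ fst) (fst ∘ snd ∘ snd ∘ snd))
        (inr (advance o ∘ snd)) (inl unit)

    entries-length : ∀ k → length (entries k) ≤ suc L + suc L
    entries-length zero    = s≤s z≤n
    entries-length (suc k) =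
      subst (λ l → length (entries (suc k)) ≤ l + l) (length-downFrom (suc L))
        (Layer.layer-length o (step k) (entries k) w q (downFrom (suc L)) (sts , s))

    safe-candidates : ∀ {k} (y : ∀ {γ} → Fn γ `Bool) (safe-y : ∀ {γ} {x : ⟦ γ ⟧} → Safe (y {γ}) x) →
      k < m → Safe (candidates o y) (step k , entries k , context)
    safe-candidates {k} y safe-y k<m =
      safe-gather (extend o ∘ moveTo y) (fst ∘ snd) nil {step k , entries k , context} _ _
        (≤-trans (entries-length k) entries≤len)
        (λ {e} e∈ → (_ , safe-y {`Entry `× `Layer} {e , step k , entries k , context} , _) ,
          safe-extend (run (y {`Entry `× `Layer}) (e , step k , entries k , context))
            k<m (entry-bounds (<⇒≤ k<m) e∈))

    safe-trim : ∀ cs acc → length cs ≤ len →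
                (∀ {e} → e ∈ cs → run scaled e ≤ num × load o (run totals e) ≤ num) →
                Safe (trim o) (cs , downFrom (suc L) , acc)
    safe-trim cs acc cs≤ b =
      safe-gather trimPick (fst ∘ snd) (snd ∘ snd) {cs , downFrom (suc L) , acc} _ _
        (≤-trans (≤-reflexive (length-downFrom (suc L))) (≤-trans (m≤m+n (suc L) (suc L)) entries≤len))
        (λ {v} v∈ → safe-pick (eq (scaled ∘ fst) (fst ∘ snd)) (resource o ∘ totals) (fst ∘ snd)
           {v , cs , downFrom (suc L) , acc} _ cs≤
           (λ {e} e∈ → safe-eq (scaled ∘ fst) (fst ∘ snd) {e , v , cs , downFrom (suc L) , acc} _ _
                          (proj₁ (b e∈)) (≤-trans (s≤s⁻¹ (∈-downFrom⁻ v∈)) L≤num) ,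
                       (_ , safe-resource o _) , proj₂ (b e∈)))
      where
      trimPick : Fn (`ℕ `× `List `Entry `× `List `ℕ `× `List `Entry) (`Maybe `Entry)
      trimPick = pick (eq (scaled ∘ fst) (fst ∘ snd)) (resource o ∘ totals) (fst ∘ snd)

    module _ {k} (k<m : k < m) where

      private
        candidate-bounds : ∀ b {f} → (∃[ e ] e ∈ entries k × run (extend o) (e , b , w , q , step k) ≡ inj₂ f) →
              run scaled f ≤ num × load o (run totals f) ≤ num
        candidate-bounds b (e , e∈ , r)
          with σ , z , p ← sound k e∈
          with extends {u} a v≤w ← extend⁻ o e b w q (step k) r =
          ≤-trans (+-mono-≤ scaled≤ (scaling-bounded q v≤w))
            (≤-trans (≤-reflexive (+-comm (k * q) q)) (kq≤num k<m)) ,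
          ≤-trans (load≤ o
            ( +-mono-≤ (proj₁ totals≤) (proj₁ u≤)
            , +-mono-≤ (proj₂ totals≤) (proj₂ u≤)))
            (≤-trans (≤-reflexive (+-comm (k * X) X)) (kX≤num k<m))
          where
          open EntryBounds (entry-bounds (<⇒≤ k<m) e∈)
          u≤ = weight-bounded (run lastSide e) b (step k) (bounded k<m) a

      safe-layer : Safe (layer o) (step k , entries k , context)
      safe-layer =
        (safe-candidates onServer tt k<m , _ ,
          ((safe-candidates onCloud tt k<m , _) , safe-trim toCloud [] cloud≤ (λ f∈ →
            candidate-bounds (inj₂ tt) (candidates-∈⁻ o onCloud (inj₂ tt) refl (step k) (entries k)
              w q (downFrom (suc L) , sts , s) f∈)))) ,
        safe-trim toServer fromCloud server≤ (λ f∈ →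
          candidate-bounds (inj₁ tt) (candidates-∈⁻ o onServer (inj₁ tt) refl (step k) (entries k)
            w q (downFrom (suc L) , sts , s) f∈))
        where
        open Layer o (step k) (entries k) w q (downFrom (suc L)) (sts , s)
        cloud≤ : length toCloud ≤ len
        cloud≤ = ≤-trans (candidates-length o onCloud (inj₂ tt) refl (step k) (entries k)
            w q (downFrom (suc L) , sts , s))
          (≤-trans (entries-length k) entries≤len)
        server≤ : length toServer ≤ len
        server≤ = ≤-trans (candidates-length o onServer (inj₁ tt) refl (step k) (entries k)
            w q (downFrom (suc L) , sts , s))
          (≤-trans (entries-length k) entries≤len)

    safe-search : Safe (search o) context
    safe-search = _ , sts≤len , go m ≤-refl
      where
      go : ∀ k → k ≤ m → Along (λ st es → Safe (layer o) (st , es , context))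
             (λ es st → run (layer o) (st , es , context)) (entries 0) (reverse (revSteps k))
      go zero    _   = tt
      -- Reversal puts the latest step at the end of the list, so the prefixes of the fold are the
      -- reversed lists for smaller `k`.
      go (suc k) k<m = subst (Along _ _ (entries 0)) (sym (unfold-reverse (step k) (revSteps k)))
        (along-∷ʳ (reverse (revSteps k)) (go k (<⇒≤ k<m))
          (subst (λ es → Safe (layer o) (step k , es , context)) (sym (foldl-entries w k))
            (safe-layer k<m)))

  step-of : ∀ {st} → st ∈ sts → ∃[ i ] i < m × st ≡ step i
  step-of st∈ = revSteps-∈⁻ m (Any.reverse⁻ st∈)

  safe-guess : ∀ (x y : ∀ {γ} → Fn γ `Bool) {st} → Safe x (st , sts) → Safe y (st , sts) →
               st ∈ sts → Safe (guess o x y) (st , sts)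
  safe-guess x y {st} safe-x safe-y st∈ with i , i<m , refl ← step-of st∈ =
    safe-case (weight ∘ pair x (pair y fst)) (inl unit) (inr (objective o ∘ fst))
      {step i , sts}
      ((safe-x , safe-y , _) ,
        safe-weight (run x (step i , sts)) (run y (step i , sts)) (step i) (bounded i<m))
      (λ _ → tt) (λ {u} _ → _ , safe-objective o u)

  safe-guesses : Safe (guesses o) sts
  safe-guesses =
    safe-gather (guess o onServer onServer) id (gather (guess o onServer onCloud) id
      (gather (guess o onCloud onServer) id (gather (guess o onCloud onCloud) id (cons (lit 0) nil))))
      {sts} _
    (safe-gather (guess o onServer onCloud) id
      (gather (guess o onCloud onServer) id (gather (guess o onCloud onCloud) id (cons (lit 0) nil)))
      {sts} _
    (safe-gather (guess o onCloud onServer) id (gather (guess o onCloud onCloud) id (cons (lit 0) nil))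
      {sts} _
    (safe-gather (guess o onCloud onCloud) id (cons (lit 0) nil) {sts} _ _ sts≤len
      (safe-guess onCloud onCloud _ _))
      sts≤len (safe-guess onCloud onServer _ _))
      sts≤len (safe-guess onServer onCloud _ _))
      sts≤len (safe-guess onServer onServer _ _)

  guesses≤num : ∀ {w} → w ∈ run (guesses o) sts → w ≤ num
  guesses≤num w∈ with guesses-∈⁻ o sts w∈
  ... | inj₁ refl = z≤n
  ... | inj₂ (x , y , st , u , st∈ , r , refl) with i , i<m , refl ← step-of st∈ =
    ≤-trans (value≤ o (weight-bounded x y (step i) (bounded i<m) r)) X≤num

  guesses-length≤ : length (run (guesses o) sts) ≤ len
  guesses-length≤ = ≤-trans (guesses-length o sts)
    (≤-trans (+-mono-≤ (+-mono-≤ (+-mono-≤ (s≤s sts≤n) sts≤n) sts≤n) sts≤n) guesses≤len)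

  safe-champion : ∀ {w} → w ∈ run (guesses o) sts → Safe (champion o) (w , fin)
  safe-champion {w} w∈ =
    safe-pick (good o) (objective o ∘ totals) (search o ∘ pair fst (fst ∘ snd ∘ snd)) {w , fin}
      (_ , safe-search w w≤) (≤-trans (≤-reflexive (cong length (search≡ w)))
        (≤-trans (entries-length w w≤ m) entries≤len))
      (λ {e} e∈ →
        let open EntryBounds (entry-bounds w w≤ ≤-refl (subst (e ∈_) (search≡ w) e∈)) in
        safe-case (lastSide ∘ fst)
          (op leq (resource o ∘ totals ∘ fst) (snd ∘ snd ∘ snd ∘ snd) ∘ snd) (inr unit)
          {e , w , fin} _
          (λ _ → _ , ((_ , safe-resource o (run totals e)) , _) ,
            ≤-trans (load≤ o totals≤) (kX≤num w w≤ ≤-refl) , bound≤num)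
          (λ _ → _) ,
        (_ , safe-objective o (run totals e)) ,
        ≤-trans (value≤ o totals≤) (kX≤num w w≤ ≤-refl))
    where w≤ = guesses≤num w∈

  safe-optimum : Safe (optimum o) fin
  safe-optimum =
    safe-pick (inl unit) (objective o ∘ totals) (gather (champion o) fst nil) {fin}
      (safe-gather (champion o) fst nil {fin} _ _ guesses-length≤ safe-champion)
      (≤-trans (collect-length {g = championOf} (run (guesses o) sts)) guesses-length≤)
      λ {e} e∈ → let σ , sol = solves e∈ in
        _ , (_ , safe-objective o (run totals e)) ,
        ≤-trans (≤-reflexive (Solves.value≡ sol))
          (≤-trans (value≤ o (total-bounded σ m ≤-refl (Admissible.arcs (Solves.feasible sol))))
            (≤-trans (*-monoˡ-≤ X m≤n) nX≤num))

-- Chains and schedules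

prefixSum : (ℕ → ℕ) → ℕ → ℕ
prefixSum f zero    = 0
prefixSum f (suc n) = prefixSum f n + f n

prefixSum-suc : ∀ f n → prefixSum f (suc n) ≡ f 0 + prefixSum (λ i → f (suc i)) n
prefixSum-suc f zero    = sym (+-identityʳ (f 0))
prefixSum-suc f (suc n) =
  trans (cong (_+ f (suc n)) (prefixSum-suc f n)) (+-assoc (f 0) _ (f (suc n)))

sum-toℕ : ∀ n f → sum {n} (λ i → f (toℕ i)) ≡ prefixSum f n
sum-toℕ zero    f = refl
sum-toℕ (suc n) f =
  trans (cong (f 0 +_) (sum-toℕ n (λ i → f (suc i)))) (sym (prefixSum-suc f n))

foldr-zipWith-just : ∀ {n} (v : Fin n → Maybe ℕ) x → (∀ j → v j ≡ just (x j)) →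
                     Vector.foldr (Maybe.zipWith _+_) (just 0) v ≡ just (sum x)
foldr-zipWith-just {zero}  v x e = refl
foldr-zipWith-just {suc n} v x e =
  cong₂ (Maybe.zipWith _+_) (e Fin.zero)
    (foldr-zipWith-just (λ j → v (Fin.suc j)) (λ j → x (Fin.suc j)) (λ j → e (Fin.suc j)))

decodeSide : ⟦ `Bool ⟧ → Side
decodeSide (inj₁ _) = server
decodeSide (inj₂ _) = cloud

encode-decode : ∀ b → encodeSide (decodeSide b) ≡ b
encode-decode (inj₁ tt) = refl
encode-decode (inj₂ tt) = refl

_≟ˢ_ : ∀ (a b : Side) → Dec (a ≡ b)
server ≟ˢ server = yes refl
server ≟ˢ cloud  = no λ ()
cloud  ≟ˢ server = no λ ()
cloud  ≟ˢ cloud  = yes refl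

communication : Side → Side → ℕ → ℕ
communication server server c = 0
communication server cloud  c = c
communication cloud  server c = c
communication cloud  cloud  c = 0

onCloudOnly : Side → ℕ → ℕ
onCloudOnly server p = 0
onCloudOnly cloud  p = p

communication-≢ : ∀ {a b} c → a ≢ b → communication a b c ≡ c
communication-≢ {server} {server} c a≢b = ⊥-elim (a≢b refl)
communication-≢ {server} {cloud}  c a≢b = refl
communication-≢ {cloud}  {server} c a≢b = refl
communication-≢ {cloud}  {cloud}  c a≢b = ⊥-elim (a≢b refl)

communication-≡ : ∀ {a b} c → a ≡ b → communication a b c ≡ 0
communication-≡ {server} c refl = refl
communication-≡ {cloud}  c refl = refl

module _ (G : TaskGraph) where
  open TaskGraph G

  processing : Side → Job → ℕ ⁺
  processing server j = finite (pˢ j)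
  processing cloud  j = pᶜ j

  stepTo : Job → ℕ → ⟦ `Step ⟧
  stepTo j c = toℕ j , c , pˢ j , encodeMaybe (pᶜ j)

  weight⁺ : ∀ a b {j c p} → processing b j ≡ just p →
            run weight (encodeSide a , encodeSide b , stepTo j c) ≡
            inj₂ (communication a b c + p , onCloudOnly b p)
  weight⁺ server server refl = refl
  weight⁺ cloud  server refl = refl
  weight⁺ server cloud  e rewrite e = refl
  weight⁺ cloud  cloud  e rewrite e = refl

  weight⁻ : ∀ a b {j c u} → run weight (encodeSide a , encodeSide b , stepTo j c) ≡ inj₂ u →
            ∃[ p ] processing b j ≡ just p × u ≡ (communication a b c + p , onCloudOnly b p)
  weight⁻ server server     refl = _ , refl , refl
  weight⁻ cloud  server     refl = _ , refl , refl
  weight⁻ server cloud  {j} r with pᶜ j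
  weight⁻ server cloud      refl | just p = p , refl , refl
  weight⁻ cloud  cloud  {j} r with pᶜ j
  weight⁻ cloud  cloud      refl | just p = p , refl , refl

  module _ (S : Schedule G) where
    open Schedule S

    p≡processing : ∀ j → p j ≡ processing (side j) j
    p≡processing j with side j
    ... | server = refl
    ... | cloud  = refl

    startsFrom⁺ : ∀ {x j q} → processing (side j) j ≡ just q → x + q ≤ C j → StartsFrom x j
    startsFrom⁺ {x} {j} {q} e le rewrite trans (p≡processing j) e = [ le ]

    -- Subtracting an infinite time would leave nothing to start from, so any such inequality forces
    -- the processing time to be finite.
    startsFrom⁻ : ∀ {x j} → StartsFrom x j → ∃[ q ] processing (side j) j ≡ just q × x + q ≤ C j
    startsFrom⁻ {x} {j} le with p j | p≡processing j
    startsFrom⁻ [ le ] | just q | e = q , sym e , le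

    cloudTime≡ : ∀ {j q} → processing (side j) j ≡ just q →
                 cloudTime j ≡ just (onCloudOnly (side j) q)
    cloudTime≡ {j} e with side j
    ... | server = refl
    ... | cloud  = e

module ChainGraph (G : TaskGraph) (chain : IsChain G) where
  open TaskGraph G

  π = proj₁ chain

  position : Job → ℕ
  position j = toℕ (π ⟨$⟩ʳ j)

  -- Indices from n on get the junk value s.
  at : ℕ → Job
  at k with k <? n
  ... | yes k<n = π ⟨$⟩ˡ fromℕ< k<n
  ... | no  _   = s

  position-at : ∀ {k} → k < n → position (at k) ≡ k
  position-at {k} k<n with k <? n
  ... | yes k<n′ = trans (cong toℕ (inverseʳ π)) (toℕ-fromℕ< k<n′)
  ... | no  k≮n  = ⊥-elim (k≮n k<n)

  position<n : ∀ j → position j < n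
  position<n j = toℕ<n (π ⟨$⟩ʳ j)

  position-injective : ∀ {i j} → position i ≡ position j → i ≡ j
  position-injective e =
    trans (sym (inverseˡ π)) (trans (cong (π ⟨$⟩ˡ_) (toℕ-injective e)) (inverseˡ π))

  at-position : ∀ j → at (position j) ≡ j
  at-position j = position-injective (position-at (position<n j))

  edge⁺ : ∀ {i j} → position j ≡ suc (position i) → Edge i j
  edge⁺ {i} {j} = Equivalence.from (proj₂ chain i j)

  edge⁻ : ∀ {i j} → Edge i j → position j ≡ suc (position i)
  edge⁻ {i} {j} = Equivalence.to (proj₂ chain i j)

  edge-at : ∀ {k} → suc k < n → Edge (at k) (at (suc k))
  edge-at {k} 1+k<n = edge⁺ (trans (position-at 1+k<n)
    (cong suc (sym (position-at (≤-trans (n≤1+n (suc k)) 1+k<n)))))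

  -- A job at a positive position has a predecessor on the path, but the source has none.
  position-s : position s ≡ 0
  position-s with position s in e
  ... | zero  = refl
  ... | suc k = ⊥-elim (source (at k) (edge⁺ (trans e
    (cong suc (sym (position-at (≤-trans (n≤1+n (suc k)) (subst (_< n) e (position<n s)))))))))

  m : ℕ
  m = position t

  -- If positions went on after the sink, it would have a successor.
  n≡1+m : n ≡ suc m
  n≡1+m with m<1+n⇒m<n∨m≡n (s≤s (position<n t))
  ... | inj₂ e  = sym e
  ... | inj₁ lt = ⊥-elim (sink (at (suc m)) (edge⁺ (position-at lt)))

  m<n : m < n
  m<n = position<n t

  at-0 : at 0 ≡ s
  at-0 = trans (cong at (sym position-s)) (at-position s)

  at-m : at m ≡ t
  at-m = at-position t

  -- The default 0 is junk: below `m` the delay is present.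
  delayAt : ℕ → ℕ
  delayAt k = fromMaybe 0 (delay (at k) (at (suc k)))

  step : ℕ → ⟦ `Step ⟧
  step k = stepTo G (at (suc k)) (delayAt k)

  open Chain (toℕ s) step public

  delay-at : ∀ {k} → k < m → delay (at k) (at (suc k)) ≡ just (delayAt k)
  delay-at {k} k<m with c , e ← edge-at (subst (suc k <_) (sym n≡1+m) (s≤s k<m)) =
    trans e (cong (λ d → just (fromMaybe 0 d)) (sym e))

  -- An edge determines its position and its delay, so matching on the view turns its ends into
  -- consecutive jobs of the path.
  record EdgeView (i j : Job) (c : ℕ) : Set where
    constructor edgeView
    field
      k    : ℕ
      k<m  : k < m
      i≡   : i ≡ at k
      j≡   : j ≡ at (suc k)
      c≡   : c ≡ delayAt k

  edge-view : ∀ {i j c} → delay i j ≡ just c → EdgeView i j c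
  edge-view {i} {j} {c} e = edgeView (position i) i<m
    (sym (at-position i)) (sym j≡)
    (cong (fromMaybe 0) (trans (sym e) (cong₂ delay (sym (at-position i)) (sym j≡))))
    where
    pos≡ = edge⁻ (c , e)
    j≡ : at (suc (position i)) ≡ j
    j≡ = trans (cong at (sym pos≡)) (at-position j)
    i<m : position i < m
    i<m = s≤s⁻¹ (subst (_≤ suc m) (cong suc pos≡) (subst (position j <_) n≡1+m (position<n j)))

  -- Common ground of both translations: only the sides of `S` are tied to `σ`, its completion times
  -- are free.
  module Follows (S : Schedule G) (σ : Assignment)
    (agree : ∀ {k} → k ≤ m → σ k ≡ encodeSide (Schedule.side S (at k)))
    (starts : σ 0 ≡ inj₁ tt) (ends : σ m ≡ inj₁ tt)
    (arcs : ∀ {i} → i < m → ∃[ u ] arc σ i ≡ inj₂ u) where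
    open Schedule S

    record ArcView (k : ℕ) : Set where
      field
        duration    : ℕ
        processing≡ : processing G (side (at (suc k))) (at (suc k)) ≡ just duration
        total≡      : total σ (suc k) ≡ total σ k ⊞
          (communication (side (at k)) (side (at (suc k))) (delayAt k) + duration ,
           onCloudOnly (side (at (suc k))) duration)

    arcView : ∀ {k} → k < m → ArcView k
    arcView {k} k<m
      with u , r ← arcs k<m
      with q , e , u≡ ← weight⁻ G (side (at k)) (side (at (suc k)))
             (trans (cong₂ (λ a b → run weight (a , b , step k))
                      (sym (agree (<⇒≤ k<m))) (sym (agree k<m))) r) = record
      { duration    = q
      ; processing≡ = e
      ; total≡      = cong (total σ k ⊞_) (trans (cong [ (λ _ → 0 , 0) , (λ u → u) ]′ r) u≡)
      }

    server-s : side s ≡ server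
    server-s = decode (trans (sym (agree z≤n)) starts)
      where
      decode : encodeSide (side (at 0)) ≡ inj₁ tt → side s ≡ server
      decode e rewrite at-0 with side s
      ... | server = refl

    cloudCost : ℕ → ℕ
    cloudCost zero    = 0
    cloudCost (suc k) = proj₂ ([ (λ _ → 0 , 0) , (λ u → u) ]′ (arc σ k))

    cloudTime-at : ∀ {k} → k ≤ m → cloudTime (at k) ≡ just (cloudCost k)
    cloudTime-at {zero}  _
      rewrite at-0 with side s | server-s
    ... | server | refl = refl
    cloudTime-at {suc k} k<m = trans (cloudTime≡ G S (V.processing≡))
      (cong just (+-cancelˡ-≡ (proj₂ (total σ k)) _ _ (sym (cong proj₂ V.total≡))))
      where module V = ArcView (arcView k<m)

    total-cost : ∀ k → proj₂ (total σ k) ≡ prefixSum cloudCost (suc k)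
    total-cost zero    = refl
    total-cost (suc k) = cong (_+ cloudCost (suc k)) (total-cost k)

    position≤m : ∀ j → position j ≤ m
    position≤m j = s≤s⁻¹ (subst (position j <_) n≡1+m (position<n j))

    cost≡ : cost ≡ just (proj₂ (total σ m))
    cost≡ = trans
      (foldr-zipWith-just cloudTime (λ j → cloudCost (position j))
        (λ j → subst (λ i → cloudTime i ≡ just (cloudCost (position j))) (at-position j)
                 (cloudTime-at (position≤m j))))
      -- The cost is a sum in input order and the total a sum along the path; the permutation of the
      -- chain reindexes one into the other.
      (cong just (trans (sym (sum-permute (λ i → cloudCost (toℕ i)) π))
        (trans (sum-toℕ n cloudCost)
          (trans (cong (prefixSum cloudCost) n≡1+m) (sym (total-cost m))))))

  module FromSchedule (S : Schedule G) (valid : Schedule.Valid S) where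
    open Schedule S
    open Valid valid

    assignment : Assignment
    assignment k = encodeSide (side (at k))

    processing-finite : ∀ j → ∃[ q ] processing G (side j) j ≡ just q
    processing-finite j with q , e , _ ← startsFrom⁻ G S (start j) = q , e

    -- Validity makes every job start at a natural number, which an infinite processing time would
    -- prevent.
    uncloudable : ∀ {j} → pᶜ j ≡ ⊤⁺ → encodeSide (side j) ≡ inj₁ tt
    uncloudable {j} e with side j | processing-finite j
    ... | server | _      = refl
    ... | cloud  | _ , e′ with () ← trans (sym e) e′

    assignment-starts : assignment 0 ≡ inj₁ tt
    assignment-starts rewrite at-0 = uncloudable pᶜ-s

    assignment-ends : assignment m ≡ inj₁ tt
    assignment-ends rewrite at-m = uncloudable pᶜ-t

    assignment-arcs : ∀ {i} → i < m → ∃[ u ] arc assignment i ≡ inj₂ u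
    assignment-arcs {i} _ = _ ,
      weight⁺ G (side (at i)) (side (at (suc i))) (proj₂ (processing-finite (at (suc i))))

    open Follows S assignment (λ _ → refl) assignment-starts assignment-ends assignment-arcs

    edge-start : ∀ {i j c} → delay i j ≡ just c →
                 StartsFrom (C i + communication (side i) (side j) c) j
    edge-start {i} {j} {c} e with side i ≟ˢ side j
    ... | yes a≡b = subst (λ x → StartsFrom x j)
      (sym (trans (cong (C i +_) (communication-≡ c a≡b)) (+-identityʳ (C i))))
      (sameSide i j (c , e) a≡b)
    ... | no a≢b  = subst (λ x → StartsFrom (C i + x) j)
      (sym (communication-≢ c a≢b)) (crossSide i j c e a≢b)

    -- Starting each job as early as possible is optimal for given sides: along the path, each edge
    -- forces at least the weight of its arc between two completion times.
    time≤C : ∀ {k} → k ≤ m → proj₁ (total assignment k) ≤ C (at k)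
    time≤C {zero}  _   = z≤n
    time≤C {suc k} k<m
      with q , e , le ← startsFrom⁻ G S (edge-start (delay-at k<m)) = begin
      proj₁ (total assignment (suc k))
        ≡⟨ cong proj₁ V.total≡ ⟩
      proj₁ (total assignment k) + (communication (side (at k)) (side (at (suc k))) (delayAt k) + V.duration)
        ≤⟨ +-monoˡ-≤ _ (time≤C (<⇒≤ k<m)) ⟩
      C (at k) + (communication (side (at k)) (side (at (suc k))) (delayAt k) + V.duration)
        ≡⟨ +-assoc (C (at k)) _ V.duration ⟨
      C (at k) + communication (side (at k)) (side (at (suc k))) (delayAt k) + V.duration
        ≡⟨ cong (_ +_) (just-injective (trans (sym V.processing≡) e)) ⟩
      C (at k) + communication (side (at k)) (side (at (suc k))) (delayAt k) + q
        ≤⟨ le ⟩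
      C (at (suc k)) ∎
      where
      open ≤-Reasoning
      module V = ArcView (arcView k<m)

    time≤makespan : proj₁ (total assignment m) ≤ makespan
    time≤makespan = subst (λ j → proj₁ (total assignment m) ≤ C j) at-m (time≤C ≤-refl)

    cost≡total : cost ≡ just (proj₂ (total assignment m))
    cost≡total = cost≡

  module ToSchedule (σ : Assignment) (starts : σ 0 ≡ inj₁ tt) (ends : σ m ≡ inj₁ tt)
    (arcs : ∀ {i} → i < m → ∃[ u ] arc σ i ≡ inj₂ u) where

    schedule : Schedule G
    schedule = record
      { side = λ j → decodeSide (σ (position j))
      ; C    = λ j → proj₁ (total σ (position j))
      }

    open Schedule schedule

    side-at : ∀ {k} → k ≤ m → σ k ≡ encodeSide (side (at k))
    side-at {k} k≤m = trans (cong σ (sym (position-at (subst (k <_) (sym n≡1+m) (s≤s k≤m)))))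
                            (sym (encode-decode _))

    open Follows schedule σ side-at starts ends arcs

    C-at : ∀ {k} → k ≤ m → C (at k) ≡ proj₁ (total σ k)
    C-at {k} k≤m = cong (λ i → proj₁ (total σ i))
      (position-at (subst (k <_) (sym n≡1+m) (s≤s k≤m)))

    edge-start : ∀ {i j c} → delay i j ≡ just c →
                 StartsFrom (C i + communication (side i) (side j) c) j
    edge-start e with edgeView k k<m refl refl refl ← edge-view e =
      startsFrom⁺ G schedule V.processing≡ (≤-reflexive (begin
        C (at k) + communication (side (at k)) (side (at (suc k))) (delayAt k) + V.duration
          ≡⟨ +-assoc (C (at k)) _ V.duration ⟩
        C (at k) + (communication (side (at k)) (side (at (suc k))) (delayAt k) + V.duration)
          ≡⟨ cong (_+ (communication (side (at k)) (side (at (suc k))) (delayAt k) + V.duration))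
               (C-at (<⇒≤ k<m)) ⟩
        proj₁ (total σ k) + (communication (side (at k)) (side (at (suc k))) (delayAt k) + V.duration)
          ≡⟨ cong proj₁ V.total≡ ⟨
        proj₁ (total σ (suc k))
          ≡⟨ C-at k<m ⟨
        C (at (suc k)) ∎))
      where
      open ≡-Reasoning
      module V = ArcView (arcView k<m)

    startsFrom-mono : ∀ {x y j} → x ≤ y → StartsFrom y j → StartsFrom x j
    startsFrom-mono x≤y from with q , e , le ← startsFrom⁻ G schedule from =
      startsFrom⁺ G schedule e (≤-trans (+-monoˡ-≤ q x≤y) le)

    total-mono : ∀ {i k} → i ≤ k → proj₁ (total σ i) ≤ proj₁ (total σ k)
    total-mono {k = zero}  z≤n = z≤n
    total-mono {i} {suc k} i≤1+k with m≤n⇒m<n∨m≡n i≤1+k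
    ... | inj₁ i<1+k = ≤-trans (total-mono (s≤s⁻¹ i<1+k)) (m≤m+n _ _)
    ... | inj₂ refl  = ≤-refl

    -- Totals increase along the path, so the immediate predecessor of `j` completes no earlier than
    -- `i`; the edge into `j` does the rest.
    precedes : ∀ i j → position i < position j → StartsFrom (C i) j
    precedes i j i<j = go (position j) refl
      where
      go : ∀ k → position j ≡ k → StartsFrom (C i) j
      go zero    e with () ← subst (position i <_) e i<j
      go (suc k) e = startsFrom-mono
        (≤-trans (total-mono (subst (position i ≤_) (sym (position-at k<n)) i≤k)) (m≤m+n _ _))
        (edge-start {at k} (proj₂ (edge⁺ (trans e (cong suc (sym (position-at k<n)))))))
        where
        i≤k : position i ≤ k
        i≤k = s≤s⁻¹ (subst (position i <_) e i<j)
        k<n : k < n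
        k<n = ≤-trans (n≤1+n (suc k)) (subst (_< n) e (position<n j))

    C-s : C s ≡ 0
    C-s rewrite position-s = refl

    valid : Valid
    valid = record
      { start     = start
      ; exclusive = exclusive
      ; sameSide  = λ { i j (c , e) _ → startsFrom-mono (m≤m+n _ _) (edge-start e) }
      ; crossSide = λ i j c e a≢b → subst (λ x → StartsFrom (C i + x) j)
                      (communication-≢ c a≢b) (edge-start e)
      }
      where
      start : ∀ j → StartsFrom 0 j
      start j = go (position j) refl
        where
        go : ∀ k → position j ≡ k → StartsFrom 0 j
        go (suc k) e = startsFrom-mono z≤n
          (precedes s j (subst₂ _<_ (sym position-s) (sym e) (s≤s z≤n)))
        -- The source has no edge into it. It starts at 0 since it runs on the server in time 0 and
        -- completes at 0.
        go zero e with refl ← position-injective (trans e (sym position-s)) =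
          startsFrom⁺ G schedule (cong (λ a → processing G a s) server-s)
            (≤-reflexive (trans pˢ-s (sym C-s)))

      exclusive : ∀ i j → i ≢ j → side i ≡ server → side j ≡ server →
                  StartsFrom (C i) j ⊎ StartsFrom (C j) i
      -- Positions are totally ordered, so one of the two jobs starts after the other completes,
      -- whatever their sides.
      exclusive i j i≢j _ _ with <-cmp (position i) (position j)
      ... | tri< i<j _ _ = inj₁ (precedes i j i<j)
      ... | tri≈ _ i≡j _ = ⊥-elim (i≢j (position-injective i≡j))
      ... | tri> _ _ j<i = inj₂ (precedes j i j<i)

    cost≡total : cost ≡ just (proj₂ (total σ m))
    cost≡total = cost≡

    -- Together with `path-∈⁻` this makes the path the graph of the schedule, so that looking up a
    -- job in it has exactly one answer.
    path-∈ : ∀ {k} → k ≤ m → (toℕ (at k) , encodeSide (side (at k)) , C (at k)) ∈ pathOf σ m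
    path-∈ {k} k≤m rewrite sym (side-at k≤m) | C-at k≤m = go m k≤m
      where
      go : ∀ l → k ≤ l → (toℕ (at k) , σ k , proj₁ (total σ k)) ∈ pathOf σ l
      go zero    z≤n rewrite at-0 | starts = here refl
      go (suc l) k≤1+l with m≤n⇒m<n∨m≡n k≤1+l
      ... | inj₁ k<1+l = there (go l (s≤s⁻¹ k<1+l))
      ... | inj₂ refl  = here refl

    private
      pathOf-∈⁻ : ∀ l → l ≤ m → ∀ {z} → z ∈ pathOf σ l →
                  ∃[ k ] k ≤ m × z ≡ (toℕ (at k) , σ k , proj₁ (total σ k))
      pathOf-∈⁻ zero    _   (here refl) =
        0 , z≤n , cong₂ (λ j b → toℕ j , b , 0) (sym at-0) (sym starts)
      pathOf-∈⁻ (suc l) l<m (here refl) = suc l , l<m , refl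
      pathOf-∈⁻ (suc l) l<m (there z∈)  = pathOf-∈⁻ l (<⇒≤ l<m) z∈

    path-∈⁻ : ∀ {z} → z ∈ pathOf σ m → ∃[ j ] z ≡ (toℕ j , encodeSide (side j) , C j)
    path-∈⁻ z∈ with k , k≤m , refl ← pathOf-∈⁻ m ≤-refl z∈ =
      at k , cong₂ (λ b c → toℕ (at k) , b , c) (side-at k≤m) (sym (C-at k≤m))

-- Reading the chain

-- The computation rule of `case` for a scrutinee whose value is known only by an equation.
case-inj₁ : ∀ (e : Fn γ (ρ `⊎ σ)) (f : Fn (ρ `× γ) τ) g {x y} →
            run e x ≡ inj₁ y → run (case e f g) x ≡ run f (y , x)
case-inj₁ e f g {x} r = cong [ (λ y → run f (y , x)) , (λ y → run g (y , x)) ]′ r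

case-inj₂ : ∀ (e : Fn γ (ρ `⊎ σ)) (f : Fn (ρ `× γ) τ) g {x y} →
            run e x ≡ inj₂ y → run (case e f g) x ≡ run g (y , x)
case-inj₂ e f g {x} r = cong [ (λ y → run f (y , x)) , (λ y → run g (y , x)) ]′ r

pick-unique : ∀ (p : Fn (σ `× γ) `Bool) v xs {x y} → y ∈ run xs x → True (run p (y , x)) →
              (∀ {z} → z ∈ run xs x → True (run p (z , x)) → z ≡ y) →
              run (pick p v xs) x ≡ inj₂ y
pick-unique p v xs {x} y∈ Py unique with run (pick p v xs) x | picked p v xs {x}
... | _ | none ¬P       = ⊥-elim (¬P y∈ Py)
... | _ | some z∈ Pz _  = cong inj₂ (unique z∈ Pz)

pick-none : ∀ (p : Fn (σ `× γ) `Bool) v xs {x} →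
            (∀ {z} → z ∈ run xs x → ¬ True (run p (z , x))) → run (pick p v xs) x ≡ inj₁ tt
pick-none p v xs {x} ¬P with run (pick p v xs) x | picked p v xs {x}
... | _ | none _       = refl
... | _ | some z∈ Pz _ = ⊥-elim (¬P z∈ Pz)

byKey-unique : ∀ (k : Fn γ `ℕ) (xs : Fn γ (`List (`ℕ `× σ))) {x v} → (run k x , v) ∈ run xs x →
               (∀ {z} → z ∈ run xs x → proj₁ z ≡ run k x → z ≡ (run k x , v)) →
               run (byKey k xs) x ≡ inj₂ (run k x , v)
byKey-unique {γ} {σ} k xs {x} {v} ∈xs unique =
  pick-unique (eq (fst ∘ fst) (k ∘ snd)) (lit 0) xs ∈xs
    (eq-true⁺ (fst ∘ fst) (k ∘ snd) {(run k x , v) , x} refl)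
    (λ {z} z∈ t → unique z∈ (eq-true⁻ {(`ℕ `× σ) `× γ} (fst ∘ fst) (k ∘ snd) {z , x} t))

byKey-number : ∀ (k : Fn γ `ℕ) (xs : Fn γ (`List (`ℕ `× σ))) {x n} (h : Fin n → ⟦ σ ⟧) {j} →
               run k x ≡ toℕ j → run xs x ≡ reverse (tabulate (number h)) →
               run (byKey k xs) x ≡ inj₂ (toℕ j , h j)
byKey-number k xs {x} h {j} k≡ xs≡ =
  trans (byKey-unique k xs {v = h j}
          (subst₂ (λ i l → (i , h j) ∈ l) (sym k≡) (sym xs≡) (number-∈ h j))
          unique)
        (cong (λ i → inj₂ (i , h j)) k≡)
  where
  unique : ∀ {z} → z ∈ run xs x → proj₁ z ≡ run k x → z ≡ (run k x , h j)
  unique z∈ e with j′ , refl ← number-∈⁻ h (subst (_ ∈_) xs≡ z∈)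
    with refl ← toℕ-injective (trans e k≡) = cong (_, h j) e

module Walking (G : TaskGraph) (chain : IsChain G) where
  open TaskGraph G
  open ChainGraph G chain
  open Steps step

  jobOf : Job → ⟦ `Job ⟧
  jobOf j = pˢ j , encodeMaybe (pᶜ j)

  rowOf : Job → ⟦ `Row ⟧
  rowOf i = tabulate (λ j → encodeMaybe (delay i j))

  numberedJobs : List ⟦ `ℕ `× `Job ⟧
  numberedJobs = reverse (tabulate (number jobOf))

  lists : ⟦ `Lists ⟧
  lists = numberedJobs , reverse (tabulate (number rowOf))

  delaysFrom : Job → List ⟦ `ℕ `× `Maybe `ℕ ⟧
  delaysFrom i = reverse (tabulate (number (λ j → encodeMaybe (delay i j))))

  module _ (k : ℕ) where
    i = at k
    x₀ : ⟦ `ℕ `× `Lists ⟧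
    x₀ = toℕ i , lists
    x₁ : ⟦ (`ℕ `× `Row) `× `ℕ `× `Lists ⟧
    x₁ = (toℕ i , rowOf i) , x₀

    row-found : run (byKey fst (snd ∘ snd)) x₀ ≡ inj₂ (toℕ i , rowOf i)
    row-found = byKey-number fst (snd ∘ snd) {x = x₀} rowOf refl refl

    numbered-row : run (snd ∘ numbered (snd ∘ fst)) x₁ ≡ delaysFrom i
    numbered-row = cong proj₂ (run-numbered (snd ∘ fst) {x = x₁} (λ j → encodeMaybe (delay i j)) refl)

    isJust⁻ : ∀ {z} → z ∈ run (snd ∘ numbered (snd ∘ fst)) x₁ → True (run isJust (z , x₁)) →
              ∃[ j ] ∃[ c ] delay i j ≡ just c × z ≡ (toℕ j , inj₂ c)
    isJust⁻ {z} z∈ t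
      with j , refl ← number-∈⁻ (λ j → encodeMaybe (delay i j)) (subst (_ ∈_) numbered-row z∈)
      with just c ← delay i j in e = j , c , e , refl

    -- The row of a job before the sink contains exactly one delay: two successors would share a
    -- position. So the pick is determined although its ranking is constant.
    successor-at : k < m → run successor x₀ ≡ inj₂ (step k)
    successor-at k<m =
      trans (case-inj₂ (byKey fst (snd ∘ snd)) (inl unit) resolveRow {x₀} row-found)
      (trans (case-inj₂ (pick isJust (lit 0) (snd ∘ numbered (snd ∘ fst))) (inl unit) resolveDelay {x₁}
        (pick-unique isJust (lit 0) (snd ∘ numbered (snd ∘ fst)) {x₁} {toℕ j , inj₂ c} ∈row refl unique))
      (case-inj₂ (byKey (fst ∘ fst ∘ snd) (fst ∘ snd ∘ snd ∘ snd ∘ snd)) (inl unit)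
        (inr (pair (fst ∘ fst) (pair (fst ∘ snd) (snd ∘ fst)))) {x₂}
        (byKey-number (fst ∘ fst ∘ snd) (fst ∘ snd ∘ snd ∘ snd ∘ snd)
          {x = x₂} jobOf {j} refl refl)))
      where
      j = at (suc k)
      c = delayAt k
      x₂ : ⟦ `ℕ `× (`ℕ `× `Maybe `ℕ) `× (`ℕ `× `Row) `× `ℕ `× `Lists ⟧
      x₂ = c , (toℕ j , inj₂ c) , x₁
      ∈row : (toℕ j , inj₂ c) ∈ run (snd ∘ numbered (snd ∘ fst)) x₁
      ∈row = subst₂ (λ d l → (toℕ j , encodeMaybe d) ∈ l) (delay-at k<m) (sym numbered-row)
        (number-∈ (λ j → encodeMaybe (delay i j)) j)
      unique : ∀ {z} → z ∈ run (snd ∘ numbered (snd ∘ fst)) x₁ → True (run isJust (z , x₁)) →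
               z ≡ (toℕ j , inj₂ c)
      unique {z} z∈ t with j′ , c′ , e , refl ← isJust⁻ {z} z∈ t
        with refl ← position-injective {j′} {j} (trans (edge⁻ (c′ , e)) (sym (edge⁻ (c , delay-at k<m))))
        with refl ← trans (sym e) (delay-at k<m) = refl

    successor-end : k ≡ m → run successor x₀ ≡ inj₁ tt
    successor-end refl =
      trans (case-inj₂ (byKey fst (snd ∘ snd)) (inl unit) resolveRow {x₀} row-found)
      (case-inj₁ (pick isJust (lit 0) (snd ∘ numbered (snd ∘ fst))) (inl unit) resolveDelay {x₁}
        (pick-none isJust (lit 0) (snd ∘ numbered (snd ∘ fst)) {x₁} ¬edge))
      where
      ¬edge : ∀ {z} → z ∈ run (snd ∘ numbered (snd ∘ fst)) x₁ → ¬ True (run isJust (z , x₁))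
      ¬edge {z} z∈ t with j , c , e , _ ← isJust⁻ {z} z∈ t =
        sink j (c , trans (cong (λ i → delay i j) (sym at-m)) e)

  state : ℕ → ⟦ `ℕ `× `List `Step ⟧
  state k = toℕ (at k) , revSteps k

  walkBy : ⟦ `List `Job `× `ℕ `× `Lists ⟧ → ⟦ `ℕ `× `List `Step ⟧ → ⟦ `Job ⟧ →
           ⟦ `ℕ `× `List `Step ⟧
  walkBy x b y = run walkStep (y , b , x)

  module _ {J : List ⟦ `Job ⟧} {i : ℕ} (k : ℕ) (y : ⟦ `Job ⟧) where

    private
      x : ⟦ `List `Job `× `ℕ `× `Lists ⟧
      x = J , i , lists
      nextStep : Fn (`Job `× (`ℕ `× `List `Step) `× `List `Job `× `ℕ `× `Lists) (`Maybe `Step)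
      nextStep = successor ∘ pair (fst ∘ fst ∘ snd) (snd ∘ snd ∘ snd ∘ snd)

    walk-step : k < m → walkBy x (state k) y ≡ state (suc k)
    walk-step k<m = case-inj₂ nextStep (fst ∘ snd ∘ snd)
      (pair (fst ∘ fst) (cons fst (snd ∘ fst ∘ snd ∘ snd))) {y , state k , x} (successor-at k k<m)

    walk-end : k ≡ m → walkBy x (state k) y ≡ state k
    walk-end k≡m = case-inj₁ nextStep (fst ∘ snd ∘ snd)
      (pair (fst ∘ fst) (cons fst (snd ∘ fst ∘ snd ∘ snd))) {y , state k , x} (successor-end k k≡m)

  -- The second inequality says that enough iterations are left; surplus ones find no successor and
  -- leave the state unchanged.
  walkFrom : ∀ J i ys k → k ≤ m → m ≤ k + length ys →
             foldl (walkBy (J , i , lists)) (state k) ys ≡ state m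
  walkFrom J i []       k k≤m m≤k+0 =
    cong state (≤-antisym k≤m (subst (m ≤_) (+-identityʳ k) m≤k+0))
  walkFrom J i (y ∷ ys) k k≤m m≤ with m≤n⇒m<n∨m≡n k≤m
  ... | inj₁ k<m = trans (cong (λ b → foldl _ b ys) (walk-step {J} {i} k y k<m))
    (walkFrom J i ys (suc k) k<m (subst (m ≤_) (+-suc k (length ys)) m≤))
  ... | inj₂ k≡m = trans (cong (λ b → foldl _ b ys) (walk-end {J} {i} k y k≡m))
    (walkFrom J i ys k k≤m (≤-trans (≤-reflexive (sym k≡m)) (m≤m+n k _)))

  walk≡ : run walk (tabulate jobOf , toℕ s , lists) ≡ state m
  walk≡ = trans
    (cong (λ j → foldl (walkBy (tabulate jobOf , toℕ s , lists)) (toℕ j , []) (tabulate jobOf))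
      (sym at-0))
    (walkFrom (tabulate jobOf) (toℕ s) (tabulate jobOf) 0 z≤n
      (subst (m ≤_) (sym (length-tabulate jobOf)) (<⇒≤ m<n)))

  instance
    n≢0 : NonZero n
    n≢0 = >-nonZero (≤-trans (s≤s z≤n) m<n)

  module _ (bound : ℕ) (num den : ℕ) where

    input : ⟦ `Input ⟧
    input = (encodeTaskGraph G , bound) , num , den

    M : ℕ
    M = quotient den num + 1

    module Optimum o = Optimisation o (toℕ s) step m (<⇒≤ m<n) M bound

    numbered-jobs : run (numbered jobs) input ≡ (n , numberedJobs)
    numbered-jobs = run-numbered jobs {x = input} jobOf refl

    numbered-rows : run (numbered rows) input ≡ (n , proj₂ lists)
    numbered-rows = run-numbered rows {x = input} rowOf refl

    steps≡ : run steps input ≡ reverse (revSteps m)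
    steps≡ = cong reverse (trans
      (cong₂ (λ E R → proj₂ (run walk (tabulate jobOf , toℕ s , proj₂ E , proj₂ R)))
        numbered-jobs numbered-rows)
      (cong proj₂ walk≡))

    scale≡ : run scale input ≡ n * M
    scale≡ = cong (λ E → proj₁ E * M) numbered-jobs

    final≡ : ∀ o → run (final o) input ≡ Optimum.fin o
    final≡ o = cong₂ (λ S (Q , L) → run (guesses o) S , (Q , downFrom L , S , toℕ s) , bound)
      steps≡ (cong₂ _,_ scale≡
        (trans (cong₂ (λ E Q → proj₁ E * Q + 1) numbered-jobs scale≡) (+-comm _ 1)))

    scheme≡ : ∀ o → run (scheme o) input ≡ run assemble (run (optimum o) (Optimum.fin o) , numberedJobs)
    scheme≡ o = cong₂ (λ F E → run assemble (run (optimum o) F , proj₂ E)) (final≡ o) numbered-jobs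

  module _ (σ : Assignment) (starts : σ 0 ≡ inj₁ tt) (ends : σ m ≡ inj₁ tt)
    (arcs : ∀ {i} → i < m → ∃[ u ] arc σ i ≡ inj₂ u) where
    open ToSchedule σ starts ends arcs
    open Schedule schedule

    assemble≡ : ∀ {e} → run path e ≡ pathOf σ m →
                run assemble (inj₂ e , numberedJobs) ≡ inj₂ (encodeSchedule schedule)
    assemble≡ {e} p = cong inj₂ (collect-reverse-tabulate
      {g = λ y → run placement (y , e , inj₂ e , numberedJobs)} (number jobOf)
      (λ j → encodeSide (side j) , C j) place)
      where
      xⱼ : Job → ⟦ (`ℕ `× `Job) `× `Entry `× `Maybe `Entry `× `List (`ℕ `× `Job) ⟧
      xⱼ j = number jobOf j , e , inj₂ e , numberedJobs
      place : ∀ j → run placement (xⱼ j) ≡ inj₂ (encodeSide (side j) , C j)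
      place j = case-inj₂ (byKey (fst ∘ fst) (path ∘ fst ∘ snd)) (inl unit) (inr (snd ∘ fst))
        {xⱼ j} {toℕ j , encodeSide (side j) , C j}
        (byKey-unique (fst ∘ fst) (path ∘ fst ∘ snd)
          {x = xⱼ j} {encodeSide (side j) , C j}
          (subst₂ (λ i l → (toℕ i , encodeSide (side i) , C i) ∈ l) (at-position j) (sym p)
            (path-∈ (s≤s⁻¹ (subst (position j <_) n≡1+m (position<n j)))))
          unique)
        where
        unique : ∀ {z} → z ∈ run path e → proj₁ z ≡ toℕ j → z ≡ (toℕ j , encodeSide (side j) , C j)
        unique z∈ k with j′ , refl ← path-∈⁻ (subst (_ ∈_) p z∈) with refl ← toℕ-injective k = refl

-- The approximation guarantee

precision : ℚ → ℕ
precision ε = quotient (↧ₙ ε) ∣ ↥ ε ∣ + 1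

-- A number is at most its floor plus one, here for 1/ε and with denominators cleared.
precision-spec : ∀ ε .{{_ : Positive ε}} → ↧ₙ ε ≤ precision ε * ∣ ↥ ε ∣
precision-spec ε@(mkℚ (ℤ.+ suc a) b _) =
  subst (λ M → suc b ≤ M * suc a) (+-comm 1 (suc b / suc a)) (<1+quotient-* (suc b) a)

-- The first hypothesis says that the excess of `v` over `w` is at most w / M, and the second that 1
-- / M is at most num / den. The case split makes the excess a natural number.
cross-multiply : ∀ {v w M num den} → v * M ≤ w * suc M → den ≤ M * num →
                 v * den ≤ (den + num) * w
cross-multiply {v} {w} {M} {num} {den} v≤ den≤ with ≤-total v w
... | inj₁ v≤w = begin
  v * den           ≤⟨ *-monoˡ-≤ den v≤w ⟩
  w * den           ≡⟨ *-comm w den ⟩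
  den * w           ≤⟨ *-monoˡ-≤ w (m≤m+n den num) ⟩
  (den + num) * w   ∎
  where open ≤-Reasoning
... | inj₂ w≤v = begin
  v * den                    ≡⟨ cong (_* den) (m+[n∸m]≡n w≤v) ⟨
  (w + δ) * den              ≡⟨ *-distribʳ-+ den w δ ⟩
  w * den + δ * den          ≤⟨ +-monoʳ-≤ (w * den) (*-monoʳ-≤ δ den≤) ⟩
  w * den + δ * (M * num)    ≡⟨ cong (λ x → w * den + x) (*-assoc δ M num) ⟨
  w * den + δ * M * num      ≤⟨ +-monoʳ-≤ (w * den) (*-monoˡ-≤ num δM≤w) ⟩
  w * den + w * num          ≡⟨ *-distribˡ-+ w den num ⟨
  w * (den + num)            ≡⟨ *-comm w (den + num) ⟩
  (den + num) * w            ∎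
  where
  open ≤-Reasoning
  δ = v ∸ w
  δM≤w : δ * M ≤ w
  δM≤w = +-cancelˡ-≤ (w * M) _ _ (begin
    w * M + δ * M   ≡⟨ *-distribʳ-+ M w δ ⟨
    (w + δ) * M     ≡⟨ cong (_* M) (m+[n∸m]≡n w≤v) ⟩
    v * M           ≤⟨ v≤ ⟩
    w * suc M       ≡⟨ *-suc w M ⟩
    w + w * M       ≡⟨ +-comm w (w * M) ⟩
    w * M + w       ∎)

-- Unnormalised rationals are compared by cross-multiplication, which reduces the claim to
-- `cross-multiply`.
within-ε : ∀ ε .{{_ : Positive ε}} {v w} → v * precision ε ≤ w * suc (precision ε) →
           fromℕ v ℚ.≤ (1ℚ ℚ.+ ε) ℚ.* fromℕ w
within-ε ε@(mkℚ (ℤ.+ suc a) b _) {v} {w} v≤ = ℚ.toℚᵘ-cancel-≤ (begin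
  toℚᵘ (fromℕ v)                         ≃⟨ ℚ.toℚᵘ-fromℚᵘ (mkℚᵘ (ℤ.+ v) 0) ⟩
  mkℚᵘ (ℤ.+ v) 0                           ≤⟨ *≤* le ⟩
  (ℚᵘ.1ℚᵘ ℚᵘ.+ toℚᵘ ε) ℚᵘ.* mkℚᵘ (ℤ.+ w) 0
    ≃⟨ ℚᵘ.*-cong (ℚ.toℚᵘ-homo-+ 1ℚ ε) (ℚ.toℚᵘ-fromℚᵘ (mkℚᵘ (ℤ.+ w) 0)) ⟨
  toℚᵘ (1ℚ ℚ.+ ε) ℚᵘ.* toℚᵘ (fromℕ w)     ≃⟨ ℚ.toℚᵘ-homo-* (1ℚ ℚ.+ ε) (fromℕ w) ⟨
  toℚᵘ ((1ℚ ℚ.+ ε) ℚ.* fromℕ w)          ∎)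
  where
  open ℚᵘ.≤-Reasoning
  lhs≡ : ℤ.+ (v * suc b) ≡ ℤ.+ v ℤ.* ℤ.+ suc ((b + 0) * 1)
  lhs≡ = trans (ℤ.pos-* v (suc b))
    (cong (λ d → ℤ.+ v ℤ.* ℤ.+ suc d) (sym (trans (*-identityʳ (b + 0)) (+-identityʳ b))))
  rhs≡ : ℤ.+ ((suc b + suc a) * w) ≡ (ℤ.+ 1 ℤ.* ℤ.+ suc b ℤ.+ ℤ.+ suc a ℤ.* ℤ.+ 1) ℤ.* ℤ.+ w ℤ.* ℤ.+ 1
  rhs≡ = trans (ℤ.pos-* (suc b + suc a) w) (sym (trans (ℤ.*-identityʳ _)
    (cong (ℤ._* ℤ.+ w) (cong₂ ℤ._+_ (ℤ.*-identityˡ (ℤ.+ suc b)) (ℤ.*-identityʳ (ℤ.+ suc a))))))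
  le : ℤ.+ v ℤ.* ℤ.+ suc ((b + 0) * 1) ℤ.≤ (ℤ.+ 1 ℤ.* ℤ.+ suc b ℤ.+ ℤ.+ suc a ℤ.* ℤ.+ 1) ℤ.* ℤ.+ w ℤ.* ℤ.+ 1
  le = subst₂ ℤ._≤_ lhs≡ rhs≡ (+≤+
    (cross-multiply {v} {w} {precision ε} {suc a} {suc b} v≤ (precision-spec ε)))

-- `ceiling` is the negated floor of the negation. For a negative dividend that floor rounds away
-- from zero, so its absolute value is the quotient or one more, depending on the remainder.
quotient≤⌈1/⌉ : ∀ ε .{{_ : Positive ε}} → quotient (↧ₙ ε) ∣ ↥ ε ∣ ≤ ⌈1/ ε ⌉
quotient≤⌈1/⌉ (mkℚ (ℤ.+ suc a) b _) = begin
  suc b / suc a                          ≤⟨ go ⟩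
  ∣ ℤ.-[1+ b ] ℤ./ℕ suc a ∣               ≡⟨ cong ∣_∣ (ℤ.*-identityˡ (ℤ.-[1+ b ] ℤ./ℕ suc a)) ⟨
  ∣ ℤ.1ℤ ℤ.* (ℤ.-[1+ b ] ℤ./ℕ suc a) ∣    ≡⟨ ℤ.∣-i∣≡∣i∣ (ℤ.1ℤ ℤ.* (ℤ.-[1+ b ] ℤ./ℕ suc a)) ⟨
  ∣ ℤ.- (ℤ.1ℤ ℤ.* (ℤ.-[1+ b ] ℤ./ℕ suc a)) ∣  ∎
  where
  open ≤-Reasoning
  go : suc b / suc a ≤ ∣ ℤ.-[1+ b ] ℤ./ℕ suc a ∣
  go with suc b % suc a
  ... | zero  = ≤-reflexive (sym (ℤ.∣-i∣≡∣i∣ (ℤ.+ (suc b / suc a))))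
  ... | suc _ = n≤1+n _

[]≤⁺ : ∀ {x y b} → x ≡ just y → y ≤ b → x ≤⁺ just b
[]≤⁺ refl le = [ le ]

[]≤⁺⁻ : ∀ {x y b} → x ≡ just y → x ≤⁺ just b → y ≤ b
[]≤⁺⁻ refl [ le ] = le

module _ (G : TaskGraph) (chain : IsChain G) (bound : ℕ) (ε : ℚ) .{{ε>0 : Positive ε}} where
  open TaskGraph G
  open ChainGraph G chain
  open Walking G chain

  within-ε⁺ : ∀ {x y v w} → x ≡ just v → y ≡ just w →
              v * precision ε ≤ w * suc (precision ε) → x ≤[1+ ε ]· y
  within-ε⁺ {v = v} {w} refl refl le = [ within-ε ε {v} {w} le ]

  Answer : Objective → ⟦ `Output ⟧ → Set
  Answer minCost     = Approximates (minCostWithinDeadline IsChain) ((G , chain) , bound) ε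
  Answer minMakespan = Approximates (minMakespanWithinBudget IsChain) ((G , chain) , bound) ε

  approximates : ∀ o {e} → Optimum.Outcome bound ∣ ↥ ε ∣ (↧ₙ ε) o e →
                 Answer o (run assemble (e , numberedJobs))
  approximates minCost (Optimisation.infeasible ¬σ) = infeasible λ S (valid , S≤d) →
    let open FromSchedule S valid in
    ¬σ assignment record
      { starts = assignment-starts ; ends = assignment-ends ; arcs = assignment-arcs
      ; within = ≤-trans time≤makespan S≤d }
  approximates minMakespan (Optimisation.infeasible ¬σ) = infeasible λ S (valid , S≤b) →
    let open FromSchedule S valid in
    ¬σ assignment record
      { starts = assignment-starts ; ends = assignment-ends ; arcs = assignment-arcs
      ; within = []≤⁺⁻ cost≡total S≤b }
  approximates minCost (Optimisation.solved {e} σ sol best) =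
    subst (Answer minCost) (sym (assemble≡ σ starts ends arcs {e} path≡))
      (solution schedule (valid , within) λ where
        opt ((S , (vS , S≤d) , refl) , _) →
          let module S = FromSchedule S vS in
          within-ε⁺ cost≡total S.cost≡total (best record
            { starts = S.assignment-starts ; ends = S.assignment-ends
            ; arcs = S.assignment-arcs ; within = ≤-trans S.time≤makespan S≤d }))
    where
    open Optimisation.Solves sol
    open Optimisation.Admissible feasible
    open ToSchedule σ starts ends arcs
  approximates minMakespan (Optimisation.solved {e} σ sol best) =
    subst (Answer minMakespan) (sym (assemble≡ σ starts ends arcs {e} path≡))
      (solution schedule (valid , []≤⁺ cost≡total within) λ where
        opt ((S , (vS , S≤b) , refl) , _) →
          let module S = FromSchedule S vS in
          -- The competitor may idle, so its makespan only bounds its total from above, whereas its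
          -- cost equals its total.
          within-ε⁺ {v = proj₁ (total σ m)} {Schedule.makespan S} refl refl (≤-trans
            (best record
              { starts = S.assignment-starts ; ends = S.assignment-ends
              ; arcs = S.assignment-arcs ; within = []≤⁺⁻ S.cost≡total S≤b })
            (*-monoˡ-≤ (suc (precision ε)) S.time≤makespan)))
    where
    open Optimisation.Solves sol
    open Optimisation.Admissible feasible
    open ToSchedule σ starts ends arcs

  scheme-approximates : ∀ o →
    Answer o (run (scheme o) ((encodeTaskGraph G , bound) , encodeℚ ε))
  scheme-approximates o = subst (Answer o) (sym (scheme≡ bound ∣ ↥ ε ∣ (↧ₙ ε) o))
    (approximates o (Optimum.outcome bound ∣ ↥ ε ∣ (↧ₙ ε) o))

-- Resources used by the scheme

module SafeScheme (G : TaskGraph) (chain : IsChain G) (o : Objective) (bound a b : ℕ) where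

  open TaskGraph G
  open ChainGraph G chain
  open Walking G chain

  module O = Optimum bound a b o
  open O using (q; L; fin; sts)

  module Budget (len num P : ℕ)
    (pˢ≤ : ∀ j → pˢ j ≤ P) (pᶜ≤ : ∀ j {r} → pᶜ j ≡ just r → r ≤ P)
    (delay≤ : ∀ i j {c} → delay i j ≡ just c → c ≤ P)
    (entries≤len : suc L + suc L ≤ len)
    (guesses≤len : 1 + n + n + n + n ≤ len)
    (L<num : suc L ≤ num) (nX≤num : n * (P + P) ≤ num) (Xq≤num : (P + P) * q ≤ num)
    (q≤num : q ≤ num) (bound≤num : bound ≤ num)
    (n≤num : n ≤ num) (a≤num : a ≤ num) (b≤num : b ≤ num) (M≤num : M bound a b ≤ num)
    where

    open Resources len num
    open ResourcesOfCombinators len num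
    open Steps step

    step-bounded : ∀ {i} → i < m → Bounded P (step i)
    step-bounded {i} i<m =
      delay≤ (at i) (at (suc i)) (delay-at i<m) , pˢ≤ (at (suc i)) , cloud≤
      where
      cloud≤ : ∀ {r} → encodeMaybe (pᶜ (at (suc i))) ≡ inj₂ r → r ≤ P
      cloud≤ e with just r ← pᶜ (at (suc i)) in p = subst (_≤ P) (inj₂-injective e) (pᶜ≤ _ p)

    open SafeSearch o (toℕ s) step m (<⇒≤ m<n) (M bound a b) bound len num P step-bounded
      entries≤len guesses≤len (≤-trans (n≤1+n L) L<num) nX≤num Xq≤num q≤num bound≤num

    1≤num : 1 ≤ num
    1≤num = ≤-trans (s≤s z≤n) L<num

    toℕ≤num : ∀ (j : Job) → toℕ j ≤ num
    toℕ≤num j = ≤-trans (<⇒≤ (toℕ<n j)) n≤num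

    I : ⟦ `Input ⟧
    I = input bound a b

    safe-numbered-tabulate : ∀ {γ σ} (xs : Fn γ (`List σ)) {x} (h : Job → ⟦ σ ⟧) → Safe xs x →
                             run xs x ≡ tabulate h → Safe (numbered xs) x
    safe-numbered-tabulate xs {x} h p e =
      safe-numbered xs p 1≤num (≤-trans (≤-reflexive l) n≤len) (≤-trans (≤-reflexive l) n≤num)
      where
      l : length (run xs x) ≡ n
      l = trans (cong length e) (length-tabulate h)

    safe-jobs : Safe (numbered jobs) I
    safe-jobs = safe-numbered-tabulate jobs {I} jobOf _ refl

    safe-rows : Safe (numbered rows) I
    safe-rows = safe-numbered-tabulate rows {I} rowOf _ refl

    length-number : ∀ {A : Set} (h : Job → A) → length (reverse (tabulate (number h))) ≤ len
    length-number h = ≤-trans (≤-reflexive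
      (trans (length-reverse (tabulate (number h))) (length-tabulate (number h)))) n≤len

    key≤num : ∀ {A : Set} (h : Job → A) {z} → z ∈ reverse (tabulate (number h)) → proj₁ z ≤ num
    key≤num h z∈ with j , refl ← number-∈⁻ h z∈ = toℕ≤num j

    safe-byKey : ∀ {γ σ} (k : Fn γ `ℕ) (xs : Fn γ (`List (`ℕ `× σ))) {x} → Safe k x → Safe xs x →
                 run k x ≤ num → length (run xs x) ≤ len →
                 (∀ {z} → z ∈ run xs x → proj₁ z ≤ num) → Safe (byKey k xs) x
    safe-byKey {γ} {σ} k xs {x} p q′ k≤ l keys≤ =
      safe-pick (eq (fst ∘ fst) (k ∘ snd)) (lit 0) xs {x} q′ l
        (λ {z} z∈ → safe-eq {(`ℕ `× σ) `× γ} (fst ∘ fst) (k ∘ snd) {z , x} _ (_ , p) (keys≤ z∈) k≤ ,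
                    _ , z≤n)

    safe-successor : ∀ k → Safe successor (x₀ k)
    safe-successor k =
      safe-case (byKey fst (snd ∘ snd)) (inl unit) resolveRow {x₀ k}
        (safe-byKey fst (snd ∘ snd) {x₀ k} _ _ (toℕ≤num (at k)) (length-number rowOf) (key≤num rowOf))
        (λ _ → tt)
        λ {y} r → subst (λ y → Safe resolveRow (y , x₀ k))
          (inj₂-injective (trans (sym (row-found k)) r)) safe-row
      where
      safe-job : ∀ c z → z ∈ run (snd ∘ numbered (snd ∘ fst)) (x₁ k) →
                 Safe resolveJob (c , z , x₁ k)
      safe-job c z z∈ =
        safe-case (byKey (fst ∘ fst ∘ snd) (fst ∘ snd ∘ snd ∘ snd ∘ snd)) (inl unit)
          (inr (pair (fst ∘ fst) (pair (fst ∘ snd) (snd ∘ fst)))) {c , z , x₁ k}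
          (safe-byKey (fst ∘ fst ∘ snd) (fst ∘ snd ∘ snd ∘ snd ∘ snd) {c , z , x₁ k} _ _
            (key≤num (λ j → encodeMaybe (delay (at k) j)) (subst (z ∈_) (numbered-row k) z∈))
            (length-number jobOf) (key≤num jobOf))
          (λ _ → tt) (λ _ → _)

      safe-row : Safe resolveRow (x₁ k)
      safe-row =
        safe-case (pick isJust (lit 0) (snd ∘ numbered (snd ∘ fst))) (inl unit) resolveDelay {x₁ k}
          (safe-pick isJust (lit 0) (snd ∘ numbered (snd ∘ fst)) {x₁ k}
            (safe-numbered-tabulate (snd ∘ fst) {x₁ k} _ _ refl , _)
            (subst (λ l → length l ≤ len) (sym (numbered-row k))
              (length-number (λ j → encodeMaybe (delay (at k) j))))
            (λ {z} _ → (_ , by-cases (proj₂ z) (λ _ → tt) (λ _ → tt)) , _ , z≤n))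
          (λ _ → tt)
          (λ {z} r → safe-case (snd ∘ fst) (inl unit) resolveJob {z , x₁ k} _ (λ _ → tt)
            (λ {c} _ → safe-job c z (proj₁ (picked-some (picked isJust (lit 0)
              (snd ∘ numbered (snd ∘ fst)) {x₁ k}) r))))

    walkInput : ⟦ `List `Job `× `ℕ `× `Lists ⟧
    walkInput = tabulate jobOf , toℕ s , lists

    safe-walk : Safe walk walkInput
    safe-walk = _ , ≤-trans (≤-reflexive (length-tabulate jobOf)) n≤len ,
      along OnChain (tabulate jobOf) (λ {y} _ → safe-step y)
        (0 , z≤n , cong (λ j → toℕ j , []) (sym at-0))
      where
      -- Lookups are safe because the current index is that of a job on the path, so the fold has to
      -- carry this fact along.
      OnChain : ⟦ `ℕ `× `List `Step ⟧ → Set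
      OnChain st = ∃[ k ] k ≤ m × st ≡ state k
      safe-step : ∀ y {st} → OnChain st →
                  Safe walkStep (y , st , walkInput) × OnChain (walkBy walkInput st y)
      safe-step y (k , k≤m , refl) =
        safe-case (successor ∘ pair (fst ∘ fst ∘ snd) (snd ∘ snd ∘ snd ∘ snd)) (fst ∘ snd ∘ snd)
          (pair (fst ∘ fst) (cons fst (snd ∘ fst ∘ snd ∘ snd))) {y , state k , walkInput}
          (_ , safe-successor k) (λ _ → _) (λ _ → _) ,
        stays
        where
        stays : OnChain (walkBy walkInput (state k) y)
        stays with m≤n⇒m<n∨m≡n k≤m
        ... | inj₁ k<m = suc k , k<m , walk-step {tabulate jobOf} {toℕ s} k y k<m
        ... | inj₂ k≡m = k , k≤m , walk-end {tabulate jobOf} {toℕ s} k y k≡m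

    safe-steps : Safe steps I
    safe-steps =
      safe-gather (inr fst) (snd ∘ walk ∘ pair jobs
          (pair sourceIndex (pair (snd ∘ numbered jobs) (snd ∘ numbered rows)))) nil {I}
        (((_ , _ , (safe-jobs , _) , (safe-rows , _)) ,
          subst (Safe walk) (sym walkInput≡) safe-walk) , _) _
        (≤-trans (≤-reflexive (trans (cong length walked≡) (length-revSteps m)))
          (≤-trans (<⇒≤ m<n) n≤len))
        (λ _ → _)
      where
      walkInput′ : ⟦ `List `Job `× `ℕ `× `Lists ⟧
      walkInput′ =
        tabulate jobOf , toℕ s , proj₂ (run (numbered jobs) I) , proj₂ (run (numbered rows) I)
      walkInput≡ : walkInput′ ≡ walkInput
      walkInput≡ = cong₂ (λ E R → tabulate jobOf , toℕ s , proj₂ E , proj₂ R)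
        (numbered-jobs bound a b) (numbered-rows bound a b)
      walked≡ : proj₂ (run walk walkInput′) ≡ revSteps m
      walked≡ = cong proj₂ (trans (cong (run walk) walkInput≡) walk≡)

    safe-scale : Safe scale I
    safe-scale = ((safe-jobs , _) , ((_ , b≤num , a≤num) , _) ,
        ≤-trans (m≤m+n _ 1) M≤num , 1≤num) ,
      subst (λ E → proj₁ E ≤ num) (sym (numbered-jobs bound a b)) n≤num , M≤num

    safe-scaledBound : Safe scaledBound I
    safe-scaledBound = ((safe-jobs , _) , safe-scale) ,
      subst (λ E → proj₁ E ≤ num) (sym (numbered-jobs bound a b)) n≤num ,
      subst (_≤ num) (sym (scale≡ bound a b)) q≤num

    scaledBound≡ : run scaledBound I ≡ L
    scaledBound≡ = cong₂ (λ E Q → proj₁ E * Q) (numbered-jobs bound a b) (scale≡ bound a b)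

    safe-final : Safe (final o) I
    safe-final =
      (safe-steps , subst (Safe (guesses o)) (sym (steps≡ bound a b)) safe-guesses) ,
      ((safe-scale ,
        (((safe-scaledBound , _) , subst (_≤ num) (sym scaledBound≡) (≤-trans (n≤1+n L) L<num) , 1≤num) ,
         subst (λ k → k + 1 ≤ len) (sym scaledBound≡) (≤-trans (≤-reflexive (+-comm L 1))
           (≤-trans (m≤m+n (suc L) (suc L)) entries≤len)) ,
         subst (λ k → k + 1 ≤ num) (sym scaledBound≡) (≤-trans (≤-reflexive (+-comm L 1)) L<num)) ,
        safe-steps , _) , _)

    safe-assemble : ∀ {c} → O.Outcome c → Safe assemble (c , numberedJobs)
    safe-assemble (Optimisation.infeasible _) = _
    safe-assemble (Optimisation.solved {e} σ sol _) =
      _ , safe-gather placement (snd ∘ snd) nil {e , inj₂ e , numberedJobs} _ _ (length-number jobOf)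
        λ {z} z∈ → safe-case (byKey (fst ∘ fst) (path ∘ fst ∘ snd)) (inl unit) (inr (snd ∘ fst))
          {x z}
          (safe-byKey (fst ∘ fst) (path ∘ fst ∘ snd) {x z} _ _
            (key≤num jobOf z∈)
            (subst (λ l → length l ≤ len) (sym path≡)
              (≤-trans (≤-reflexive (length-pathOf m)) (≤-trans m<n n≤len)))
            (λ {y} y∈ → path-key (subst (y ∈_) path≡ y∈)))
          (λ _ → tt) (λ _ → _)
      where
      open Optimisation.Solves sol
      open Optimisation.Admissible feasible
      x : ⟦ `ℕ `× `Job ⟧ → ⟦ (`ℕ `× `Job) `× `Entry `× `Maybe `Entry `× `List (`ℕ `× `Job) ⟧
      x z = z , e , inj₂ e , numberedJobs
      length-pathOf : ∀ k → length (pathOf σ k) ≡ suc k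
      length-pathOf zero    = refl
      length-pathOf (suc k) = cong suc (length-pathOf k)
      path-key : ∀ {y} → y ∈ pathOf σ m → proj₁ y ≤ num
      path-key y∈ with j , refl ← ToSchedule.path-∈⁻ σ starts ends arcs y∈ = toℕ≤num j

    safe-scheme : Safe (scheme o) I
    safe-scheme =
      ((safe-final , subst (Safe (optimum o)) (sym (final≡ bound a b o)) safe-optimum) , (safe-jobs , _)) ,
      subst (Safe assemble)
        (sym (cong₂ (λ F E → run (optimum o) F , proj₂ E)
          (final≡ bound a b o) (numbered-jobs bound a b)))
        (safe-assemble O.outcome)

-- Sizes of encodings and the polynomial bound

≤2^bits : ∀ k → k ≤ 2 ^ bits k
≤2^bits k = <⇒≤ (≰⇒> λ 2^≤k → 1+n≰n
  (≤-trans (≤-reflexive (sym (⌊log₂[2^n]⌋≡n (bits k)))) (⌊log₂⌋-mono-≤ 2^≤k)))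

n≤2^n : ∀ k → k ≤ 2 ^ k
n≤2^n zero    = z≤n
n≤2^n (suc k) = +-mono-≤ (m^n>0 2 k) (≤-trans (n≤2^n k) (m≤m+n (2 ^ k) 0))

size-fst : ∀ σ τ p → size σ (proj₁ p) ≤ size (σ `× τ) p
size-fst σ τ p = ≤-trans (m≤m+n _ (size τ (proj₂ p))) (n≤1+n _)

size-snd : ∀ σ τ p → size τ (proj₂ p) ≤ size (σ `× τ) p
size-snd σ τ p = ≤-trans (m≤n+m _ (size σ (proj₁ p))) (n≤1+n _)

size-∈ : ∀ τ {xs x} → x ∈ xs → size τ x ≤ size (`List τ) xs
size-∈ τ x∈ = ≤-trans (go x∈) (n≤1+n _)
  where
  go : ∀ {xs x} → x ∈ xs → size τ x ≤ ListAction.sum (List.map (λ x → suc (size τ x)) xs)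
  go (here refl) = ≤-trans (n≤1+n _) (m≤m+n _ _)
  go (there x∈)  = ≤-trans (go x∈) (m≤n+m _ _)

length≤size : ∀ τ xs → length xs ≤ size (`List τ) xs
length≤size τ xs = ≤-trans (go xs) (n≤1+n _)
  where
  go : ∀ xs → length xs ≤ ListAction.sum (List.map (λ x → suc (size τ x)) xs)
  go []       = z≤n
  go (x ∷ xs) = +-mono-≤ (s≤s z≤n) (go xs)

module _ (P : MinProblem) (f : Fn (MinProblem.instanceTy P `× `ℚ) (`1 `⊎ MinProblem.solutionTy P))
         (i : ℕ) where
  open MinProblem P

  -- The input is a field of its own so that run f and Safe f need not be unfolded to compare
  -- it with an encoded instance.
  record Certified (I : Instance) (ε : ℚ) .{{_ : Positive ε}} : Set where
    field
      {input}      : ⟦ instanceTy `× `ℚ ⟧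
      input≡       : (encodeInstance I , encodeℚ ε) ≡ input
      num          : ℕ
      2≤len        : 2 ≤ (size (instanceTy `× `ℚ) input + ⌈1/ ε ⌉) ^ i
      bits≤len     : bits num ≤ (size (instanceTy `× `ℚ) input + ⌈1/ ε ⌉) ^ i
      safe         : Resources.Safe ((size (instanceTy `× `ℚ) input + ⌈1/ ε ⌉) ^ i) num f input
      approximate  : Approximates P I ε (run f input)

  -- The bound `len ^ degree f`, with `len` the `i`-th power of the size, is a power of the size
  -- with the constant exponent `i * degree f`.
  certified⇒FPTAS : (∀ I ε .{{_ : Positive ε}} → Certified I ε) → HasFPTAS P
  certified⇒FPTAS certify = term f , 1 , i * degree f , λ I ε → go I ε (certify I ε)
    where
    go : ∀ I ε .{{_ : Positive ε}} → Certified I ε →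
         let input = encodeInstance I , encodeℚ ε in
         ∃[ out ] ∃[ time ] Runs (term f) input out time × Approximates P I ε out ×
           time ≤ 1 * (size (instanceTy `× `ℚ) input + ⌈1/ ε ⌉) ^ (i * degree f)
    go I ε record { input≡ = refl ; num = num ; 2≤len = 2≤len ; bits≤len = bits≤len
                  ; safe = safe ; approximate = approximate }
      with Resources.eval _ num 2≤len bits≤len f {γ = []} safe
    ... | Resources.⟨ derivation , steps≤ ⟩ =
      run f _ , _ , derivation , approximate ,
      ≤-trans steps≤ (≤-reflexive (trans (^-*-assoc _ i (degree f)) (sym (*-identityˡ _))))

module Sizes (G : TaskGraph) (chain : IsChain G) (bound : ℕ) (ε : ℚ) .{{ε>0 : Positive ε}} where
  open TaskGraph G
  open Walking G chain

  a b Z S : ℕ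
  a = ∣ ↥ ε ∣
  b = ↧ₙ ε
  Z = size `Input ((encodeTaskGraph G , bound) , a , b)
  S = Z + ⌈1/ ε ⌉

  I : ⟦ `Input ⟧
  I = input bound a b

  instance≤ : size (`TaskGraph `× `ℕ) (proj₁ I) ≤ Z
  instance≤ = size-fst (`TaskGraph `× `ℕ) `ℚ I

  ε≤ : size `ℚ (a , b) ≤ Z
  ε≤ = size-snd (`TaskGraph `× `ℕ) `ℚ I

  graph≤ : size `TaskGraph (encodeTaskGraph G) ≤ Z
  graph≤ = ≤-trans (size-fst `TaskGraph `ℕ (proj₁ I)) instance≤

  jobs≤ : size (`List `Job) (tabulate jobOf) ≤ Z
  jobs≤ = ≤-trans (size-fst (`List `Job) (`List `Row `× `ℕ `× `ℕ) (encodeTaskGraph G)) graph≤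

  rows≤ : size (`List `Row) (tabulate rowOf) ≤ Z
  rows≤ = ≤-trans (size-fst (`List `Row) (`ℕ `× `ℕ) (proj₂ (encodeTaskGraph G)))
    (≤-trans (size-snd (`List `Job) (`List `Row `× `ℕ `× `ℕ) (encodeTaskGraph G)) graph≤)

  number≤ : ∀ {k} → bits k ≤ Z → k ≤ 2 ^ Z
  number≤ {k} le = ≤-trans (≤2^bits k) (^-monoʳ-≤ 2 le)

  job≤ : ∀ j → size `Job (jobOf j) ≤ Z
  job≤ j = ≤-trans (size-∈ `Job (∈-tabulate⁺ {f = jobOf} j)) jobs≤

  pˢ≤ : ∀ j → pˢ j ≤ 2 ^ Z
  pˢ≤ j = number≤ (≤-trans (size-fst `ℕ (`Maybe `ℕ) (jobOf j)) (job≤ j))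

  maybe≤ : ∀ {v r} → size (`Maybe `ℕ) (encodeMaybe v) ≤ Z → v ≡ just r → r ≤ 2 ^ Z
  maybe≤ le refl = number≤ (≤-trans (n≤1+n _) le)

  pᶜ≤ : ∀ j {r} → pᶜ j ≡ just r → r ≤ 2 ^ Z
  pᶜ≤ j = maybe≤ (≤-trans (size-snd `ℕ (`Maybe `ℕ) (jobOf j)) (job≤ j))

  delay≤ : ∀ i j {c} → delay i j ≡ just c → c ≤ 2 ^ Z
  delay≤ i j = maybe≤ (≤-trans (size-∈ (`Maybe `ℕ) (∈-tabulate⁺ {f = λ j → encodeMaybe (delay i j)} j))
    (≤-trans (size-∈ `Row (∈-tabulate⁺ {f = rowOf} i)) rows≤))

  bound≤ : bound ≤ 2 ^ Z
  bound≤ = number≤ (≤-trans (size-snd `TaskGraph `ℕ (proj₁ I)) instance≤)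

  a≤ : a ≤ 2 ^ Z
  a≤ = number≤ (≤-trans (size-fst `ℕ `ℕ (a , b)) ε≤)

  b≤ : b ≤ 2 ^ Z
  b≤ = number≤ (≤-trans (size-snd `ℕ `ℕ (a , b)) ε≤)

  2≤Z : 2 ≤ Z
  2≤Z = s≤s (≤-trans (s≤s z≤n) (m≤n+m _ (size (`TaskGraph `× `ℕ) (encodeTaskGraph G , bound))))

  Z≤S : Z ≤ S
  Z≤S = m≤m+n Z _

  2≤S : 2 ≤ S
  2≤S = ≤-trans 2≤Z Z≤S

  n≤S : n ≤ S
  n≤S = ≤-trans (≤-reflexive (sym (length-tabulate jobOf)))
    (≤-trans (length≤size `Job (tabulate jobOf)) (≤-trans jobs≤ Z≤S))

  μ q L : ℕ
  μ = M bound a b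
  q = n * μ
  L = n * q

  -- The parameter M is at most ⌈1/ε⌉ + 1, and the input size absorbs the 1. This is how 1/ε enters
  -- the running time.
  μ≤S : μ ≤ S
  μ≤S = ≤-trans (+-monoˡ-≤ 1 (quotient≤⌈1/⌉ ε)) (≤-trans (≤-reflexive (+-comm _ 1))
    (+-monoˡ-≤ ⌈1/ ε ⌉ (≤-trans (s≤s z≤n) 2≤Z)))

  -- A layer has at most twice `suc L` entries with `L` at most the cube of `S`, and the successor
  -- and the doubling cost one exponent each: hence 5. The largest product is `(2 ^ Z + 2 ^ Z) * q`,
  -- whose factors are at most `2 ^ (1 + S)` and `2 ^ (S + S)`: hence `num`.
  len num : ℕ
  len = S ^ 5
  num = 2 ^ (1 + (S + (S + S)))

  q≤S² : q ≤ S * S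
  q≤S² = *-mono-≤ n≤S μ≤S

  L≤S³ : L ≤ S * (S * S)
  L≤S³ = *-mono-≤ n≤S q≤S²

  instance
    S≢0 : NonZero S
    S≢0 = >-nonZero (≤-trans (s≤s z≤n) 2≤S)

  S^-mono : ∀ {i j} → i ≤ j → S ^ i ≤ S ^ j
  S^-mono = ^-monoʳ-≤ S

  S³≡ : S * (S * S) ≡ S ^ 3
  S³≡ = cong (λ x → S * (S * x)) (sym (*-identityʳ S))

  double : ∀ i {x y} → x ≤ S ^ i → y ≤ S ^ i → x + y ≤ S ^ suc i
  double i {x} {y} p r = begin
    x + y              ≤⟨ +-mono-≤ p r ⟩
    S ^ i + S ^ i      ≡⟨ cong (S ^ i +_) (+-identityʳ _) ⟨
    2 * S ^ i          ≤⟨ *-monoˡ-≤ (S ^ i) 2≤S ⟩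
    S ^ suc i          ∎
    where open ≤-Reasoning

  S≤S¹ : S ≤ S ^ 1
  S≤S¹ = ≤-reflexive (sym (*-identityʳ S))

  entries≤len : suc L + suc L ≤ len
  entries≤len = double 4 1+L≤ 1+L≤
    where
    1+L≤ : suc L ≤ S ^ 4
    1+L≤ = double 3 (m^n>0 S 3) (≤-trans L≤S³ (≤-reflexive S³≡))

  guesses≤len : 1 + n + n + n + n ≤ len
  guesses≤len = double 4 (double 3 (double 2 (double 1 (m^n>0 S 1) n≤) (up 2)) (up 3)) (up 4)
    where
    n≤ : n ≤ S ^ 1
    n≤ = ≤-trans n≤S S≤S¹
    up : ∀ i → .{{NonZero i}} → n ≤ S ^ i
    up (suc i) = ≤-trans n≤ (S^-mono (s≤s (z≤n {i})))

  bits≤len : bits num ≤ len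
  bits≤len = ≤-trans (≤-reflexive (cong suc (⌊log₂[2^n]⌋≡n _)))
    (≤-trans (double 3 (≤-trans (≤-trans 2≤S S≤S¹) (S^-mono (s≤s (z≤n {2}))))
      (double 2 (≤-trans S≤S¹ (S^-mono (s≤s (z≤n {1})))) (double 1 S≤S¹ S≤S¹)))
      (S^-mono (n≤1+n 4)))

  2≤len : 2 ≤ len
  2≤len = ≤-trans 2≤S (≤-trans S≤S¹ (S^-mono (s≤s (z≤n {4}))))

  S≤2^S : S ≤ 2 ^ S
  S≤2^S = n≤2^n S

  small : ∀ {x} → x ≤ 2 ^ (S + (S + S)) → x ≤ num
  small p = ≤-trans p (^-monoʳ-≤ 2 (n≤1+n (S + (S + S))))

  2^Z≤num : ∀ {x} → x ≤ 2 ^ Z → x ≤ num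
  2^Z≤num p = small (≤-trans p (^-monoʳ-≤ 2 (≤-trans Z≤S (m≤m+n S (S + S)))))

  S≤num : ∀ {x} → x ≤ S → x ≤ num
  S≤num p = small (≤-trans (≤-trans p S≤2^S) (^-monoʳ-≤ 2 (m≤m+n S (S + S))))

  S²≤2^ : S * S ≤ 2 ^ (S + S)
  S²≤2^ = ≤-trans (*-mono-≤ S≤2^S S≤2^S) (≤-reflexive (sym (^-distribˡ-+-* 2 S S)))

  q≤num : q ≤ num
  q≤num = small (≤-trans q≤S² (≤-trans S²≤2^ (^-monoʳ-≤ 2 (m≤n+m (S + S) S))))

  L<num : suc L ≤ num
  L<num = begin
    1 + L                                      ≤⟨ +-mono-≤ (m^n>0 2 (S + (S + S))) L≤ ⟩
    2 ^ (S + (S + S)) + 2 ^ (S + (S + S))      ≡⟨ cong (2 ^ (S + (S + S)) +_) (+-identityʳ _) ⟨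
    num                                        ∎
    where
    open ≤-Reasoning
    L≤ : L ≤ 2 ^ (S + (S + S))
    L≤ = ≤-trans L≤S³ (≤-trans (*-mono-≤ S≤2^S S²≤2^) (≤-reflexive (sym (^-distribˡ-+-* 2 S (S + S)))))

  X≤ : 2 ^ Z + 2 ^ Z ≤ 2 ^ (1 + S)
  X≤ = ≤-trans (+-mono-≤ Z≤ Z≤) (≤-reflexive (cong (2 ^ S +_) (sym (+-identityʳ _))))
    where
    Z≤ : 2 ^ Z ≤ 2 ^ S
    Z≤ = ^-monoʳ-≤ 2 Z≤S

  Xq≤num : (2 ^ Z + 2 ^ Z) * q ≤ num
  Xq≤num = ≤-trans (*-mono-≤ X≤ (≤-trans q≤S² S²≤2^))
    (≤-reflexive (sym (^-distribˡ-+-* 2 (1 + S) (S + S))))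

  nX≤num : n * (2 ^ Z + 2 ^ Z) ≤ num
  nX≤num = ≤-trans (≤-trans (≤-reflexive (*-comm n _)) (*-monoʳ-≤ (2 ^ Z + 2 ^ Z) n≤q)) Xq≤num
    where
    n≤q : n ≤ q
    n≤q = ≤-trans (≤-reflexive (sym (*-identityʳ n))) (*-monoʳ-≤ n (m≤n+m 1 _))

  open Resources len num

  safe : ∀ o → Safe (scheme o) I
  safe o = SafeScheme.Budget.safe-scheme G chain o bound a b len num (2 ^ Z) pˢ≤ pᶜ≤ delay≤
    entries≤len guesses≤len L<num nX≤num Xq≤num q≤num (2^Z≤num bound≤)
    (S≤num n≤S) (2^Z≤num a≤) (2^Z≤num b≤) (S≤num μ≤S)

  certifiedCost : Certified (minCostWithinDeadline IsChain) (scheme minCost) 5 ((G , chain) , bound) ε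
  certifiedCost = record
    { input≡ = refl {x = I} ; num = num ; 2≤len = 2≤len ; bits≤len = bits≤len
    ; safe = safe minCost ; approximate = scheme-approximates G chain bound ε minCost }

  certifiedMakespan :
    Certified (minMakespanWithinBudget IsChain) (scheme minMakespan) 5 ((G , chain) , bound) ε
  certifiedMakespan = record
    { input≡ = refl {x = I} ; num = num ; 2≤len = 2≤len ; bits≤len = bits≤len
    ; safe = safe minMakespan ; approximate = scheme-approximates G chain bound ε minMakespan }

theorem4 : HasFPTAS (minCostWithinDeadline IsChain) × HasFPTAS (minMakespanWithinBudget IsChain)
theorem4 =
  certified⇒FPTAS (minCostWithinDeadline IsChain) (scheme minCost) 5
    (λ ((G , chain) , bound) ε → Sizes.certifiedCost G chain bound ε) ,
  certified⇒FPTAS (minMakespanWithinBudget IsChain) (scheme minMakespan) 5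
    (λ ((G , chain) , bound) ε → Sizes.certifiedMakespan G chain bound ε)
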